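{- If $k\ge3$ is odd, then $\mathcal{O}(\mathbb{C},k)=\emptyset$; that is, every overlap in $\mathbb{C}$ with respect to $\phi=\exp(2\pi\mathrm{i}/k)$ is trivial.
   Context: $\mathbf{k}=\{1,\dots,k-1\}$, $\mathbf{k}_0=\{0,\dots,k-1\}$. A quadruple $(i,j\mid s,t)\in\mathbf{k}^4$ with $i\ne s$ is an overlap if $\phi^\omega(\phi^j-1)(\phi^s-1)=(\phi^i-1)(\phi^t-1)$ for some $\omega\in\mathbf{k}_0$; it is trivial if one of $i\equiv\pm j$, $j\equiv\pm t$, $t\equiv\pm s$, $s\equiv\pm i\pmod k$ holds, nontrivial otherwise. $\mathcal{O}(\mathbb{C},k)$ is the set of nontrivial overlaps. -}

module Defs where

open import Algebra.Bundles.Raw using (RawRing)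
import Algebra.Definitions.RawSemiring as RawSemiringDefinitions
open import Data.Fin.Base using (toℕ)
open import Data.Integer.Base as ℤ using (ℤ; +_)
import Data.Integer.Divisibility as ℤ
open import Data.Nat.Base as ℕ using (ℕ; NonZero; _!)
import Data.Nat.Properties as ℕ
open import Data.Product.Base using (∃-syntax; _×_; _,_)
open import Data.Rational.Base as ℚ using (ℚ; 0ℚ; 1ℚ; ½)
import Data.Rational.Properties as ℚ
open import Data.Rational.Solver using (module +-*-Solver)
open import Data.Sum.Base using (_⊎_; inj₁; inj₂)
open import Level using (0ℓ)
open import Relation.Binary.PropositionalEquality
  using (_≡_; _≢_; refl; sym; trans; cong; cong₂; subst; subst₂; module ≡-Reasoning)
open import Relation.Nullary.Negation using (¬_)
open import Relation.Unary using (Pred; _∈_; _∉_)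

open +-*-Solver using (solve; _:=_; _:+_; _:-_; :-_)

Cauchy : (ℕ → ℚ) → Set
Cauchy x = ∀ {ε} → 0ℚ ℚ.< ε →
  ∃[ N ] (∀ {m n} → N ℕ.≤ m → N ℕ.≤ n → ℚ.∣ x m ℚ.- x n ∣ ℚ.< ε)

∣p∣-∣q∣≤∣p-q∣ : ∀ p q → ℚ.∣ p ∣ ℚ.- ℚ.∣ q ∣ ℚ.≤ ℚ.∣ p ℚ.- q ∣
∣p∣-∣q∣≤∣p-q∣ p q = subst (ℚ.∣ p ∣ ℚ.- ℚ.∣ q ∣ ℚ.≤_)
  (solve 2 (λ u v → (u :+ v) :- v := u) refl ℚ.∣ p ℚ.- q ∣ ℚ.∣ q ∣)
  (ℚ.+-monoˡ-≤ (ℚ.- ℚ.∣ q ∣)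
    (subst (λ r → ℚ.∣ r ∣ ℚ.≤ ℚ.∣ p ℚ.- q ∣ ℚ.+ ℚ.∣ q ∣)
      (solve 2 (λ u v → (u :- v) :+ v := u) refl p q)
      (ℚ.∣p+q∣≤∣p∣+∣q∣ (p ℚ.- q) q)))

∣p-q∣≡∣q-p∣ : ∀ p q → ℚ.∣ p ℚ.- q ∣ ≡ ℚ.∣ q ℚ.- p ∣
∣p-q∣≡∣q-p∣ p q = trans
  (cong ℚ.∣_∣ (solve 2 (λ u v → u :- v := :- (v :- u)) refl p q))
  (ℚ.∣-p∣≡∣p∣ (q ℚ.- p))

∣∣p∣-∣q∣∣≤∣p-q∣ : ∀ p q → ℚ.∣ ℚ.∣ p ∣ ℚ.- ℚ.∣ q ∣ ∣ ℚ.≤ ℚ.∣ p ℚ.- q ∣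
∣∣p∣-∣q∣∣≤∣p-q∣ p q with ℚ.∣p∣≡p∨∣p∣≡-p (ℚ.∣ p ∣ ℚ.- ℚ.∣ q ∣)
... | inj₁ eq = subst (ℚ._≤ ℚ.∣ p ℚ.- q ∣) (sym eq) (∣p∣-∣q∣≤∣p-q∣ p q)
... | inj₂ eq = subst₂ ℚ._≤_
  (trans (solve 2 (λ u v → v :- u := :- (u :- v)) refl ℚ.∣ p ∣ ℚ.∣ q ∣) (sym eq))
  (∣p-q∣≡∣q-p∣ q p)
  (∣p∣-∣q∣≤∣p-q∣ q p)

const-cauchy : ∀ p → Cauchy (λ _ → p)
const-cauchy p {ε} 0<ε =
  0 , λ _ _ → subst (λ r → ℚ.∣ r ∣ ℚ.< ε) (sym (ℚ.+-inverseʳ p)) 0<ε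

∣∣-cauchy : ∀ {x} → Cauchy x → Cauchy (λ n → ℚ.∣ x n ∣)
∣∣-cauchy {x} cx 0<ε with cx 0<ε
... | N , close = N , λ {m} {n} N≤m N≤n →
  ℚ.≤-<-trans (∣∣p∣-∣q∣∣≤∣p-q∣ (x m) (x n)) (close N≤m N≤n)

neg-cauchy : ∀ {x} → Cauchy x → Cauchy (λ n → ℚ.- x n)
neg-cauchy {x} cx {ε} 0<ε with cx 0<ε
... | N , close = N , λ {m} {n} N≤m N≤n → subst (ℚ._< ε)
  (trans (sym (ℚ.∣-p∣≡∣p∣ (x m ℚ.- x n)))
         (cong ℚ.∣_∣ (solve 2 (λ u v → :- (u :- v) := :- u :- :- v) refl (x m) (x n))))
  (close N≤m N≤n)

+-cauchy : ∀ {x y} → Cauchy x → Cauchy y → Cauchy (λ n → x n ℚ.+ y n)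
+-cauchy {x} {y} cx cy {ε} 0<ε with cx ½ε>0 | cy ½ε>0
  where
  ½ε>0 : 0ℚ ℚ.< ½ ℚ.* ε
  ½ε>0 = subst (ℚ._< ½ ℚ.* ε) (ℚ.*-zeroʳ ½) (ℚ.*-monoʳ-<-pos ½ 0<ε)
... | M , closeˣ | N , closeʸ = M ℕ.⊔ N , λ {m} {n} ≤m ≤n →
  subst₂ (λ p q → ℚ.∣ p ∣ ℚ.< q)
    (solve 4 (λ a b c d → (a :- b) :+ (c :- d) := (a :+ c) :- (b :+ d)) refl
      (x m) (x n) (y m) (y n))
    (trans (sym (ℚ.*-distribʳ-+ ε ½ ½)) (ℚ.*-identityˡ ε))
    (ℚ.≤-<-trans (ℚ.∣p+q∣≤∣p∣+∣q∣ (x m ℚ.- x n) (y m ℚ.- y n))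
      (ℚ.+-mono-<
        (closeˣ (ℕ.m⊔n≤o⇒m≤o M N ≤m) (ℕ.m⊔n≤o⇒m≤o M N ≤n))
        (closeʸ (ℕ.m⊔n≤o⇒n≤o M N ≤m) (ℕ.m⊔n≤o⇒n≤o M N ≤n))))

cauchy-bounded : ∀ {x} → Cauchy x →
  ∃[ B ] 0ℚ ℚ.< B × ∃[ N ] (∀ {n} → N ℕ.≤ n → ℚ.∣ x n ∣ ℚ.≤ B)
cauchy-bounded {x} cx with cx {1ℚ} (ℚ.positive⁻¹ 1ℚ)
... | N , close =
  1ℚ ℚ.+ ℚ.∣ x N ∣ ,
  ℚ.+-mono-<-≤ (ℚ.positive⁻¹ 1ℚ) (ℚ.0≤∣p∣ (x N)) ,
  N , λ {n} N≤n → subst (λ r → ℚ.∣ r ∣ ℚ.≤ 1ℚ ℚ.+ ℚ.∣ x N ∣)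
    (solve 2 (λ u v → (u :- v) :+ v := u) refl (x n) (x N))
    (ℚ.≤-trans (ℚ.∣p+q∣≤∣p∣+∣q∣ (x n ℚ.- x N) (x N))
      (ℚ.+-monoˡ-≤ ℚ.∣ x N ∣ (ℚ.<⇒≤ (close N≤n ℕ.≤-refl))))

split-ε : ∀ {A B ε} → 0ℚ ℚ.< A → 0ℚ ℚ.< B → 0ℚ ℚ.< ε →
  ∃[ δ ] 0ℚ ℚ.< δ × A ℚ.* δ ℚ.+ B ℚ.* δ ≡ ε
split-ε {A} {B} {ε} 0<A 0<B 0<ε = scale (A ℚ.+ B) (ℚ.+-mono-< 0<A 0<B) refl
  where
  scale : ∀ S → 0ℚ ℚ.< S → A ℚ.+ B ≡ S → ∃[ δ ] 0ℚ ℚ.< δ × A ℚ.* δ ℚ.+ B ℚ.* δ ≡ ε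
  scale S 0<S A+B≡S = r ℚ.* ε , 0<rε , eq
    where
    instance
      _ : ℚ.Positive S
      _ = ℚ.positive 0<S
      _ : ℚ.NonZero S
      _ = ℚ.pos⇒nonZero S
    r : ℚ
    r = ℚ.1/ S
    0<rε : 0ℚ ℚ.< r ℚ.* ε
    0<rε = subst (ℚ._< r ℚ.* ε) (ℚ.*-zeroʳ r)
      (ℚ.*-monoʳ-<-pos r {{ℚ.1/pos⇒pos S}} 0<ε)
    eq : A ℚ.* (r ℚ.* ε) ℚ.+ B ℚ.* (r ℚ.* ε) ≡ ε
    eq = trans (sym (ℚ.*-distribʳ-+ (r ℚ.* ε) A B))
      (trans (cong (ℚ._* (r ℚ.* ε)) A+B≡S)
      (trans (sym (ℚ.*-assoc S r ε))
      (trans (cong (ℚ._* ε) (ℚ.*-inverseʳ S)) (ℚ.*-identityˡ ε))))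

∣p*q∣<C*δ : ∀ {C δ} p q → 0ℚ ℚ.< C → ℚ.∣ p ∣ ℚ.≤ C → ℚ.∣ q ∣ ℚ.< δ →
  ℚ.∣ p ℚ.* q ∣ ℚ.< C ℚ.* δ
∣p*q∣<C*δ {C} {δ} p q 0<C ∣p∣≤C ∣q∣<δ = subst (ℚ._< C ℚ.* δ)
  (sym (ℚ.∣p*q∣≡∣p∣*∣q∣ p q))
  (ℚ.≤-<-trans
    (ℚ.*-monoʳ-≤-nonNeg ℚ.∣ q ∣ {{ℚ.∣-∣-nonNeg q}} ∣p∣≤C)
    (ℚ.*-monoʳ-<-pos C {{ℚ.positive 0<C}} ∣q∣<δ))

telescope : ∀ a b c d → a ℚ.* (c ℚ.- d) ℚ.+ d ℚ.* (a ℚ.- b) ≡ a ℚ.* c ℚ.- b ℚ.* d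
telescope a b c d = begin
  a * (c - d) + d * (a - b)             ≡⟨ cong₂ _+_ (ℚ.*-distribˡ-+ a c (- d)) (ℚ.*-comm d (a - b)) ⟩
  (a * c + a * - d) + (a - b) * d       ≡⟨ cong₂ _+_ (cong (λ u → a * c + u) (sym (ℚ.neg-distribʳ-* a d))) (ℚ.*-distribʳ-+ d a (- b)) ⟩
  (a * c - a * d) + (a * d + - b * d)   ≡⟨ cong (λ u → (a * c - a * d) + (a * d + u)) (sym (ℚ.neg-distribˡ-* b d)) ⟩
  (a * c - a * d) + (a * d - b * d)     ≡⟨ ℚ.+-assoc (a * c) (- (a * d)) (a * d - b * d) ⟩
  a * c + (- (a * d) + (a * d - b * d)) ≡⟨ cong (λ u → a * c + u) (sym (ℚ.+-assoc (- (a * d)) (a * d) (- (b * d)))) ⟩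
  a * c + (- (a * d) + a * d - b * d)   ≡⟨ cong (λ u → a * c + (u - b * d)) (ℚ.+-inverseˡ (a * d)) ⟩
  a * c + (0ℚ - b * d)                  ≡⟨ cong (λ u → a * c + u) (ℚ.+-identityˡ (- (b * d))) ⟩
  a * c - b * d                         ∎
  where
  open ≡-Reasoning
  open import Data.Rational.Base using (_+_; _-_; _*_; -_)

∣a*c-b*d∣<A*δ+B*δ : ∀ {a b c d A B δ} → 0ℚ ℚ.< A → 0ℚ ℚ.< B →
  ℚ.∣ a ∣ ℚ.≤ A → ℚ.∣ d ∣ ℚ.≤ B → ℚ.∣ a ℚ.- b ∣ ℚ.< δ → ℚ.∣ c ℚ.- d ∣ ℚ.< δ →
  ℚ.∣ a ℚ.* c ℚ.- b ℚ.* d ∣ ℚ.< A ℚ.* δ ℚ.+ B ℚ.* δ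
∣a*c-b*d∣<A*δ+B*δ {a} {b} {c} {d} {A} {B} {δ} 0<A 0<B a≤A d≤B a-b<δ c-d<δ =
  subst (λ r → ℚ.∣ r ∣ ℚ.< A ℚ.* δ ℚ.+ B ℚ.* δ) (telescope a b c d)
    (ℚ.≤-<-trans (ℚ.∣p+q∣≤∣p∣+∣q∣ (a ℚ.* (c ℚ.- d)) (d ℚ.* (a ℚ.- b)))
      (ℚ.+-mono-< {ℚ.∣ a ℚ.* (c ℚ.- d) ∣} {A ℚ.* δ} {ℚ.∣ d ℚ.* (a ℚ.- b) ∣} {B ℚ.* δ}
        (∣p*q∣<C*δ a (c ℚ.- d) 0<A a≤A c-d<δ)
        (∣p*q∣<C*δ d (a ℚ.- b) 0<B d≤B a-b<δ)))

*-cauchy : ∀ {x y} → Cauchy x → Cauchy y → Cauchy (λ n → x n ℚ.* y n)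
*-cauchy {x} {y} cx cy {ε} 0<ε =
  let A , 0<A , K , ∣x∣≤A = cauchy-bounded cx
      B , 0<B , L , ∣y∣≤B = cauchy-bounded cy
      δ , 0<δ , Aδ+Bδ≡ε   = split-ε 0<A 0<B 0<ε
      M , closeˣ = cx 0<δ
      N , closeʸ = cy 0<δ
  in close 0<A 0<B Aδ+Bδ≡ε K L M N ∣x∣≤A ∣y∣≤B closeˣ closeʸ
  where
  close : ∀ {A B δ} → 0ℚ ℚ.< A → 0ℚ ℚ.< B → A ℚ.* δ ℚ.+ B ℚ.* δ ≡ ε → ∀ K L M N →
    (∀ {n} → K ℕ.≤ n → ℚ.∣ x n ∣ ℚ.≤ A) →
    (∀ {n} → L ℕ.≤ n → ℚ.∣ y n ∣ ℚ.≤ B) →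
    (∀ {m n} → M ℕ.≤ m → M ℕ.≤ n → ℚ.∣ x m ℚ.- x n ∣ ℚ.< δ) →
    (∀ {m n} → N ℕ.≤ m → N ℕ.≤ n → ℚ.∣ y m ℚ.- y n ∣ ℚ.< δ) →
    ∃[ P ] (∀ {m n} → P ℕ.≤ m → P ℕ.≤ n → ℚ.∣ x m ℚ.* y m ℚ.- x n ℚ.* y n ∣ ℚ.< ε)
  close {A} {B} {δ} 0<A 0<B Aδ+Bδ≡ε K L M N ∣x∣≤A ∣y∣≤B closeˣ closeʸ =
    (K ℕ.⊔ M) ℕ.⊔ (L ℕ.⊔ N) , λ {m} {n} ≤m ≤n →
    let KM≤m = ℕ.m⊔n≤o⇒m≤o (K ℕ.⊔ M) (L ℕ.⊔ N) ≤m
        KM≤n = ℕ.m⊔n≤o⇒m≤o (K ℕ.⊔ M) (L ℕ.⊔ N) ≤n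
        LN≤m = ℕ.m⊔n≤o⇒n≤o (K ℕ.⊔ M) (L ℕ.⊔ N) ≤m
        LN≤n = ℕ.m⊔n≤o⇒n≤o (K ℕ.⊔ M) (L ℕ.⊔ N) ≤n
    in subst (λ r → ℚ.∣ x m ℚ.* y m ℚ.- x n ℚ.* y n ∣ ℚ.< r) Aδ+Bδ≡ε
      (∣a*c-b*d∣<A*δ+B*δ {x m} {x n} {y m} {y n} {A} {B} {δ} 0<A 0<B
        (∣x∣≤A (ℕ.m⊔n≤o⇒m≤o K M KM≤m))
        (∣y∣≤B (ℕ.m⊔n≤o⇒m≤o L N LN≤n))
        (closeˣ (ℕ.m⊔n≤o⇒n≤o K M KM≤m) (ℕ.m⊔n≤o⇒n≤o K M KM≤n))
        (closeʸ (ℕ.m⊔n≤o⇒n≤o L N LN≤m) (ℕ.m⊔n≤o⇒n≤o L N LN≤n)))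

record ℝ : Set where
  constructor mkℝ
  field
    seq    : ℕ → ℚ
    cauchy : Cauchy seq

open ℝ public

fromℚ : ℚ → ℝ
fromℚ p = mkℝ (λ _ → p) (const-cauchy p)

infix  4 _≈ᴿ_ _<ᴿ_
infixl 6 _+ᴿ_ _-ᴿ_
infixl 7 _*ᴿ_
infix  8 -ᴿ_

record _≈ᴿ_ (x y : ℝ) : Set where
  constructor mk≈ᴿ
  field
    close : ∀ {ε} → 0ℚ ℚ.< ε →
      ∃[ N ] (∀ {n} → N ℕ.≤ n → ℚ.∣ seq x n ℚ.- seq y n ∣ ℚ.< ε)

record _<ᴿ_ (x y : ℝ) : Set where
  constructor mk<ᴿ
  field
    gap       : ℚ
    gap>0     : 0ℚ ℚ.< gap
    separated : ∃[ N ] (∀ {n} → N ℕ.≤ n → seq x n ℚ.+ gap ℚ.≤ seq y n)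

0ᴿ 1ᴿ : ℝ
0ᴿ = fromℚ 0ℚ
1ᴿ = fromℚ 1ℚ

_+ᴿ_ _*ᴿ_ : ℝ → ℝ → ℝ
x +ᴿ y = mkℝ (λ n → seq x n ℚ.+ seq y n) (+-cauchy {seq x} {seq y} (cauchy x) (cauchy y))
x *ᴿ y = mkℝ (λ n → seq x n ℚ.* seq y n) (*-cauchy {seq x} {seq y} (cauchy x) (cauchy y))

-ᴿ_ ∣_∣ᴿ : ℝ → ℝ
-ᴿ_ x = mkℝ (λ n → ℚ.- seq x n) (neg-cauchy {seq x} (cauchy x))
∣ x ∣ᴿ = mkℝ (λ n → ℚ.∣ seq x n ∣) (∣∣-cauchy {seq x} (cauchy x))

_-ᴿ_ : ℝ → ℝ → ℝ
x -ᴿ y = x +ᴿ (-ᴿ y)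

_⟶ᴿ_ : (ℕ → ℝ) → ℝ → Set
u ⟶ᴿ l = ∀ {ε} → 0ℚ ℚ.< ε →
  ∃[ N ] (∀ {n} → N ℕ.≤ n → ∣ u n -ᴿ l ∣ᴿ <ᴿ fromℚ ε)

infixl 6 _+i_

record ℂ : Set where
  constructor _+i_
  field
    re im : ℝ

open ℂ public

infix 4 _≈ᶜ_

record _≈ᶜ_ (z w : ℂ) : Set where
  constructor mk≈ᶜ
  field
    re-≈ : re z ≈ᴿ re w
    im-≈ : im z ≈ᴿ im w

ℂ-rawRing : RawRing 0ℓ 0ℓ
ℂ-rawRing = record
  { Carrier = ℂ
  ; _≈_     = _≈ᶜ_
  ; _+_     = λ z w → (re z +ᴿ re w) +i (im z +ᴿ im w)
  ; _*_     = λ z w → (re z *ᴿ re w -ᴿ im z *ᴿ im w) +i (re z *ᴿ im w +ᴿ im z *ᴿ re w)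
  ; -_      = λ z → (-ᴿ re z) +i (-ᴿ im z)
  ; 0#      = 0ᴿ +i 0ᴿ
  ; 1#      = 1ᴿ +i 0ᴿ
  }

open RawRing ℂ-rawRing public
  using (_≈_; _+_; _*_; -_; 0#; 1#; rawSemiring)
open RawSemiringDefinitions rawSemiring public using (_^_; sum)

infixl 6 _-_
_-_ : ℂ → ℂ → ℂ
z - w = z + - w

-- The topology of ℂ is that of ℝ × ℝ.
_⟶_ : (ℕ → ℂ) → ℂ → Set
u ⟶ l = ((λ n → re (u n)) ⟶ᴿ re l) × ((λ n → im (u n)) ⟶ᴿ im l)

1/_! : ℕ → ℚ
1/ m ! = (+ 1 ℚ./ (m !)) {{m ℕ.!≢0}}

expSum : ℂ → ℕ → ℂ
expSum z n = sum {n} (λ m → (fromℚ (1/ toℕ m !) +i 0ᴿ) * z ^ toℕ m)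

-- The graph of exp: w is the sum of the exponential series at z.  Limits are
-- unique up to _≈_, so w = exp z.
IsExp : ℂ → ℂ → Set
IsExp z w = expSum z ⟶ w

-- sin x = Im (exp (i x))
IsSin : ℝ → ℝ → Set
IsSin x y = ∃[ w ] IsExp (0ᴿ +i x) w × im w ≈ᴿ y

-- π is the least positive zero of sin.
IsPi : ℝ → Set
IsPi π = 0ᴿ <ᴿ π × IsSin π 0ᴿ × (∀ x → 0ᴿ <ᴿ x → x <ᴿ π → ¬ IsSin x 0ᴿ)

-- φ = exp (2πi/k)
IsExp[2πi/_] : (k : ℕ) → .{{NonZero k}} → ℂ → Set
IsExp[2πi/ k ] φ =
  ∃[ π ] IsPi π × IsExp (0ᴿ +i (fromℚ (+ 2 ℚ./ k) *ᴿ π)) φ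

infix 4 _≡_mod_ _≡±_mod_

_≡_mod_ : ℤ → ℤ → ℕ → Set
a ≡ b mod k = (+ k) ℤ.∣ (a ℤ.- b)

_≡±_mod_ : ℕ → ℕ → ℕ → Set
a ≡± b mod k = (+ a ≡ + b mod k) ⊎ (+ a ≡ ℤ.- + b mod k)

𝐤 𝐤₀ : ℕ → Pred ℕ 0ℓ
𝐤  k n = 1 ℕ.≤ n × n ℕ.< k
𝐤₀ k n = n ℕ.< k

record Quadruple : Set where
  constructor _,_∣_,_
  field
    i j s t : ℕ

Overlap : ℕ → ℂ → Pred Quadruple 0ℓ
Overlap k φ (i , j ∣ s , t) =
  i ∈ 𝐤 k × j ∈ 𝐤 k × s ∈ 𝐤 k × t ∈ 𝐤 k × i ≢ s ×
  ∃[ ω ] ω ∈ 𝐤₀ k × φ ^ ω * ((φ ^ j - 1#) * (φ ^ s - 1#)) ≈ (φ ^ i - 1#) * (φ ^ t - 1#)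

Trivial : ℕ → Pred Quadruple 0ℓ
Trivial k (i , j ∣ s , t) =
  i ≡± j mod k ⊎ j ≡± t mod k ⊎ t ≡± s mod k ⊎ s ≡± i mod k

𝒪 : ℕ → ℂ → Pred Quadruple 0ℓ
𝒪 k φ q = q ∈ Overlap k φ × q ∉ Trivial k

{-# OPTIONS --safe #-}

module Submission where

-- Write a = φ^ω, b = φ^j, c = φ^s, d = φ^i, e = φ^t, so that an overlap is the equation
-- a(b-1)(c-1) = (d-1)(e-1); dividing it by its complex conjugate gives de = a²bc.
--
-- Since k is odd, ℤ[φ]/2 is a nonzero ring in which x ↦ x² is a homomorphism, in which φ
-- has a square root ψ = φ^g with 2g ≡ 1 (mod k), and in which φ^n - 1 is a unit unless
-- k ∣ n, because it divides the odd number k.  Let now a, …, e be the same powers of ψ.  The equation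
-- holds exactly for their squares, hence modulo 2 for themselves.  Comparing the two
-- refines the congruence to d + e ≡ a(b+c) (mod 2), and together with de = a²bc this
-- yields (d-ab)(d-ac) ≡ 0 and (a-1)(abc-1) ≡ 0.  A difference of two powers of ψ is zero
-- or a unit, so i ≡ ω+j or i ≡ ω+s, and ω ≡ 0 or ω+j+s ≡ 0 (mod k); in all four cases
-- the overlap is trivial.
--
-- That φ is a primitive k-th root of unity follows from exp(z+w) = exp z exp w: since
-- sin π = 0, exp(iπ) is real and exp(2πi) = 1, while φ^a = 1 with 0 < a < k would make
-- exp(iπa/k) real, contradicting the minimality of π.

open import Algebra.Bundles using (CommutativeRing)
import Algebra.Properties.CommutativeSemiring.Exp as CommutativeSemiringExp
import Algebra.Properties.Semiring.Exp as SemiringExp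
import Algebra.Properties.Semiring.Mult as SemiringMult
import Algebra.Solver.Ring
open import Algebra.Solver.Ring.AlmostCommutativeRing
  using (fromCommutativeRing; _-Raw-AlmostCommutative⟶_)
open import Data.Fin.Base using (Fin; zero; suc; toℕ; fromℕ<)
import Data.Fin.Properties as Fin
open import Data.Integer.Base as ℤ using (ℤ; +_; -[1+_])
import Data.Integer.Divisibility as ℤ
import Data.Integer.Divisibility.Signed as Signed
import Data.Integer.Properties as ℤ
open import Data.Maybe.Base using (Maybe; just; nothing)
open import Data.Nat.Base as ℕ using (ℕ; zero; suc; NonZero; _≤_; _!)
import Data.Nat.Coprimality as ℕ
open import Data.Nat.Divisibility
  using (_∣_; divides; _∣?_; n∣m*n; ∣m+n∣m⇒∣n; ∣⇒≤; 0∣⇒≡0; >⇒∤; m%n≡0⇒n∣m)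
open import Data.Nat.DivMod using (_%_; _/_; m≡m%n+[m/n]*n; m%n<n)
import Data.Nat.Properties as ℕ
open import Data.Product.Base using (∃-syntax; _×_; _,_; proj₁; proj₂)
open import Data.Rational.Base as ℚ using (ℚ; 0ℚ; 1ℚ; ½)
import Data.Rational.Properties as ℚ
open import Data.Rational.Unnormalised.Base as ℚᵘ using (mkℚᵘ; *≡*; *≤*) renaming (_≃_ to _≃ᵘ_)
import Data.Rational.Unnormalised.Properties as ℚᵘ
open import Data.Sum.Base using (_⊎_; inj₁; inj₂)
open import Function.Base using (_∘_; _$_)
open import Level using (_⊔_; 0ℓ) renaming (suc to lsuc)
open import Relation.Binary.PropositionalEquality as ≡ using (_≡_)
open import Relation.Nullary.Decidable using (yes; no)
open import Relation.Nullary.Negation using (¬_; contradiction)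
open import Relation.Unary using (Empty; _⊆_)

-- The exponent g is taken to be a power 2^m with 2^(m+1) ≡ 1 (mod k). Then ψ = φ^g is reached from
-- φ by m squarings, so the equation for ψ modulo 2 is the one for φ after m applications of the
-- squaring homomorphism.
--
-- Equality of Cauchy reals is not decidable, and this shapes the algebra. A vanishing product
-- yields only that one factor is zero once the other is known to be nonzero; the final disjunctions
-- come from deciding divisibility by k instead. That ℤ[φ]/2 is nonzero is shown without cyclotomic
-- polynomials or an integral basis: if 1 were twice an element, the finitely generated group
-- spanned by the powers of φ would equal its own double, and elimination with odd pivots would make
-- it vanish.
--
-- The only exponentials given are exp(iπ) and exp(2πi/k). The numbers exp(iπa/k), to which the
-- minimality of π applies, are assembled from these two and conjugation, which uses k = 1 + 2h.

-- Integer coefficients for the ring solver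

module IntegerCoefficients {c ℓ} (R : CommutativeRing c ℓ) where
  open CommutativeRing R
  open import Algebra.Properties.Ring ring
  open import Algebra.Properties.Semiring.Mult.TCOptimised semiring
    using (×-homo-+; ×1-homo-*) renaming (_×_ to _·_)
  open import Relation.Binary.Reasoning.Setoid setoid

  -- The optimised multiple makes `ι (+ 1)` reduce to `1#`, so that `con (+ 1)` in a solver equation
  -- denotes the unit of the ring itself.
  ι : ℤ → Carrier
  ι (+ n)    = n · 1#
  ι -[1+ n ] = - (suc n · 1#)

  suc-· : ∀ n → suc n · 1# ≈ 1# + n · 1#
  suc-· n = ×-homo-+ 1# 1 n

  cancel-1 : ∀ x y → (1# + x) - (1# + y) ≈ x - y
  cancel-1 x y = begin
    (1# + x) - (1# + y)      ≈⟨ +-congˡ (-‿+-comm 1# y) ⟨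
    (1# + x) + (- 1# - y)    ≈⟨ +-congʳ (+-comm 1# x) ⟩
    (x + 1#) + (- 1# - y)    ≈⟨ +-assoc x 1# _ ⟩
    x + (1# + (- 1# - y))    ≈⟨ +-congˡ (+-assoc 1# (- 1#) (- y)) ⟨
    x + ((1# - 1#) - y)      ≈⟨ +-congˡ (+-congʳ (-‿inverseʳ 1#)) ⟩
    x + (0# - y)             ≈⟨ +-congˡ (+-identityˡ (- y)) ⟩
    x - y                    ∎

  ι-⊖ : ∀ m n → ι (m ℤ.⊖ n) ≈ m · 1# - n · 1#
  ι-⊖ zero    zero    = sym (-‿inverseʳ 0#)
  ι-⊖ zero    (suc n) = sym (+-identityˡ _)
  ι-⊖ (suc m) zero    = sym (trans (+-congˡ -0#≈0#) (+-identityʳ _))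
  ι-⊖ (suc m) (suc n) = begin
    ι (suc m ℤ.⊖ suc n)                ≡⟨ ≡.cong ι (ℤ.[1+m]⊖[1+n]≡m⊖n m n) ⟩
    ι (m ℤ.⊖ n)                        ≈⟨ ι-⊖ m n ⟩
    m · 1# - n · 1#                    ≈⟨ cancel-1 _ _ ⟨
    (1# + m · 1#) - (1# + n · 1#)      ≈⟨ +-cong (suc-· m) (-‿cong (suc-· n)) ⟨
    suc m · 1# - suc n · 1#            ∎

  ι-neg : ∀ i → ι (ℤ.- i) ≈ - ι i
  ι-neg (+ zero)  = sym -0#≈0#
  ι-neg (+ suc n) = refl
  ι-neg -[1+ n ]  = sym (-‿involutive _)

  ι-+ : ∀ i j → ι (i ℤ.+ j) ≈ ι i + ι j
  ι-+ (+ m)    (+ n)    = ×-homo-+ 1# m n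
  ι-+ (+ m)    -[1+ n ] = ι-⊖ m (suc n)
  ι-+ -[1+ m ] (+ n)    = trans (ι-⊖ n (suc m)) (+-comm _ _)
  ι-+ -[1+ m ] -[1+ n ] = begin
    - (suc (suc (m ℕ.+ n)) · 1#)       ≡⟨ ≡.cong (λ l → - (suc l · 1#)) (ℕ.+-suc m n) ⟨
    - ((suc m ℕ.+ suc n) · 1#)         ≈⟨ -‿cong (×-homo-+ 1# (suc m) (suc n)) ⟩
    - (suc m · 1# + suc n · 1#)        ≈⟨ -‿+-comm _ _ ⟨
    - (suc m · 1#) - suc n · 1#        ∎

  ι-*⁺ : ∀ m j → ι (+ m ℤ.* j) ≈ m · 1# * ι j
  ι-*⁺ m (+ n) = begin
    ι (+ m ℤ.* + n)      ≡⟨ ≡.cong ι (ℤ.pos-* m n) ⟨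
    (m ℕ.* n) · 1#       ≈⟨ ×1-homo-* m n ⟩
    m · 1# * n · 1#      ∎
  ι-*⁺ m -[1+ n ] = begin
    ι (+ m ℤ.* -[1+ n ])           ≡⟨ ≡.cong ι (ℤ.neg-distribʳ-* (+ m) (+ suc n)) ⟨
    ι (ℤ.- (+ m ℤ.* + suc n))      ≈⟨ ι-neg (+ m ℤ.* + suc n) ⟩
    - ι (+ m ℤ.* + suc n)          ≈⟨ -‿cong (ι-*⁺ m (+ suc n)) ⟩
    - (m · 1# * suc n · 1#)        ≈⟨ -‿distribʳ-* _ _ ⟩
    m · 1# * - (suc n · 1#)        ∎

  ι-* : ∀ i j → ι (i ℤ.* j) ≈ ι i * ι j
  ι-* (+ m)    j = ι-*⁺ m j
  ι-* -[1+ m ] j = begin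
    ι (-[1+ m ] ℤ.* j)         ≡⟨ ≡.cong ι (ℤ.neg-distribˡ-* (+ suc m) j) ⟨
    ι (ℤ.- (+ suc m ℤ.* j))    ≈⟨ ι-neg (+ suc m ℤ.* j) ⟩
    - ι (+ suc m ℤ.* j)        ≈⟨ -‿cong (ι-*⁺ (suc m) j) ⟩
    - (suc m · 1# * ι j)       ≈⟨ -‿distribˡ-* _ _ ⟩
    - (suc m · 1#) * ι j       ∎

  ι-morphism : CommutativeRing.rawRing ℤ.+-*-commutativeRing -Raw-AlmostCommutative⟶ fromCommutativeRing R
  ι-morphism = record
    { ⟦_⟧    = ι
    ; +-homo = ι-+
    ; *-homo = ι-*
    ; -‿homo = ι-neg
    ; 0-homo = refl
    ; 1-homo = refl
    }

  ι-≟ : ∀ i j → Maybe (ι i ≈ ι j)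
  ι-≟ i j with i ℤ.≟ j
  ... | yes ≡.refl = just refl
  ... | no  _      = nothing

  module Solver = Algebra.Solver.Ring _ _ ι-morphism ι-≟

-- Geometric sums and notions for roots of unity

module Geometric {c ℓ} (K : CommutativeRing c ℓ) where
  open CommutativeRing K hiding (zero)
  open IntegerCoefficients K
  open Solver
  open SemiringExp semiring
  open import Relation.Binary.Reasoning.Setoid setoid

  1^n≈1 : ∀ n → 1# ^ n ≈ 1#
  1^n≈1 zero    = refl
  1^n≈1 (suc n) = trans (*-identityˡ _) (1^n≈1 n)

  geometric : Carrier → ℕ → Carrier
  geometric x zero    = 0#
  geometric x (suc n) = geometric x n + x ^ n

  geometric-sum : ∀ x n → (x - 1#) * geometric x n ≈ x ^ n - 1#
  geometric-sum x zero    = solve 1 (λ x → (x :- con (+ 1)) :* con (+ 0) := con (+ 1) :- con (+ 1)) refl x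
  geometric-sum x (suc n) = begin
    (x - 1#) * (geometric x n + x ^ n)              ≈⟨ distribˡ _ _ _ ⟩
    (x - 1#) * geometric x n + (x - 1#) * x ^ n     ≈⟨ +-congʳ (geometric-sum x n) ⟩
    (x ^ n - 1#) + (x - 1#) * x ^ n                 ≈⟨ solve 2 (λ x y → (y :- con (+ 1)) :+ (x :- con (+ 1)) :* y := x :* y :- con (+ 1)) refl x (x ^ n) ⟩
    x * x ^ n - 1#                                  ∎

  -- The quotient of `geometric x n` - n by x - 1. When the geometric sum vanishes, it is an
  -- explicit cofactor showing that x - 1 divides n.
  geometric² : Carrier → ℕ → Carrier
  geometric² x zero    = 0#
  geometric² x (suc n) = geometric² x n + geometric x n

  geometric²-sum : ∀ x n → (x - 1#) * geometric² x n ≈ geometric x n - ι (+ n)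
  geometric²-sum x zero    = solve 1 (λ x → (x :- con (+ 1)) :* con (+ 0) := con (+ 0) :- con (+ 0)) refl x
  geometric²-sum x (suc n) = begin
    (x - 1#) * (geometric² x n + geometric x n)              ≈⟨ distribˡ _ _ _ ⟩
    (x - 1#) * geometric² x n + (x - 1#) * geometric x n     ≈⟨ +-cong (geometric²-sum x n) (geometric-sum x n) ⟩
    (geometric x n - ι (+ n)) + (x ^ n - 1#)                 ≈⟨ solve 3 (λ g m y → (g :- m) :+ (y :- con (+ 1)) := (g :+ y) :- (con (+ 1) :+ m)) refl _ _ _ ⟩
    geometric x (suc n) - (1# + ι (+ n))                     ≈⟨ +-congˡ (-‿cong (suc-· n)) ⟨
    geometric x (suc n) - ι (+ suc n)                        ∎

-- The disjunctive form would demand a decision that Cauchy reals do not allow; this form holds in ℂ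
-- constructively.
IsDomain : ∀ {c ℓ} → CommutativeRing c ℓ → Set (c ⊔ ℓ)
IsDomain K = ∀ x y → x * y ≈ 0# → ¬ x ≈ 0# → y ≈ 0#
  where open CommutativeRing K

CharacteristicZero : ∀ {c ℓ} → CommutativeRing c ℓ → Set ℓ
CharacteristicZero K = ∀ i → ι i ≈ 0# → i ≡ + 0
  where open CommutativeRing K; open IntegerCoefficients K

RootOfUnity : ∀ {c ℓ} (K : CommutativeRing c ℓ) → CommutativeRing.Carrier K → ℕ → Set ℓ
RootOfUnity K ζ k = ζ ^ k ≈ 1#
  where open CommutativeRing K; open SemiringExp semiring

OrderMultipleOf : ∀ {c ℓ} (K : CommutativeRing c ℓ) → CommutativeRing.Carrier K → ℕ → Set ℓ
OrderMultipleOf K ζ k = ∀ n → ζ ^ n ≈ 1# → k ∣ n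
  where open CommutativeRing K; open SemiringExp semiring

CharacteristicTwo : ∀ {c ℓ} → CommutativeRing c ℓ → Set (c ⊔ ℓ)
CharacteristicTwo K = ∀ x → x + x ≈ 0#
  where open CommutativeRing K

-- Reduction modulo 2 of ℤ[ζ]

module Nakayama {c ℓ} (K : CommutativeRing c ℓ)
  (domain : IsDomain K) (char0 : CharacteristicZero K) where
  open CommutativeRing K hiding (zero)
  open IntegerCoefficients K
  open Solver
  open import Relation.Binary.Reasoning.Setoid setoid

  -- The integer coefficients are stored one generator at a time, so that elimination can split off
  -- the coefficient of the first generator.
  data Span : ∀ {n} → (Fin n → Carrier) → Carrier → Set (c ⊔ ℓ) where
    nil  : ∀ {v y} → y ≈ 0# → Span {0} v y
    cons : ∀ {n} {v : Fin (suc n) → Carrier} {y} a {z} →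
           Span (v ∘ suc) z → y ≈ ι a * v zero + z → Span v y

  span-resp : ∀ {n} {v : Fin n → Carrier} {y z} → y ≈ z → Span v y → Span v z
  span-resp y≈z (nil y≈0)     = nil (trans (sym y≈z) y≈0)
  span-resp y≈z (cons a s eq) = cons a s (trans (sym y≈z) eq)

  span-0 : ∀ {n} {v : Fin n → Carrier} → Span v 0#
  span-0 {zero}      = nil refl
  span-0 {suc n} {v} = cons (+ 0) span-0 (solve 1 (λ v → con (+ 0) := con (+ 0) :* v :+ con (+ 0)) refl (v zero))

  span-+ : ∀ {n} {v : Fin n → Carrier} {y z} → Span v y → Span v z → Span v (y + z)
  span-+ (nil p) (nil q) = nil (trans (+-cong p q) (+-identityˡ 0#))
  span-+ {v = v} {y} {z} (cons a {y′} s p) (cons b {z′} t q) = cons (a ℤ.+ b) (span-+ s t) $ begin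
    y + z                                              ≈⟨ +-cong p q ⟩
    (ι a * v zero + y′) + (ι b * v zero + z′)          ≈⟨ solve 5 (λ a b v y z → (a :* v :+ y) :+ (b :* v :+ z) := (a :+ b) :* v :+ (y :+ z)) refl _ _ _ _ _ ⟩
    (ι a + ι b) * v zero + (y′ + z′)                   ≈⟨ +-congʳ (*-congʳ (ι-+ a b)) ⟨
    ι (a ℤ.+ b) * v zero + (y′ + z′)                   ∎

  span-ι* : ∀ {n} {v : Fin n → Carrier} a {y} → Span v y → Span v (ι a * y)
  span-ι* a (nil p) = nil (trans (*-congˡ p) (zeroʳ _))
  span-ι* {v = v} a {y} (cons b {y′} s p) = cons (a ℤ.* b) (span-ι* a s) $ begin
    ι a * y                                ≈⟨ *-congˡ p ⟩
    ι a * (ι b * v zero + y′)              ≈⟨ solve 4 (λ a b v y → a :* (b :* v :+ y) := (a :* b) :* v :+ a :* y) refl _ _ _ _ ⟩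
    (ι a * ι b) * v zero + ι a * y′        ≈⟨ +-congʳ (*-congʳ (ι-* a b)) ⟨
    ι (a ℤ.* b) * v zero + ι a * y′        ∎

  span-neg : ∀ {n} {v : Fin n → Carrier} {y} → Span v y → Span v (- y)
  span-neg {y = y} s = span-resp (solve 1 (λ y → con (ℤ.- (+ 1)) :* y := :- y) refl y) (span-ι* (ℤ.- (+ 1)) s)

  span-∈ : ∀ {n} (v : Fin n → Carrier) i → Span v (v i)
  span-∈ v zero    = cons (+ 1) span-0 (solve 1 (λ x → x := con (+ 1) :* x :+ con (+ 0)) refl (v zero))
  span-∈ v (suc i) = cons (+ 0) (span-∈ (v ∘ suc) i) (solve 2 (λ x y → y := con (+ 0) :* x :+ y) refl (v zero) (v (suc i)))

  span-* : ∀ {m n} {v : Fin m → Carrier} {w : Fin n → Carrier} x →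
           (∀ i → Span v (x * w i)) → ∀ {y} → Span w y → Span v (x * y)
  span-* x s (nil p) = span-resp (sym (trans (*-congˡ p) (zeroʳ x))) span-0
  span-* {w = w} x s {y} (cons a {z} t p) = span-resp
    (begin
      ι a * (x * w zero) + x * z    ≈⟨ solve 4 (λ a x w z → a :* (x :* w) :+ x :* z := x :* (a :* w :+ z)) refl _ _ _ _ ⟩
      x * (ι a * w zero + z)        ≈⟨ *-congˡ p ⟨
      x * y                         ∎)
    (span-+ (span-ι* a (s zero)) (span-* x (s ∘ suc) t))

  odd : ℤ → ℤ
  odd m = + 1 ℤ.+ (m ℤ.+ m)

  ι-odd : ∀ m → ι (odd m) ≈ 1# + (ι m + ι m)
  ι-odd m = trans (ι-+ (+ 1) (m ℤ.+ m)) (+-congˡ (ι-+ m m))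

  odd≢0 : ∀ m → ¬ odd m ≡ + 0
  odd≢0 (+ m)    ()
  odd≢0 -[1+ m ] ()

  ι-odd≉0 : ∀ m → ¬ ι (odd m) ≈ 0#
  ι-odd≉0 m = odd≢0 m ∘ char0 (odd m)

  OddMultipleInTwice : ∀ {n} → (Fin n → Carrier) → Carrier → Set (c ⊔ ℓ)
  OddMultipleInTwice v x = ∃[ m ] ∃[ y ] Span v y × ι (odd m) * x ≈ y + y

  -- Gaussian elimination with odd pivots: a ℤ-module M generated by v with
  -- M = 2 M (up to odd multiples) vanishes.
  nakayama : ∀ {n} (v : Fin n → Carrier) → (∀ i → OddMultipleInTwice v (v i)) → ∀ i → v i ≈ 0#
  nakayama {suc n} v H = all
    where
    v₀ = v zero
    w  = v ∘ suc

    -- If (1 + 2m) v₀ = 2(a v₀ + z), moving 2a v₀ to the left leaves the odd coefficient 1 + 2(m -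
    -- a) and a right-hand side free of v₀.
    pivot : ∃[ p ] ∃[ y ] Span w y × ι (odd p) * v₀ ≈ y + y
    pivot with H zero
    ... | m , y , cons a {z} s y≈ , eq = m ℤ.- a , z , s , (begin
      ι (odd (m ℤ.- a)) * v₀
        ≈⟨ *-congʳ (trans (ι-odd (m ℤ.- a)) (+-congˡ (+-cong ι- ι-))) ⟩
      (1# + ((ι m - ι a) + (ι m - ι a))) * v₀
        ≈⟨ solve 3 (λ m a v → (con (+ 1) :+ ((m :- a) :+ (m :- a))) :* v := (con (+ 1) :+ (m :+ m)) :* v :- (a :* v :+ a :* v)) refl _ _ _ ⟩
      (1# + (ι m + ι m)) * v₀ - (ι a * v₀ + ι a * v₀)
        ≈⟨ +-congʳ (trans (*-congʳ (sym (ι-odd m))) (trans eq (+-cong y≈ y≈))) ⟩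
      (ι a * v₀ + z) + (ι a * v₀ + z) - (ι a * v₀ + ι a * v₀)
        ≈⟨ solve 2 (λ u z → (u :+ z) :+ (u :+ z) :- (u :+ u) := z :+ z) refl _ _ ⟩
      z + z ∎)
      where
      ι- : ι (m ℤ.- a) ≈ ι m - ι a
      ι- = trans (ι-+ m (ℤ.- a)) (+-congˡ (ι-neg a))

    -- The relation for `w i` is multiplied by the odd pivot, so that its multiple of v₀ can be
    -- replaced by the pivot relation. The new coefficient is odd: (1 + 2p)(1 + 2m) = 1 + 2(p + m +
    -- 2pm).
    eliminate : ∀ i → OddMultipleInTwice w (w i)
    eliminate i with pivot | H (suc i)
    ... | p , y₀ , s₀ , eq₀ | m , y , cons a {z} s y≈ , eq =
      (p ℤ.+ m) ℤ.+ (p ℤ.* m ℤ.+ p ℤ.* m) ,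
      ι a * (y₀ + y₀) + ι (odd p) * z ,
      span-+ (span-ι* a (span-+ s₀ s₀)) (span-ι* (odd p) s) , (begin
        ι (odd ((p ℤ.+ m) ℤ.+ (p ℤ.* m ℤ.+ p ℤ.* m))) * w i
          ≈⟨ *-congʳ (trans (ι-odd q) (+-congˡ (+-cong ιq ιq))) ⟩
        (1# + (((ι p + ι m) + (ι p * ι m + ι p * ι m)) + ((ι p + ι m) + (ι p * ι m + ι p * ι m)))) * w i
          ≈⟨ solve 3 (λ p m w → (con (+ 1) :+ (((p :+ m) :+ (p :* m :+ p :* m)) :+ ((p :+ m) :+ (p :* m :+ p :* m)))) :* w
               := (con (+ 1) :+ (p :+ p)) :* ((con (+ 1) :+ (m :+ m)) :* w)) refl _ _ _ ⟩
        (1# + (ι p + ι p)) * ((1# + (ι m + ι m)) * w i)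
          ≈⟨ *-cong (ι-odd p) (*-congʳ (ι-odd m)) ⟨
        ι (odd p) * (ι (odd m) * w i)
          ≈⟨ *-congˡ (trans eq (+-cong y≈ y≈)) ⟩
        ι (odd p) * ((ι a * v₀ + z) + (ι a * v₀ + z))
          ≈⟨ solve 4 (λ o a v z → o :* ((a :* v :+ z) :+ (a :* v :+ z)) := (a :* (o :* v) :+ o :* z) :+ (a :* (o :* v) :+ o :* z)) refl _ _ _ _ ⟩
        (ι a * (ι (odd p) * v₀) + ι (odd p) * z) + (ι a * (ι (odd p) * v₀) + ι (odd p) * z)
          ≈⟨ +-cong (+-congʳ (*-congˡ eq₀)) (+-congʳ (*-congˡ eq₀)) ⟩
        (ι a * (y₀ + y₀) + ι (odd p) * z) + (ι a * (y₀ + y₀) + ι (odd p) * z) ∎)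
      where
      q = (p ℤ.+ m) ℤ.+ (p ℤ.* m ℤ.+ p ℤ.* m)
      ιq : ι q ≈ (ι p + ι m) + (ι p * ι m + ι p * ι m)
      ιq = trans (ι-+ (p ℤ.+ m) _) (+-cong (ι-+ p m) (trans (ι-+ (p ℤ.* m) _) (+-cong (ι-* p m) (ι-* p m))))

    w≈0 : ∀ i → w i ≈ 0#
    w≈0 = nakayama w eliminate

    zero-span : ∀ {n} {u : Fin n → Carrier} → (∀ i → u i ≈ 0#) → ∀ {y} → Span u y → y ≈ 0#
    zero-span u≈0 (nil p)       = p
    zero-span u≈0 (cons a s p) = trans p (trans (+-cong (trans (*-congˡ (u≈0 zero)) (zeroʳ _)) (zero-span (u≈0 ∘ suc) s)) (+-identityˡ 0#))

    all : ∀ i → v i ≈ 0#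
    all (suc i) = w≈0 i
    all zero with pivot
    ... | p , y₀ , s , eq = domain _ _
      (trans eq (trans (+-cong (zero-span w≈0 s) (zero-span w≈0 s)) (+-identityˡ 0#))) (ι-odd≉0 p)

module Adjunction {c ℓ} (K : CommutativeRing c ℓ)
  (domain : IsDomain K) (char0 : CharacteristicZero K) (ζ : CommutativeRing.Carrier K)
  (k : ℕ) {{_ : NonZero k}}
  (ζ^k≈1 : RootOfUnity K ζ k) where
  open CommutativeRing K hiding (zero)
  open SemiringExp semiring
  open Geometric K using (1^n≈1)
  open IntegerCoefficients K
  open Solver
  open Nakayama K domain char0
  open import Algebra.Properties.Ring ring
  open import Relation.Binary.Reasoning.Setoid setoid

  data ℤ[ζ] : Carrier → Set (c ⊔ ℓ) where
    gen  : ℤ[ζ] ζ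
    one  : ℤ[ζ] 1#
    add  : ∀ {x y} → ℤ[ζ] x → ℤ[ζ] y → ℤ[ζ] (x + y)
    mul  : ∀ {x y} → ℤ[ζ] x → ℤ[ζ] y → ℤ[ζ] (x * y)
    neg  : ∀ {x} → ℤ[ζ] x → ℤ[ζ] (- x)
    resp : ∀ {x y} → x ≈ y → ℤ[ζ] x → ℤ[ζ] y

  nought : ℤ[ζ] 0#
  nought = resp (-‿inverseʳ 1#) (add one (neg one))

  power : ∀ {x} → ℤ[ζ] x → ∀ n → ℤ[ζ] (x ^ n)
  power r zero    = one
  power r (suc n) = mul r (power r n)

  -- A spanning family of the additive group of ℤ[ζ], with no claim of linear independence;
  -- `nakayama` asks for generators only.
  basis : Fin k → Carrier
  basis i = ζ ^ toℕ i

  power-span : ∀ n → Span basis (ζ ^ n)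
  power-span n = span-resp (sym reduce) (span-∈ basis (fromℕ< (m%n<n n k)))
    where
    reduce : ζ ^ n ≈ basis (fromℕ< (m%n<n n k))
    reduce = begin
      ζ ^ n                                ≡⟨ ≡.cong (ζ ^_) (m≡m%n+[m/n]*n n k) ⟩
      ζ ^ (n % k ℕ.+ n / k ℕ.* k)          ≈⟨ ^-homo-* ζ (n % k) _ ⟩
      ζ ^ (n % k) * ζ ^ (n / k ℕ.* k)      ≡⟨ ≡.cong (λ m → ζ ^ (n % k) * ζ ^ m) (ℕ.*-comm (n / k) k) ⟩
      ζ ^ (n % k) * ζ ^ (k ℕ.* (n / k))    ≈⟨ *-congˡ (^-assocʳ ζ k (n / k)) ⟨
      ζ ^ (n % k) * (ζ ^ k) ^ (n / k)      ≈⟨ *-congˡ (trans (^-congˡ (n / k) ζ^k≈1) (1^n≈1 (n / k))) ⟩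
      ζ ^ (n % k) * 1#                     ≈⟨ *-identityʳ _ ⟩
      ζ ^ (n % k)                          ≡⟨ ≡.cong (ζ ^_) (Fin.toℕ-fromℕ< (m%n<n n k)) ⟨
      basis (fromℕ< (m%n<n n k))           ∎

  -- The span of the powers is a module over ℤ[ζ]. Multiplication by ζ shifts the exponent, and
  -- `power-span` reduces it modulo k.
  acts : ∀ {x} → ℤ[ζ] x → ∀ {y} → Span basis y → Span basis (x * y)
  acts gen        s = span-* ζ (λ i → power-span (suc (toℕ i))) s
  acts one        s = span-resp (sym (*-identityˡ _)) s
  acts (add r r′) s = span-resp (sym (distribʳ _ _ _)) (span-+ (acts r s) (acts r′ s))
  acts (mul r r′) s = span-resp (sym (*-assoc _ _ _)) (acts r (acts r′ s))
  acts (neg r)    s = span-resp (-‿distribˡ-* _ _) (span-neg (acts r s))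
  acts (resp e r) s = span-resp (*-congʳ e) (acts r s)

  -- From 1 = 2r, each generator is twice an element of the span, namely of r times itself. Then
  -- `nakayama` annihilates all generators, among them ζ^0 = 1.
  2∤1 : ∀ {r} → ℤ[ζ] r → ¬ 1# ≈ r + r
  2∤1 {r} r∈ 1≈r+r = contradiction (char0 (+ 1) (1≈0 k basis≈0)) λ ()
    where
    basis≈0 : ∀ i → basis i ≈ 0#
    basis≈0 = nakayama basis λ i → + 0 , r * basis i , acts r∈ (span-∈ basis i) , (begin
      1# * basis i               ≈⟨ *-congʳ 1≈r+r ⟩
      (r + r) * basis i          ≈⟨ distribʳ _ _ _ ⟩
      r * basis i + r * basis i  ∎)
    1≈0 : ∀ k {{_ : NonZero k}} → (∀ (i : Fin k) → ζ ^ toℕ i ≈ 0#) → 1# ≈ 0#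
    1≈0 (suc _) e = e zero

  infix 4 _~_
  -- The half of the difference must itself lie in ℤ[ζ]: where 2 is invertible in K, as in ℂ, a half
  -- in K would make all elements congruent.
  record _~_ (x y : ∃[ r ] ℤ[ζ] r) : Set (c ⊔ ℓ) where
    constructor mk~
    field
      half       : Carrier
      half-∈     : ℤ[ζ] half
      difference : proj₁ x ≈ proj₁ y + (half + half)

  lift : ∀ {x y} → proj₁ x ≈ proj₁ y → x ~ y
  lift e = mk~ 0# nought (trans e (solve 1 (λ y → y := y :+ (con (+ 0) :+ con (+ 0))) refl _))

  mod2 : CommutativeRing (c ⊔ ℓ) (c ⊔ ℓ)
  mod2 = record
    { Carrier = ∃[ r ] ℤ[ζ] r
    ; _≈_ = _~_
    ; _+_ = λ (x , r) (y , s) → x + y , add r s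
    ; _*_ = λ (x , r) (y , s) → x * y , mul r s
    ; -_  = λ (x , r) → - x , neg r
    ; 0#  = 0# , nought
    ; 1#  = 1# , one
    ; isCommutativeRing = record
      { isRing = record
        { +-isAbelianGroup = record
          { isGroup = record
            { isMonoid = record
              { isSemigroup = record
                { isMagma = record
                  { isEquivalence = record
                    { refl  = lift refl
                    ; sym   = λ (mk~ h r e) → mk~ (- h) (neg r) (trans (solve 2 (λ y h → y := (y :+ (h :+ h)) :+ (:- h :+ :- h)) refl _ _) (+-congʳ (sym e)))
                    ; trans = λ (mk~ h r e) (mk~ h′ r′ e′) → mk~ (h + h′) (add r r′)
                        (trans e (trans (+-congʳ e′) (solve 3 (λ y h h′ → (y :+ (h′ :+ h′)) :+ (h :+ h) := y :+ ((h :+ h′) :+ (h :+ h′))) refl _ _ _)))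
                    }
                  ; ∙-cong = λ (mk~ h r e) (mk~ h′ r′ e′) → mk~ (h + h′) (add r r′)
                      (trans (+-cong e e′) (solve 4 (λ x y h h′ → (x :+ (h :+ h)) :+ (y :+ (h′ :+ h′)) := (x :+ y) :+ ((h :+ h′) :+ (h :+ h′))) refl _ _ _ _))
                  }
                ; assoc = λ _ _ _ → lift (+-assoc _ _ _)
                }
              ; identity = (λ _ → lift (+-identityˡ _)) , (λ _ → lift (+-identityʳ _))
              }
            ; inverse = (λ _ → lift (-‿inverseˡ _)) , (λ _ → lift (-‿inverseʳ _))
            ; ⁻¹-cong = λ (mk~ h r e) → mk~ (- h) (neg r) (trans (-‿cong e) (solve 2 (λ y h → :- (y :+ (h :+ h)) := :- y :+ (:- h :+ :- h)) refl _ _))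
            }
          ; comm = λ _ _ → lift (+-comm _ _)
          }
        ; *-cong = λ {x} {y} {u} {v} (mk~ h r e) (mk~ h′ r′ e′) →
            mk~ (proj₁ y * h′ + h * (proj₁ v + (h′ + h′))) (add (mul (proj₂ y) r′) (mul r (add (proj₂ v) (add r′ r′))))
              (trans (*-cong e e′) (solve 4 (λ y v h h′ → (y :+ (h :+ h)) :* (v :+ (h′ :+ h′))
                := (y :* v) :+ ((y :* h′ :+ h :* (v :+ (h′ :+ h′))) :+ (y :* h′ :+ h :* (v :+ (h′ :+ h′))))) refl _ _ _ _))
        ; *-assoc = λ _ _ _ → lift (*-assoc _ _ _)
        ; *-identity = (λ _ → lift (*-identityˡ _)) , (λ _ → lift (*-identityʳ _))
        ; distrib = (λ _ _ _ → lift (distribˡ _ _ _)) , (λ _ _ _ → lift (distribʳ _ _ _))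
        }
      ; *-comm = λ _ _ → lift (*-comm _ _)
      }
    }

-- Powers of 2 modulo an odd number

2∤⇒coprime : ∀ {k} → ¬ 2 ∣ k → ℕ.Coprime k 2
2∤⇒coprime 2∤k {0} (_ , 0∣2) = contradiction (0∣⇒≡0 0∣2) λ ()
2∤⇒coprime 2∤k {1} _ = ≡.refl
2∤⇒coprime 2∤k {2} (2∣k , _) = contradiction 2∣k 2∤k
2∤⇒coprime 2∤k {suc (suc (suc _))} (_ , d∣2) = contradiction (∣⇒≤ d∣2) λ { (ℕ.s≤s (ℕ.s≤s ())) }

∣2^i*n⇒∣n : ∀ {k n} → ¬ 2 ∣ k → ∀ i → k ∣ 2 ℕ.^ i ℕ.* n → k ∣ n
∣2^i*n⇒∣n {k} {n} 2∤k zero    k∣ = ≡.subst (k ∣_) (ℕ.*-identityˡ n) k∣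
∣2^i*n⇒∣n {k} {n} 2∤k (suc i) k∣ = ∣2^i*n⇒∣n 2∤k i
  (ℕ.coprime-divisor (2∤⇒coprime 2∤k) (≡.subst (k ∣_) (ℕ.*-assoc 2 (2 ℕ.^ i) n) k∣))

-- Among the k + 1 powers 2^0, ..., 2^k two agree modulo k, and the smaller one cancels because k is
-- odd. The exponent is returned as a successor since 2^m then serves as the inverse of 2.
power-of-2≡1 : ∀ k .{{_ : NonZero k}} → ¬ 2 ∣ k → ∃[ m ] ∃[ q ] 2 ℕ.^ suc m ≡ 1 ℕ.+ q ℕ.* k
power-of-2≡1 k 2∤k with Fin.pigeonhole (ℕ.n<1+n k) (λ i → fromℕ< (m%n<n (2 ℕ.^ toℕ i) k))
... | i , j , i<j , eq with ℕ.m≤n⇒∃[o]m+o≡n i<j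
... | m , 1+i+m≡j with ∣2^i*n⇒∣n {n = 2 ℕ.^ suc m ℕ.∸ 1} 2∤k (toℕ i) k∣
  where
  open ≡.≡-Reasoning
  I = 2 ℕ.^ toℕ i
  J = 2 ℕ.^ toℕ j
  J≡ : J ≡ I ℕ.+ I ℕ.* (2 ℕ.^ suc m ℕ.∸ 1)
  J≡ = begin
    J                                        ≡⟨ ≡.cong (2 ℕ.^_) (≡.trans (≡.sym 1+i+m≡j) (≡.sym (ℕ.+-suc (toℕ i) m))) ⟩
    2 ℕ.^ (toℕ i ℕ.+ suc m)                  ≡⟨ ℕ.^-distribˡ-+-* 2 (toℕ i) (suc m) ⟩
    I ℕ.* 2 ℕ.^ suc m                        ≡⟨ ≡.cong (I ℕ.*_) (ℕ.m+[n∸m]≡n (ℕ.m^n>0 2 (suc m))) ⟨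
    I ℕ.* (1 ℕ.+ (2 ℕ.^ suc m ℕ.∸ 1))        ≡⟨ ℕ.*-suc I _ ⟩
    I ℕ.+ I ℕ.* (2 ℕ.^ suc m ℕ.∸ 1)          ∎
  residue : I % k ≡ J % k
  residue = ≡.trans (≡.sym (Fin.toℕ-fromℕ< _)) (≡.trans (≡.cong toℕ eq) (Fin.toℕ-fromℕ< _))
  k∣ : k ∣ I ℕ.* (2 ℕ.^ suc m ℕ.∸ 1)
  k∣ = ∣m+n∣m⇒∣n (≡.subst (k ∣_) J/k (n∣m*n (J / k))) (n∣m*n (I / k))
    where
    J/k : J / k ℕ.* k ≡ I / k ℕ.* k ℕ.+ I ℕ.* (2 ℕ.^ suc m ℕ.∸ 1)
    J/k = ℕ.+-cancelˡ-≡ (I % k) _ _ $ begin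
      I % k ℕ.+ J / k ℕ.* k                                             ≡⟨ ≡.cong (ℕ._+ J / k ℕ.* k) residue ⟩
      J % k ℕ.+ J / k ℕ.* k                                             ≡⟨ m≡m%n+[m/n]*n J k ⟨
      J                                                                 ≡⟨ J≡ ⟩
      I ℕ.+ I ℕ.* (2 ℕ.^ suc m ℕ.∸ 1)                                   ≡⟨ ≡.cong (ℕ._+ I ℕ.* (2 ℕ.^ suc m ℕ.∸ 1)) (m≡m%n+[m/n]*n I k) ⟩
      (I % k ℕ.+ I / k ℕ.* k) ℕ.+ I ℕ.* (2 ℕ.^ suc m ℕ.∸ 1)             ≡⟨ ℕ.+-assoc (I % k) _ _ ⟩
      I % k ℕ.+ (I / k ℕ.* k ℕ.+ I ℕ.* (2 ℕ.^ suc m ℕ.∸ 1))             ∎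
... | divides q eq′ = m , q , ≡.trans (≡.sym (ℕ.m+[n∸m]≡n (ℕ.m^n>0 2 (suc m)))) (≡.cong suc eq′)

-- The overlap equation in characteristic two

OverlapEquation : ∀ {c ℓ} (K : CommutativeRing c ℓ) → CommutativeRing.Carrier K → (ω i j s t : ℕ) → Set ℓ
OverlapEquation K x ω i j s t = x ^ ω * ((x ^ j - 1#) * (x ^ s - 1#)) ≈ (x ^ i - 1#) * (x ^ t - 1#)
  where open CommutativeRing K; open SemiringExp semiring

module Modulo2 {c ℓ} (F : CommutativeRing c ℓ) (x+x≈0 : CharacteristicTwo F) where
  open CommutativeRing F hiding (zero)
  open IntegerCoefficients F
  open Solver
  open SemiringExp semiring
  open CommutativeSemiringExp commutativeSemiring using (^-distrib-*)
  open import Relation.Binary.Reasoning.Setoid setoid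

  drop-twice : ∀ x y → x + (y + y) ≈ x
  drop-twice x y = trans (+-congˡ (x+x≈0 y)) (+-identityʳ x)

  -- In characteristic two an odd number is 1, so g is an inverse of u.
  cancel-odd-divisor : ∀ {u g h} → 1# + (h + h) ≈ g * u → ∀ {y} → u * y ≈ 0# → y ≈ 0#
  cancel-odd-divisor {u} {g} {h} odd {y} uy≈0 = begin
    y                        ≈⟨ drop-twice y (h * y) ⟨
    y + (h * y + h * y)      ≈⟨ solve 2 (λ h y → y :+ (h :* y :+ h :* y) := (con (+ 1) :+ (h :+ h)) :* y) refl h y ⟩
    (1# + (h + h)) * y       ≈⟨ *-congʳ odd ⟩
    (g * u) * y              ≈⟨ *-assoc g u y ⟩
    g * (u * y)              ≈⟨ *-congˡ uy≈0 ⟩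
    g * 0#                   ≈⟨ zeroʳ g ⟩
    0#                       ∎

  difference-quotient : ∀ {x y y⁻¹ w} → y * y⁻¹ ≈ 1# → (x - y) * w ≈ 0# → (x * y⁻¹ - 1#) * w ≈ 0#
  difference-quotient {x} {y} {y⁻¹} {w} yy⁻¹≈1 eq = begin
    (x * y⁻¹ - 1#) * w          ≈⟨ *-congʳ (+-congˡ (-‿cong yy⁻¹≈1)) ⟨
    (x * y⁻¹ - y * y⁻¹) * w     ≈⟨ solve 4 (λ x y z w → (x :* z :- y :* z) :* w := z :* ((x :- y) :* w)) refl x y y⁻¹ w ⟩
    y⁻¹ * ((x - y) * w)         ≈⟨ *-congˡ eq ⟩
    y⁻¹ * 0#                    ≈⟨ zeroʳ y⁻¹ ⟩
    0#                          ∎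

  product-difference : ∀ {x y u v} → (x * y) * u ≈ (x * y) * v → x * (y * (u - v)) ≈ 0#
  product-difference {x} {y} {u} {v} eq = begin
    x * (y * (u - v))              ≈⟨ solve 4 (λ x y u v → x :* (y :* (u :- v)) := (x :* y) :* u :- (x :* y) :* v) refl x y u v ⟩
    (x * y) * u - (x * y) * v      ≈⟨ +-congʳ eq ⟩
    (x * y) * v - (x * y) * v      ≈⟨ -‿inverseʳ _ ⟩
    0#                             ∎

  -- The two sides differ by 2(1 - x), which vanishes.
  square-1 : ∀ x → x * x - 1# ≈ (x - 1#) * (x - 1#)
  square-1 x = trans (sym (drop-twice _ (1# - x)))
    (solve 1 (λ x → (x :* x :- con (+ 1)) :+ ((con (+ 1) :- x) :+ (con (+ 1) :- x)) := (x :- con (+ 1)) :* (x :- con (+ 1))) refl x)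

  overlap-resp : ∀ {x y} → x ≈ y → ∀ {ω i j s t} → OverlapEquation F x ω i j s t → OverlapEquation F y ω i j s t
  overlap-resp e {ω} {i} {j} {s} {t} eq = trans
    (*-cong (^-congˡ ω (sym e)) (*-cong (+-congʳ (^-congˡ j (sym e))) (+-congʳ (^-congˡ s (sym e)))))
    (trans eq (*-cong (+-congʳ (^-congˡ i e)) (+-congʳ (^-congˡ t e))))

  power-1 : ∀ x n → (x * x) ^ n - 1# ≈ (x ^ n - 1#) * (x ^ n - 1#)
  power-1 x n = trans (+-congʳ (^-distrib-* x x n)) (square-1 (x ^ n))

  frobenius : ∀ {x ω i j s t} → OverlapEquation F x ω i j s t → OverlapEquation F (x * x) ω i j s t
  frobenius {x} {ω} {i} {j} {s} {t} eq = begin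
    (x * x) ^ ω * (((x * x) ^ j - 1#) * ((x * x) ^ s - 1#))
      ≈⟨ *-cong (^-distrib-* x x ω) (*-cong (power-1 x j) (power-1 x s)) ⟩
    (x ^ ω * x ^ ω) * (((x ^ j - 1#) * (x ^ j - 1#)) * ((x ^ s - 1#) * (x ^ s - 1#)))
      ≈⟨ solve 3 (λ a b c → (a :* a) :* ((b :* b) :* (c :* c)) := (a :* (b :* c)) :* (a :* (b :* c))) refl _ _ _ ⟩
    (x ^ ω * ((x ^ j - 1#) * (x ^ s - 1#))) * (x ^ ω * ((x ^ j - 1#) * (x ^ s - 1#)))
      ≈⟨ *-cong eq eq ⟩
    ((x ^ i - 1#) * (x ^ t - 1#)) * ((x ^ i - 1#) * (x ^ t - 1#))
      ≈⟨ solve 2 (λ a b → (a :* b) :* (a :* b) := (a :* a) :* (b :* b)) refl _ _ ⟩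
    ((x ^ i - 1#) * (x ^ i - 1#)) * ((x ^ t - 1#) * (x ^ t - 1#))
      ≈⟨ *-cong (power-1 x i) (power-1 x t) ⟨
    ((x * x) ^ i - 1#) * ((x * x) ^ t - 1#) ∎

  frobenius^ : ∀ m {x ω i j s t} → OverlapEquation F x ω i j s t → OverlapEquation F (x ^ (2 ℕ.^ m)) ω i j s t
  frobenius^ zero    {x} {ω} {i} {j} {s} {t} eq = overlap-resp (sym (*-identityʳ x)) {ω} {i} {j} {s} {t} eq
  frobenius^ (suc m) {x} {ω} {i} {j} {s} {t} eq = overlap-resp (begin
      x ^ (2 ℕ.^ m) * x ^ (2 ℕ.^ m)     ≈⟨ ^-homo-* x (2 ℕ.^ m) (2 ℕ.^ m) ⟨
      x ^ (2 ℕ.^ m ℕ.+ 2 ℕ.^ m)         ≡⟨ ≡.cong (λ l → x ^ (2 ℕ.^ m ℕ.+ l)) (ℕ.+-identityʳ (2 ℕ.^ m)) ⟨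
      x ^ (2 ℕ.^ suc m)                 ∎) {ω} {i} {j} {s} {t}
    (frobenius {x ^ (2 ℕ.^ m)} {ω} {i} {j} {s} {t} (frobenius^ m {x} {ω} {i} {j} {s} {t} eq))

  module _ {a b c d e} (de≈a²bc : d * e ≈ (a * a) * (b * c)) (d+e≈a[b+c] : d + e ≈ a * (b + c)) where

    -- By Vieta the hypotheses say that T² - (d + e)T + de and (T - ab)(T - ac) are the same
    -- polynomial, and d is a root of the first.
    [d-ab][d-ac]≈0 : (d - a * b) * (d - a * c) ≈ 0#
    [d-ab][d-ac]≈0 = begin
      (d - a * b) * (d - a * c)
        ≈⟨ solve 4 (λ a b c d → (d :- a :* b) :* (d :- a :* c) := (d :* d :- d :* (a :* (b :+ c))) :+ (a :* a) :* (b :* c)) refl a b c d ⟩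
      (d * d - d * (a * (b + c))) + (a * a) * (b * c)
        ≈⟨ +-cong (+-congˡ (-‿cong (*-congˡ d+e≈a[b+c]))) de≈a²bc ⟨
      (d * d - d * (d + e)) + d * e
        ≈⟨ solve 2 (λ d e → (d :* d :- d :* (d :+ e)) :+ d :* e := con (+ 0)) refl d e ⟩
      0# ∎

    -- Expanding the overlap equation gives abc - a(b + c) + a = de - (d + e) + 1. Substituting for
    -- de and d + e leaves abc + a = a²bc + 1.
    [a-1][abc-1]≈0 : a * ((b - 1#) * (c - 1#)) ≈ (d - 1#) * (e - 1#) → (a - 1#) * (a * (b * c) - 1#) ≈ 0#
    [a-1][abc-1]≈0 eq = begin
      (a - 1#) * (a * (b * c) - 1#)
        ≈⟨ solve 3 (λ a b c → (a :- con (+ 1)) :* (a :* (b :* c) :- con (+ 1)) :=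
             ((a :* a) :* (b :* c) :+ con (+ 1) :- a :* (b :+ c)) :- a :* ((b :- con (+ 1)) :* (c :- con (+ 1)))) refl a b c ⟩
      ((a * a) * (b * c) + 1# - a * (b + c)) - a * ((b - 1#) * (c - 1#))
        ≈⟨ +-cong (+-cong (+-congʳ (sym de≈a²bc)) (-‿cong (sym d+e≈a[b+c]))) (-‿cong eq) ⟩
      (d * e + 1# - (d + e)) - (d - 1#) * (e - 1#)
        ≈⟨ solve 2 (λ d e → (d :* e :+ con (+ 1) :- (d :+ e)) :- (d :- con (+ 1)) :* (e :- con (+ 1)) := con (+ 0)) refl d e ⟩
      0# ∎

-- Overlaps of an odd root of unity, compared modulo 2

module OddOverlap {κ ℓ} (K : CommutativeRing κ ℓ)
  (domain : IsDomain K) (char0 : CharacteristicZero K) (ζ : CommutativeRing.Carrier K)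
  (k h : ℕ) {{_ : NonZero k}} (k≡1+2h : k ≡ suc (h ℕ.+ h)) (2∤k : ¬ 2 ∣ k)
  (ζ^k≈1 : RootOfUnity K ζ k) (ζ-order : OrderMultipleOf K ζ k) where
  open CommutativeRing K hiding (zero)
  open SemiringExp semiring
  open IntegerCoefficients K
  open Solver
  open Geometric K
  open Adjunction K domain char0 ζ k ζ^k≈1
  open CommutativeSemiringExp commutativeSemiring using (^-distrib-*)
  open import Algebra.Properties.Ring ring using (x∙y⁻¹≈ε⇒x≈y)
  open import Relation.Binary.Reasoning.Setoid setoid

  private
    module Q = CommutativeRing mod2
    module Q^ = SemiringExp Q.semiring

  proj₁-^ : ∀ x n → proj₁ (x Q^.^ n) ≈ proj₁ x ^ n
  proj₁-^ x zero    = refl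
  proj₁-^ x (suc n) = *-congˡ (proj₁-^ x n)

  x+x~0 : ∀ x → x Q.+ x ~ Q.0#
  x+x~0 (x , r) = mk~ x r (sym (+-identityˡ _))

  open Modulo2 mod2 x+x~0

  1≁0 : ¬ Q.1# ~ Q.0#
  1≁0 (mk~ r r∈ e) = 2∤1 r∈ (trans e (+-identityˡ _))

  geometric-∈ : ∀ {x} → ℤ[ζ] x → ∀ n → ℤ[ζ] (geometric x n)
  geometric-∈ r zero    = nought
  geometric-∈ r (suc n) = add (geometric-∈ r n) (power r n)

  geometric²-∈ : ∀ {x} → ℤ[ζ] x → ∀ n → ℤ[ζ] (geometric² x n)
  geometric²-∈ r zero    = nought
  geometric²-∈ r (suc n) = add (geometric²-∈ r n) (geometric-∈ r n)

  -- A k-th root of unity x ≠ 1 has 1 + x + ⋯ + x^(k-1) = 0, so x - 1 divides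
  -- the odd number k and is a unit modulo 2.
  cancel-root-1 : ∀ x → proj₁ x ^ k ≈ 1# → ¬ proj₁ x ≈ 1# → ∀ y → (x Q.- Q.1#) Q.* y ~ Q.0# → y ~ Q.0#
  cancel-root-1 X@(x , r) x^k≈1 x≉1 y = cancel-odd-divisor {X Q.- Q.1#} {G} {H} k≡1 {y}
    where
    geometric≈0 : geometric x k ≈ 0#
    geometric≈0 = domain _ _ (trans (geometric-sum x k) (trans (+-congʳ x^k≈1) (-‿inverseʳ 1#)))
      (x≉1 ∘ x∙y⁻¹≈ε⇒x≈y x 1#)
    ι-∈ : ∀ n → ℤ[ζ] (ι (+ n))
    ι-∈ zero    = nought
    ι-∈ (suc n) = resp (sym (suc-· n)) (add one (ι-∈ n))
    H G : ∃[ r ] ℤ[ζ] r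
    H = ι (+ h) , ι-∈ h
    -- Since the geometric sum of x vanishes, (x - 1) · `geometric² x k` = -k, which explains the
    -- sign.
    G = - geometric² x k , neg (geometric²-∈ r k)
    k≡1 : Q.1# Q.+ (H Q.+ H) ~ G Q.* (X Q.- Q.1#)
    k≡1 = lift (begin
      1# + (ι (+ h) + ι (+ h))             ≈⟨ +-congˡ (ι-+ (+ h) (+ h)) ⟨
      1# + ι (+ (h ℕ.+ h))                 ≈⟨ suc-· (h ℕ.+ h) ⟨
      ι (+ suc (h ℕ.+ h))                  ≡⟨ ≡.cong (λ n → ι (+ n)) k≡1+2h ⟨
      ι (+ k)                              ≈⟨ solve 2 (λ g k → k := :- (g :- k) :+ g) refl (geometric x k) (ι (+ k)) ⟩
      - (geometric x k - ι (+ k)) + geometric x k   ≈⟨ +-cong (-‿cong (sym (geometric²-sum x k))) geometric≈0 ⟩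
      - ((x - 1#) * geometric² x k) + 0#   ≈⟨ solve 2 (λ x g → :- ((x :- con (+ 1)) :* g) :+ con (+ 0) := (:- g) :* (x :- con (+ 1))) refl x _ ⟩
      - geometric² x k * (x - 1#)          ∎)

  double-cancel : ∀ {x} → x + x ≈ 0# → x ≈ 0#
  double-cancel {x} x+x≈0 = domain _ _
    (trans (solve 1 (λ x → con (+ 2) :* x := x :+ x) refl x) x+x≈0)
    (λ 2≈0 → contradiction (char0 (+ 2) 2≈0) λ ())

  root-power : ∀ {x} → x ^ k ≈ 1# → ∀ n → (x ^ n) ^ k ≈ 1#
  root-power {x} x^k≈1 n = begin
    (x ^ n) ^ k        ≈⟨ ^-assocʳ x n k ⟩
    x ^ (n ℕ.* k)      ≡⟨ ≡.cong (x ^_) (ℕ.*-comm n k) ⟩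
    x ^ (k ℕ.* n)      ≈⟨ ^-assocʳ x k n ⟨
    (x ^ k) ^ n        ≈⟨ ^-congˡ n x^k≈1 ⟩
    1# ^ n             ≈⟨ 1^n≈1 n ⟩
    1#                 ∎

  private
    m q : ℕ
    m = proj₁ (power-of-2≡1 k 2∤k)
    q = proj₁ (proj₂ (power-of-2≡1 k 2∤k))

    2^[1+m]≡1+qk : 2 ℕ.^ suc m ≡ 1 ℕ.+ q ℕ.* k
    2^[1+m]≡1+qk = proj₂ (proj₂ (power-of-2≡1 k 2∤k))

  -- As an m-fold iterated square of `Z`, `Ψ` inherits the overlap equation modulo 2 through
  -- `frobenius^`.
  Z Ψ : Q.Carrier
  Z = ζ , gen
  Ψ = Z Q^.^ (2 ℕ.^ m)

  ψ^ : ℕ → Carrier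
  ψ^ n = proj₁ (Ψ Q^.^ n)

  ψ^≈ : ∀ n → ψ^ n ≈ (ζ ^ n) ^ (2 ℕ.^ m)
  ψ^≈ n = begin
    ψ^ n                          ≈⟨ proj₁-^ Ψ n ⟩
    proj₁ Ψ ^ n                   ≈⟨ ^-congˡ n (proj₁-^ Z (2 ℕ.^ m)) ⟩
    (ζ ^ (2 ℕ.^ m)) ^ n           ≈⟨ ^-assocʳ ζ (2 ℕ.^ m) n ⟩
    ζ ^ (2 ℕ.^ m ℕ.* n)           ≡⟨ ≡.cong (ζ ^_) (ℕ.*-comm (2 ℕ.^ m) n) ⟩
    ζ ^ (n ℕ.* 2 ℕ.^ m)           ≈⟨ ^-assocʳ ζ n (2 ℕ.^ m) ⟨
    (ζ ^ n) ^ (2 ℕ.^ m)           ∎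

  ψ^k≈1 : ∀ n → ψ^ n ^ k ≈ 1#
  ψ^k≈1 n = trans (^-congˡ k (ψ^≈ n)) (root-power (root-power ζ^k≈1 n) (2 ℕ.^ m))

  -- Since 2 · 2^m = 1 + qk and ζ^k = 1, this is an equality in K and not merely a congruence. That
  -- matters in `multiple-of-Y`, where an exact equation is divided by 2.
  ψ²≈ζ : ∀ n → ψ^ n * ψ^ n ≈ ζ ^ n
  ψ²≈ζ n = begin
    ψ^ n * ψ^ n                                  ≈⟨ *-cong (ψ^≈ n) (ψ^≈ n) ⟩
    (ζ ^ n) ^ (2 ℕ.^ m) * (ζ ^ n) ^ (2 ℕ.^ m)    ≈⟨ ^-homo-* (ζ ^ n) (2 ℕ.^ m) (2 ℕ.^ m) ⟨
    (ζ ^ n) ^ (2 ℕ.^ m ℕ.+ 2 ℕ.^ m)              ≡⟨ ≡.cong (λ l → (ζ ^ n) ^ (2 ℕ.^ m ℕ.+ l)) (ℕ.+-identityʳ (2 ℕ.^ m)) ⟨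
    (ζ ^ n) ^ (2 ℕ.^ suc m)                      ≡⟨ ≡.cong ((ζ ^ n) ^_) 2^[1+m]≡1+qk ⟩
    ζ ^ n * (ζ ^ n) ^ (q ℕ.* k)                  ≈⟨ *-congˡ (^-assocʳ (ζ ^ n) q k) ⟨
    ζ ^ n * ((ζ ^ n) ^ q) ^ k                    ≈⟨ *-congˡ (root-power (root-power ζ^k≈1 n) q) ⟩
    ζ ^ n * 1#                                   ≈⟨ *-identityʳ _ ⟩
    ζ ^ n                                        ∎

  -- If ψ^n were 1, squaring would give ζ^n = 1 and hence k ∣ n. So ψ^n is a k-th root of unity
  -- other than 1 and `cancel-root-1` applies.
  cancel-ψ-1 : ∀ {n} → ¬ k ∣ n → ∀ {y} → (Ψ Q^.^ n Q.- Q.1#) Q.* y ~ Q.0# → y ~ Q.0#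
  cancel-ψ-1 {n} k∤n {y} = cancel-root-1 (Ψ Q^.^ n) (ψ^k≈1 n)
    (λ ψ^n≈1 → k∤n (ζ-order n (trans (sym (ψ²≈ζ n)) (trans (*-cong ψ^n≈1 ψ^n≈1) (*-identityˡ 1#))))) y

  -- l (h + h) = l (k - 1) ≡ -l (mod k), so ψ^(l (h + h)) is the inverse of ψ^l.
  cancel-ψ-ψ : ∀ {p l} → ¬ k ∣ p ℕ.+ l ℕ.* (h ℕ.+ h) → ∀ {y} → (Ψ Q^.^ p Q.- Ψ Q^.^ l) Q.* y ~ Q.0# → y ~ Q.0#
  cancel-ψ-ψ {p} {l} k∤ {y} eq = cancel-ψ-1 k∤ {y} (Q.trans
    (Q.*-congʳ {y} (Q.+-congʳ { Q.- Q.1# } (Q^.^-homo-* Ψ p n)))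
    (difference-quotient ψ^l+n eq))
    where
    n = l ℕ.* (h ℕ.+ h)
    ψ^l+n : Ψ Q^.^ l Q.* Ψ Q^.^ n ~ Q.1#
    ψ^l+n = Q.trans (Q.sym (Q^.^-homo-* Ψ l n)) (lift (begin
      ψ^ (l ℕ.+ n)            ≡⟨ ≡.cong ψ^ (≡.trans (≡.sym (ℕ.*-suc l (h ℕ.+ h))) (≡.cong (l ℕ.*_) (≡.sym k≡1+2h))) ⟩
      ψ^ (l ℕ.* k)            ≈⟨ proj₁-^ Ψ (l ℕ.* k) ⟩
      proj₁ Ψ ^ (l ℕ.* k)     ≈⟨ ^-assocʳ (proj₁ Ψ) l k ⟨
      (proj₁ Ψ ^ l) ^ k       ≈⟨ ^-congˡ k (proj₁-^ Ψ l) ⟨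
      ψ^ l ^ k                ≈⟨ ψ^k≈1 l ⟩
      1#                      ∎))

  module _ {ω i j s t} (k∤i : ¬ k ∣ i) (k∤t : ¬ k ∣ t)
    (is-overlap : OverlapEquation K ζ ω i j s t)
    (conjugate : ζ ^ i * ζ ^ t ≈ (ζ ^ ω * ζ ^ ω) * (ζ ^ j * ζ ^ s)) where
    private
      A = Ψ Q^.^ ω
      B = Ψ Q^.^ j
      C = Ψ Q^.^ s
      D = Ψ Q^.^ i
      E = Ψ Q^.^ t
      a = proj₁ A
      b = proj₁ B
      c = proj₁ C
      d = proj₁ D
      e = proj₁ E

    overlap-mod2 : OverlapEquation mod2 Ψ ω i j s t
    overlap-mod2 = frobenius^ m {Z} {ω} {i} {j} {s} {t} (lift
      (trans (*-cong (proj₁-^ Z ω) (*-cong (+-congʳ (proj₁-^ Z j)) (+-congʳ (proj₁-^ Z s))))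
        (trans is-overlap (sym (*-cong (+-congʳ (proj₁-^ Z i)) (+-congʳ (proj₁-^ Z t)))))))

    overlap-squares : (a * a) * ((b * b - 1#) * (c * c - 1#)) ≈ (d * d - 1#) * (e * e - 1#)
    overlap-squares = trans (*-cong (ψ²≈ζ ω) (*-cong (+-congʳ (ψ²≈ζ j)) (+-congʳ (ψ²≈ζ s))))
      (trans is-overlap (sym (*-cong (+-congʳ (ψ²≈ζ i)) (+-congʳ (ψ²≈ζ t)))))

    de≈a²bc : d * e ≈ (a * a) * (b * c)
    de≈a²bc = begin
      d * e                                ≈⟨ *-cong (ψ^≈ i) (ψ^≈ t) ⟩
      (ζ ^ i) ^ g * (ζ ^ t) ^ g            ≈⟨ ^-distrib-* (ζ ^ i) (ζ ^ t) g ⟨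
      (ζ ^ i * ζ ^ t) ^ g                  ≈⟨ ^-congˡ g conjugate ⟩
      ((ζ ^ ω * ζ ^ ω) * (ζ ^ j * ζ ^ s)) ^ g
        ≈⟨ trans (^-distrib-* _ _ g) (*-cong (^-distrib-* _ _ g) (^-distrib-* _ _ g)) ⟩
      ((ζ ^ ω) ^ g * (ζ ^ ω) ^ g) * ((ζ ^ j) ^ g * (ζ ^ s) ^ g)
        ≈⟨ *-cong (*-cong (ψ^≈ ω) (ψ^≈ ω)) (*-cong (ψ^≈ j) (ψ^≈ s)) ⟨
      (a * a) * (b * c)                    ∎
      where g = 2 ℕ.^ m

    -- With X = a(b-1)(c-1), Y = (d-1)(e-1), X′ = a(b+1)(c+1), Y′ = (d+1)(e+1) one has
    -- X X′ = Y Y′ and X = Y + 2r.  Expanding and dividing by 2 compares the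
    -- differences X′ - X = 2a(b+c) and Y′ - Y = 2(d+e) modulo 2.
    multiple-of-Y : ((D Q.- Q.1#) Q.* (E Q.- Q.1#)) Q.* (D Q.+ E) ~ ((D Q.- Q.1#) Q.* (E Q.- Q.1#)) Q.* (A Q.* (B Q.+ C))
    multiple-of-Y with overlap-mod2
    ... | mk~ r r∈ X≈Y+2r = mk~ u u∈ (x∙y⁻¹≈ε⇒x≈y _ _ (double-cancel (begin
      (Y * (d + e) - (Y * β + (u + u))) + (Y * (d + e) - (Y * β + (u + u)))
        ≈⟨ solve 5 (λ Y d e β r → (Y :* (d :+ e) :- (Y :* β :+ ((r :* Y :+ (r :* r :+ r :* β)) :+ (r :* Y :+ (r :* r :+ r :* β)))))
                              :+ (Y :* (d :+ e) :- (Y :* β :+ ((r :* Y :+ (r :* r :+ r :* β)) :+ (r :* Y :+ (r :* r :+ r :* β)))))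
             := Y :* (Y :+ ((d :+ e) :+ (d :+ e))) :- (Y :+ (r :+ r)) :* ((Y :+ (r :+ r)) :+ (β :+ β)))
             refl Y d e β r ⟩
      Y * (Y + ((d + e) + (d + e))) - (Y + (r + r)) * ((Y + (r + r)) + (β + β))
        ≈⟨ +-congˡ (-‿cong (*-cong X≈Y+2r (+-congʳ X≈Y+2r))) ⟨
      Y * (Y + ((d + e) + (d + e))) - X * (X + (β + β))
        ≈⟨ solve 5 (λ a b c d e → let one = con (+ 1); X = a :* ((b :- one) :* (c :- one)); Y = (d :- one) :* (e :- one); β = a :* (b :+ c) in
               Y :* (Y :+ ((d :+ e) :+ (d :+ e))) :- X :* (X :+ (β :+ β))
             := (d :* d :- one) :* (e :* e :- one) :- (a :* a) :* ((b :* b :- one) :* (c :* c :- one)))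
             refl a b c d e ⟩
      (d * d - 1#) * (e * e - 1#) - (a * a) * ((b * b - 1#) * (c * c - 1#))
        ≈⟨ +-congˡ (-‿cong overlap-squares) ⟩
      (d * d - 1#) * (e * e - 1#) - (d * d - 1#) * (e * e - 1#)
        ≈⟨ -‿inverseʳ _ ⟩
      0# ∎)))
      where
      X = a * ((b - 1#) * (c - 1#))
      Y = (d - 1#) * (e - 1#)
      β = a * (b + c)
      -- With X′ = X + 2β, Y′ = Y + 2(d + e) and X = Y + 2r, the equation X X′ = Y Y′ becomes 2Y(d +
      -- e) = 2Yβ + 4(rY + r² + rβ); halved, it shows u as the required half.
      u = r * Y + (r * r + r * β)
      u∈ : ℤ[ζ] u
      u∈ = add (mul r∈ (proj₂ ((D Q.- Q.1#) Q.* (E Q.- Q.1#))))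
             (add (mul r∈ r∈) (mul r∈ (proj₂ (A Q.* (B Q.+ C)))))

    -- Both factors ψ^i - 1 and ψ^t - 1 of Y are units modulo 2, as k divides neither i nor t, so Y
    -- cancels from `multiple-of-Y`.
    d+e~a[b+c] : D Q.+ E ~ A Q.* (B Q.+ C)
    d+e~a[b+c] = Q-x∙y⁻¹≈ε⇒x≈y _ _ (cancel-ψ-1 {t} k∤t {D Q.+ E Q.- A Q.* (B Q.+ C)}
      (cancel-ψ-1 {i} k∤i {(E Q.- Q.1#) Q.* (D Q.+ E Q.- A Q.* (B Q.+ C))}
        (product-difference {D Q.- Q.1#} {E Q.- Q.1#} {D Q.+ E} {A Q.* (B Q.+ C)} multiple-of-Y)))
      where
      open import Algebra.Properties.Ring Q.ring using () renaming (x∙y⁻¹≈ε⇒x≈y to Q-x∙y⁻¹≈ε⇒x≈y)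

    -- Deciding the two divisibilities turns a vanishing product into a disjunction: if both failed,
    -- both factors of `[d-ab][d-ac]≈0` would cancel and leave 1 ~ 0. Adding u (h + h) is
    -- subtracting u modulo k, because h + h = k - 1.
    i≡ω+j∨ω+s : k ∣ i ℕ.+ (ω ℕ.+ j) ℕ.* (h ℕ.+ h) ⊎ k ∣ i ℕ.+ (ω ℕ.+ s) ℕ.* (h ℕ.+ h)
    i≡ω+j∨ω+s with k ∣? i ℕ.+ (ω ℕ.+ j) ℕ.* (h ℕ.+ h) | k ∣? i ℕ.+ (ω ℕ.+ s) ℕ.* (h ℕ.+ h)
    ... | yes p | _     = inj₁ p
    ... | no _  | yes p = inj₂ p
    ... | no ¬p | no ¬q = contradiction
      (cancel-ψ-ψ {i} {ω ℕ.+ s} ¬q {Q.1#} (Q.trans (Q.*-identityʳ (D Q.- Ψ Q^.^ (ω ℕ.+ s)))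
        (cancel-ψ-ψ {i} {ω ℕ.+ j} ¬p {D Q.- Ψ Q^.^ (ω ℕ.+ s)} (Q.trans
          (Q.*-cong (Q.+-congˡ (Q.-‿cong (Q^.^-homo-* Ψ ω j))) (Q.+-congˡ (Q.-‿cong (Q^.^-homo-* Ψ ω s))))
          ([d-ab][d-ac]≈0 {A} {B} {C} {D} {E} (lift de≈a²bc) d+e~a[b+c])))))
      1≁0

    ω≡0∨-[j+s] : k ∣ ω ⊎ k ∣ ω ℕ.+ (j ℕ.+ s)
    ω≡0∨-[j+s] with k ∣? ω | k ∣? ω ℕ.+ (j ℕ.+ s)
    ... | yes p | _     = inj₁ p
    ... | no _  | yes p = inj₂ p
    ... | no ¬p | no ¬q = contradiction
      (cancel-ψ-1 ¬q {Q.1#} (Q.trans (Q.*-identityʳ (Ψ Q^.^ (ω ℕ.+ (j ℕ.+ s)) Q.- Q.1#))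
        (cancel-ψ-1 ¬p {Ψ Q^.^ (ω ℕ.+ (j ℕ.+ s)) Q.- Q.1#} (Q.trans
          (Q.*-congˡ {A Q.- Q.1#} (Q.+-congʳ (Q.trans (Q^.^-homo-* Ψ ω (j ℕ.+ s)) (Q.*-congˡ {A} (Q^.^-homo-* Ψ j s)))))
          ([a-1][abc-1]≈0 {A} {B} {C} {D} {E} (lift de≈a²bc) d+e~a[b+c] overlap-mod2)))))
      1≁0

-- Gaussian numbers over a ring, and polynomial identities

module _ {c ℓ} (R : CommutativeRing c ℓ) where
  open CommutativeRing R
  open IntegerCoefficients R
  open Solver

  gaussian : CommutativeRing c ℓ
  gaussian = record
    { Carrier = Carrier × Carrier
    ; _≈_ = λ (a , b) (c , d) → a ≈ c × b ≈ d
    ; _+_ = λ (a , b) (c , d) → a + c , b + d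
    ; _*_ = λ (a , b) (c , d) → a * c - b * d , a * d + b * c
    ; -_  = λ (a , b) → - a , - b
    ; 0#  = 0# , 0#
    ; 1#  = 1# , 0#
    ; isCommutativeRing = record
      { isRing = record
        { +-isAbelianGroup = record
          { isGroup = record
            { isMonoid = record
              { isSemigroup = record
                { isMagma = record
                  { isEquivalence = record
                    { refl  = refl , refl
                    ; sym   = λ (p , q) → sym p , sym q
                    ; trans = λ (p , q) (p′ , q′) → trans p p′ , trans q q′
                    }
                  ; ∙-cong = λ (p , q) (p′ , q′) → +-cong p p′ , +-cong q q′
                  }
                ; assoc = λ _ _ _ → +-assoc _ _ _ , +-assoc _ _ _
                }
              ; identity = (λ _ → +-identityˡ _ , +-identityˡ _) , (λ _ → +-identityʳ _ , +-identityʳ _)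
              }
            ; inverse = (λ _ → -‿inverseˡ _ , -‿inverseˡ _) , (λ _ → -‿inverseʳ _ , -‿inverseʳ _)
            ; ⁻¹-cong = λ (p , q) → -‿cong p , -‿cong q
            }
          ; comm = λ _ _ → +-comm _ _ , +-comm _ _
          }
        ; *-cong = λ (p , q) (p′ , q′) →
            +-cong (*-cong p p′) (-‿cong (*-cong q q′)) , +-cong (*-cong p q′) (*-cong q p′)
        ; *-assoc = λ (a , b) (c , d) (e , f) →
            solve 6 (λ a b c d e f → (a :* c :- b :* d) :* e :- (a :* d :+ b :* c) :* f := a :* (c :* e :- d :* f) :- b :* (c :* f :+ d :* e)) refl a b c d e f ,
            solve 6 (λ a b c d e f → (a :* c :- b :* d) :* f :+ (a :* d :+ b :* c) :* e := a :* (c :* f :+ d :* e) :+ b :* (c :* e :- d :* f)) refl a b c d e f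
        ; *-identity =
            (λ (a , b) → solve 2 (λ a b → con (+ 1) :* a :- con (+ 0) :* b := a) refl a b ,
                         solve 2 (λ a b → con (+ 1) :* b :+ con (+ 0) :* a := b) refl a b) ,
            (λ (a , b) → solve 2 (λ a b → a :* con (+ 1) :- b :* con (+ 0) := a) refl a b ,
                         solve 2 (λ a b → a :* con (+ 0) :+ b :* con (+ 1) := b) refl a b)
        ; distrib =
            (λ (a , b) (c , d) (e , f) →
              solve 6 (λ a b c d e f → a :* (c :+ e) :- b :* (d :+ f) := (a :* c :- b :* d) :+ (a :* e :- b :* f)) refl a b c d e f ,
              solve 6 (λ a b c d e f → a :* (d :+ f) :+ b :* (c :+ e) := (a :* d :+ b :* c) :+ (a :* f :+ b :* e)) refl a b c d e f) ,
            (λ (a , b) (c , d) (e , f) →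
              solve 6 (λ a b c d e f → (c :+ e) :* a :- (d :+ f) :* b := (c :* a :- d :* b) :+ (e :* a :- f :* b)) refl a b c d e f ,
              solve 6 (λ a b c d e f → (c :+ e) :* b :+ (d :+ f) :* a := (c :* b :+ d :* a) :+ (e :* b :+ f :* a)) refl a b c d e f)
        }
      ; *-comm = λ (a , b) (c , d) →
          solve 4 (λ a b c d → a :* c :- b :* d := c :* a :- d :* b) refl a b c d ,
          solve 4 (λ a b c d → a :* d :+ b :* c := c :* b :+ d :* a) refl a b c d
      }
    }

  gaussian-conj-* : ∀ a b c d → (a * c - b * d ≈ a * c - (- b) * (- d)) × (- (a * d + b * c) ≈ a * (- d) + (- b) * c)
  gaussian-conj-* a b c d =
    solve 4 (λ a b c d → a :* c :- b :* d := a :* c :- (:- b) :* (:- d)) refl a b c d ,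
    solve 4 (λ a b c d → :- (a :* d :+ b :* c) := a :* (:- d) :+ (:- b) :* c) refl a b c d

  expand-norm : ∀ a b c d → (a * c + b * d) + (a * d + b * c) ≈ (a + b) * (c + d)
  expand-norm = solve 4 (λ a b c d → (a :* c :+ b :* d) :+ (a :* d :+ b :* c) := (a :+ b) :* (c :+ d)) refl

  parallelogram : ∀ a b → (a + b) * (a + b) + (a - b) * (a - b) ≈ (a * a + b * b) + (a * a + b * b)
  parallelogram = solve 2 (λ a b → (a :+ b) :* (a :+ b) :+ (a :- b) :* (a :- b) := (a :* a :+ b :* b) :+ (a :* a :+ b :* b)) refl


-- Stated over an arbitrary commutative ring because the identities are used both for ℚ and for the
-- Gaussian rationals.
module RingIdentities {c ℓ} (R : CommutativeRing c ℓ) where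
  open CommutativeRing R
  open IntegerCoefficients R
  open Solver

  difference-chain : ∀ x y z → (x - y) + (y - z) ≈ x - z
  difference-chain = solve 3 (λ x y z → (x :- y) :+ (y :- z) := x :- z) refl

  difference-+ : ∀ a b c d → (a - b) + (c - d) ≈ (a + c) - (b + d)
  difference-+ = solve 4 (λ a b c d → (a :- b) :+ (c :- d) := (a :+ c) :- (b :+ d)) refl

  difference-* : ∀ a b c d → a * c - b * d ≈ a * (c - d) + d * (a - b)
  difference-* = solve 4 (λ a b c d → a :* c :- b :* d := a :* (c :- d) :+ d :* (a :- b)) refl

  difference-cancel : ∀ x y → (x - y) + y ≈ x
  difference-cancel = solve 2 (λ x y → (x :- y) :+ y := x) refl

  difference-neg : ∀ x y → - (x - y) ≈ - x - - y
  difference-neg = solve 2 (λ x y → :- (x :- y) := :- x :- :- y) refl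

  difference-head : ∀ x y z → (x + y) - (x + z) ≈ y - z
  difference-head = solve 3 (λ x y z → (x :+ y) :- (x :+ z) := y :- z) refl

  difference-product : ∀ a s b t d → (a + s) * b - (a * t + d) ≈ a * (b - t) + (s * b - d)
  difference-product = solve 5 (λ a s b t d → (a :+ s) :* b :- (a :* t :+ d) := a :* (b :- t) :+ (s :* b :- d)) refl

  4-fold : ∀ x h → ((x + x) + (x + x)) * (h * h) ≈ x * ((h + h) * (h + h))
  4-fold = solve 2 (λ x h → ((x :+ x) :+ (x :+ x)) :* (h :* h) := x :* ((h :+ h) :* (h :+ h))) refl

  successor-distrib : ∀ n h y → (1# + n) * (h * y) ≈ h * (y + n * y)
  successor-distrib = solve 3 (λ n h y → (con (+ 1) :+ n) :* (h :* y) := h :* (y :+ n :* y)) refl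

  square-distrib : ∀ n d y → n * ((n * d) * (y * y)) ≈ ((n * y) * (n * y)) * d
  square-distrib = solve 3 (λ n d y → n :* ((n :* d) :* (y :* y)) := ((n :* y) :* (n :* y)) :* d) refl

  successor-product : ∀ n a b q y → (a * 1#) * (b * (q * y)) + n * (((a * q) * b) * y) ≈ (1# + n) * ((a * b) * (q * y))
  successor-product = solve 5 (λ n a b q y → (a :* con (+ 1)) :* (b :* (q :* y)) :+ n :* (((a :* q) :* b) :* y) := (con (+ 1) :+ n) :* ((a :* b) :* (q :* y))) refl

  *-swap : ∀ x y z → x * (y * z) ≈ y * (x * z)
  *-swap = solve 3 (λ x y z → x :* (y :* z) := y :* (x :* z)) refl

  fromReal-* : ∀ p q → (p * q - 0# * 0# ≈ p * q) × (p * 0# + 0# * q ≈ 0#)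
  fromReal-* p q =
    solve 2 (λ p q → p :* q :- con (+ 0) :* con (+ 0) := p :* q) refl p q ,
    solve 2 (λ p q → p :* con (+ 0) :+ con (+ 0) :* q := con (+ 0)) refl p q

  conjugate-product : ∀ a b → (a * a - b * (- b) ≈ a * a + b * b) × (a * (- b) + b * a ≈ 0#)
  conjugate-product a b =
    solve 2 (λ a b → a :* a :- b :* (:- b) := a :* a :+ b :* b) refl a b ,
    solve 2 (λ a b → a :* (:- b) :+ b :* a := con (+ 0)) refl a b

  real-multiple : ∀ a b q → (a * q - b * 0# ≈ a * q) × (a * 0# + b * q ≈ b * q)
  real-multiple a b q =
    solve 3 (λ a b q → a :* q :- b :* con (+ 0) := a :* q) refl a b q ,
    solve 3 (λ a b q → a :* con (+ 0) :+ b :* q := b :* q) refl a b q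

  odd-cancel : ∀ h c → (1# + (h + h)) * c + h * (- (c + c)) ≈ c
  odd-cancel = solve 2 (λ h c → (con (+ 1) :+ (h :+ h)) :* c :+ h :* (:- (c :+ c)) := c) refl

  minus-neg : ∀ b → b - - b ≈ b + b
  minus-neg = solve 1 (λ b → b :- :- b := b :+ b) refl

  complement : ∀ q p → q * p + (1# - q) * p ≈ p
  complement = solve 2 (λ q p → q :* p :+ (con (+ 1) :- q) :* p := p) refl

-- Formal exponential series

module CauchyProduct {c ℓ} (F : CommutativeRing c ℓ) where
  open CommutativeRing F hiding (zero)
  open IntegerCoefficients F using (module Solver)
  open Solver
  open SemiringMult semiring using () renaming (_×_ to _·_)
  open import Relation.Binary.Reasoning.Setoid setoid

  ∑ : ℕ → (ℕ → Carrier) → Carrier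
  ∑ zero    a = 0#
  ∑ (suc n) a = a 0 + ∑ n (a ∘ suc)

  ∑-cong : ∀ n {a b} → (∀ i → a i ≈ b i) → ∑ n a ≈ ∑ n b
  ∑-cong zero    e = refl
  ∑-cong (suc n) e = +-cong (e 0) (∑-cong n (e ∘ suc))

  ∑-*-+ : ∀ n x a b → ∑ n (λ i → x * a i + b i) ≈ x * ∑ n a + ∑ n b
  ∑-*-+ zero    x a b = solve 1 (λ x → con (+ 0) := x :* con (+ 0) :+ con (+ 0)) refl x
  ∑-*-+ (suc n) x a b = trans (+-congˡ (∑-*-+ n x (a ∘ suc) (b ∘ suc)))
    (solve 5 (λ x a b s t → (x :* a :+ b) :+ (x :* s :+ t) := x :* (a :+ s) :+ (b :+ t)) refl x (a 0) (b 0) _ _)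

  conv : (ℕ → Carrier) → (ℕ → Carrier) → ℕ → Carrier
  conv a b zero    = a 0 * b 0
  conv a b (suc m) = a 0 * b (suc m) + conv (a ∘ suc) b m

  -- The sum of a p · b q over the triangle p + q < n, taken row by row in p.
  diagonal : (ℕ → Carrier) → (ℕ → Carrier) → ℕ → Carrier
  diagonal a b zero    = 0#
  diagonal a b (suc n) = a 0 * ∑ (suc n) b + diagonal (a ∘ suc) b n

  -- The same triangle summed along antidiagonals on the left and along rows on the right.
  ∑-conv : ∀ n a b → ∑ n (conv a b) ≈ diagonal a b n
  ∑-conv zero    a b = refl
  ∑-conv (suc n) a b = begin
    a 0 * b 0 + ∑ n (λ m → a 0 * b (suc m) + conv (a ∘ suc) b m)
      ≈⟨ +-congˡ (∑-*-+ n (a 0) (b ∘ suc) _) ⟩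
    a 0 * b 0 + (a 0 * ∑ n (b ∘ suc) + ∑ n (conv (a ∘ suc) b))
      ≈⟨ +-congˡ (+-congˡ (∑-conv n (a ∘ suc) b)) ⟩
    a 0 * b 0 + (a 0 * ∑ n (b ∘ suc) + diagonal (a ∘ suc) b n)
      ≈⟨ solve 4 (λ a b s d → a :* b :+ (a :* s :+ d) := a :* (b :+ s) :+ d) refl _ _ _ _ ⟩
    a 0 * (b 0 + ∑ n (b ∘ suc)) + diagonal (a ∘ suc) b n ∎

  conv-cong : ∀ m {a a′ b b′} → (∀ i → a i ≈ a′ i) → (∀ i → b i ≈ b′ i) → conv a b m ≈ conv a′ b′ m
  conv-cong zero    p q = *-cong (p 0) (q 0)
  conv-cong (suc m) p q = +-cong (*-cong (p 0) (q (suc m))) (conv-cong m (p ∘ suc) q)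

  conv-+ˡ : ∀ m a a′ b → conv (λ i → a i + a′ i) b m ≈ conv a b m + conv a′ b m
  conv-+ˡ zero    a a′ b = distribʳ _ _ _
  conv-+ˡ (suc m) a a′ b = trans (+-congˡ (conv-+ˡ m (a ∘ suc) (a′ ∘ suc) b))
    (solve 5 (λ a a′ b s t → (a :+ a′) :* b :+ (s :+ t) := (a :* b :+ s) :+ (a′ :* b :+ t)) refl (a 0) (a′ 0) (b (suc m)) _ _)

  conv-*ˡ : ∀ m x a b → conv (λ i → x * a i) b m ≈ x * conv a b m
  conv-*ˡ zero    x a b = *-assoc _ _ _
  conv-*ˡ (suc m) x a b = trans (+-congˡ (conv-*ˡ m x (a ∘ suc) b))
    (solve 4 (λ x a b s → (x :* a) :* b :+ x :* s := x :* (a :* b :+ s)) refl x (a 0) (b (suc m)) _)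

  conv-*ʳ : ∀ m x a b → conv a (λ i → x * b i) m ≈ x * conv a b m
  conv-*ʳ zero    x a b = solve 3 (λ x a b → a :* (x :* b) := x :* (a :* b)) refl x (a 0) (b 0)
  conv-*ʳ (suc m) x a b = trans (+-congˡ (conv-*ʳ m x (a ∘ suc) b))
    (solve 4 (λ x a b s → a :* (x :* b) :+ x :* s := x :* (a :* b :+ s)) refl x (a 0) (b (suc m)) _)

  -- The coefficients of the derivative of a formal power series.
  ∂ : (ℕ → Carrier) → ℕ → Carrier
  ∂ a i = suc i · 1# * a (suc i)

  -- The product rule (fg)′ = f′g + fg′ on coefficients.
  leibniz : ∀ m a b → suc m · 1# * conv a b (suc m) ≈ conv (∂ a) b m + conv a (∂ b) m
  leibniz zero a b =
    solve 5 (λ n a₀ a₁ b₀ b₁ → n :* (a₀ :* b₁ :+ a₁ :* b₀) := (n :* a₁) :* b₀ :+ a₀ :* (n :* b₁)) refl (1 · 1#) (a 0) (a 1) (b 0) (b 1)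
  leibniz (suc m) a b = begin
    (1# + n) * (a 0 * b (suc (suc m)) + (a 1 * b (suc m) + s))
      ≈⟨ solve 6 (λ n a₀ a₁ b₁ b₂ s → (con (+ 1) :+ n) :* (a₀ :* b₂ :+ (a₁ :* b₁ :+ s)) :=
           ((con (+ 1) :+ n) :* (a₀ :* b₂) :+ (a₁ :* b₁ :+ s)) :+ n :* (a₁ :* b₁ :+ s)) refl n (a 0) (a 1) (b (suc m)) (b (suc (suc m))) s ⟩
    ((1# + n) * (a 0 * b (suc (suc m))) + (a 1 * b (suc m) + s)) + n * conv (a ∘ suc) b (suc m)
      ≈⟨ +-congˡ (leibniz m (a ∘ suc) b) ⟩
    ((1# + n) * (a 0 * b (suc (suc m))) + (a 1 * b (suc m) + s)) + (p + r)
      ≈⟨ solve 8 (λ n a₀ a₁ b₁ b₂ s p r → ((con (+ 1) :+ n) :* (a₀ :* b₂) :+ (a₁ :* b₁ :+ s)) :+ (p :+ r) :=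
           (((con (+ 1) :+ con (+ 0)) :* a₁) :* b₁ :+ (s :+ p)) :+ (a₀ :* ((con (+ 1) :+ n) :* b₂) :+ r)) refl n (a 0) (a 1) (b (suc m)) (b (suc (suc m))) s p r ⟩
    (∂ a 0 * b (suc m) + (s + p)) + (a 0 * ∂ b (suc m) + r)
      ≈⟨ +-congʳ (+-congˡ (trans (conv-cong m ∂-shift (λ _ → refl)) (conv-+ˡ m (λ i → a (suc (suc i))) (∂ (a ∘ suc)) b))) ⟨
    (∂ a 0 * b (suc m) + conv (∂ a ∘ suc) b m) + (a 0 * ∂ b (suc m) + r) ∎
    where
    n = suc m · 1#
    s = conv (λ i → a (suc (suc i))) b m
    p = conv (∂ (a ∘ suc)) b m
    r = conv (a ∘ suc) (∂ b) m
    ∂-shift : ∀ i → ∂ a (suc i) ≈ a (suc (suc i)) + ∂ (a ∘ suc) i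
    ∂-shift i = solve 2 (λ n x → (con (+ 1) :+ n) :* x := x :+ n :* x) refl (suc i · 1#) (a (suc (suc i)))

  module _ (cancel : ∀ m {x y} → suc m · 1# * x ≈ suc m · 1# * y → x ≈ y)
    (e : Carrier → ℕ → Carrier) (e-0 : ∀ x → e x 0 ≈ 1#) (∂e≈xe : ∀ x m → ∂ (e x) m ≈ x * e x m) where

    -- Both sides solve the formal differential equation f′ = (x + y) f with f(0) = 1, by `leibniz`
    -- on the left. Cancellation of positive integers makes the solution unique, so no binomial
    -- theorem is required.
    conv-exp : ∀ x y m → conv (e x) (e y) m ≈ e (x + y) m
    conv-exp x y zero    = trans (trans (*-cong (e-0 x) (e-0 y)) (*-identityˡ 1#)) (sym (e-0 (x + y)))
    conv-exp x y (suc m) = cancel m (begin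
      suc m · 1# * conv (e x) (e y) (suc m)
        ≈⟨ leibniz m (e x) (e y) ⟩
      conv (∂ (e x)) (e y) m + conv (e x) (∂ (e y)) m
        ≈⟨ +-cong (conv-cong m (∂e≈xe x) (λ _ → refl)) (conv-cong m (λ _ → refl) (∂e≈xe y)) ⟩
      conv (λ i → x * e x i) (e y) m + conv (e x) (λ i → y * e y i) m
        ≈⟨ +-cong (conv-*ˡ m x (e x) (e y)) (conv-*ʳ m y (e x) (e y)) ⟩
      x * conv (e x) (e y) m + y * conv (e x) (e y) m
        ≈⟨ distribʳ _ _ _ ⟨
      (x + y) * conv (e x) (e y) m
        ≈⟨ *-congˡ (conv-exp x y m) ⟩
      (x + y) * e (x + y) m
        ≈⟨ ∂e≈xe (x + y) m ⟨
      suc m · 1# * e (x + y) (suc m) ∎)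

    diagonal-exp : ∀ x y n → diagonal (e x) (e y) n ≈ ∑ n (e (x + y))
    diagonal-exp x y n = trans (sym (∑-conv n (e x) (e y))) (∑-cong n (conv-exp x y))

-- Natural multiples in ℚ and the Archimedean property

module ℚ-Ring = CommutativeRing ℚ.+-*-commutativeRing
module G where
  open CommutativeRing (gaussian ℚ.+-*-commutativeRing) public
  open RingIdentities (gaussian ℚ.+-*-commutativeRing) public


module ℚ′ where
  open SemiringMult ℚ-Ring.semiring public using () renaming (_×_ to _·_; ×1-homo-* to ·1-homo-*; ×-homo-+ to ·-homo-+)
  open SemiringExp ℚ-Ring.semiring public using (_^_)
  open CommutativeSemiringExp ℚ-Ring.commutativeSemiring public using (^-distrib-*)
  open RingIdentities ℚ.+-*-commutativeRing public

-- As an unoptimised multiple, `ν (suc n)` unfolds to 1 + `ν n`, the form in which the inductions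
-- below use it.
ν : ℕ → ℚ
ν n = n ℚ′.· 1ℚ

0≤1 : 0ℚ ℚ.≤ 1ℚ
0≤1 = ℚ.nonNegative⁻¹ 1ℚ

0≤ν : ∀ n → 0ℚ ℚ.≤ ν n
0≤ν zero    = ℚ.≤-refl
0≤ν (suc n) = ℚ.+-mono-≤ 0≤1 (0≤ν n)

1≤ν : ∀ n → 1ℚ ℚ.≤ ν (suc n)
1≤ν n = ≡.subst (ℚ._≤ ν (suc n)) (ℚ.+-identityʳ 1ℚ) (ℚ.+-monoʳ-≤ 1ℚ (0≤ν n))

0<ν : ∀ n → 0ℚ ℚ.< ν (suc n)
0<ν n = ℚ.<-≤-trans (ℚ.positive⁻¹ 1ℚ) (1≤ν n)

ν-mono-≤ : ∀ {m n} → m ℕ.≤ n → ν m ℚ.≤ ν n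
ν-mono-≤ {n = n} ℕ.z≤n       = 0≤ν n
ν-mono-≤         (ℕ.s≤s m≤n) = ℚ.+-monoʳ-≤ 1ℚ (ν-mono-≤ m≤n)

toℚᵘ-ν : ∀ n → ℚ.toℚᵘ (ν n) ≃ᵘ mkℚᵘ (+ n) 0
toℚᵘ-ν zero    = ℚᵘ.≃-refl
toℚᵘ-ν (suc n) = ℚᵘ.≃-trans (ℚ.toℚᵘ-homo-+ 1ℚ (ν n))
  (ℚᵘ.≃-trans (ℚᵘ.+-cong (ℚᵘ.≃-refl {ℚᵘ.1ℚᵘ}) (toℚᵘ-ν n)) (*≡* (≡.cong (ℤ._* + 1) (≡.cong (λ i → + 1 ℤ.+ i) (ℤ.*-identityʳ (+ n))))))

ν*[n/d]≡ν : ∀ n d .{{_ : NonZero d}} → ν d ℚ.* (+ n ℚ./ d) ≡ ν n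
ν*[n/d]≡ν n (suc d) = ℚ.toℚᵘ-injective (ℚᵘ.≃-trans (ℚ.toℚᵘ-homo-* (ν (suc d)) (+ n ℚ./ suc d))
  (ℚᵘ.≃-trans (ℚᵘ.*-cong (toℚᵘ-ν (suc d)) (ℚ.toℚᵘ-fromℚᵘ (mkℚᵘ (+ n) d)))
  (ℚᵘ.≃-trans (*≡* eq) (ℚᵘ.≃-sym (toℚᵘ-ν n)))))
  where
  eq : (+ suc d ℤ.* + n) ℤ.* + 1 ≡ + n ℤ.* + (suc d ℕ.+ 0)
  eq = ≡.trans (ℤ.*-identityʳ _) (≡.trans (ℤ.*-comm (+ suc d) (+ n)) (≡.cong (λ m → + n ℤ.* + m) (≡.sym (ℕ.+-identityʳ (suc d)))))

archimedean : ∀ p → ∃[ N ] p ℚ.≤ ν N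
archimedean p@(ℚ.mkℚ i d _) = ℤ.∣ i ∣ , ℚ.toℚᵘ-cancel-≤ (ℚᵘ.≤-trans (*≤* le) (ℚᵘ.≤-reflexive (ℚᵘ.≃-sym (toℚᵘ-ν ℤ.∣ i ∣))))
  where
  open ℤ.≤-Reasoning
  i≤∣i∣ : ∀ i → i ℤ.≤ + ℤ.∣ i ∣
  i≤∣i∣ (+ n)    = ℤ.≤-refl
  i≤∣i∣ -[1+ n ] = ℤ.-≤+
  le : i ℤ.* + 1 ℤ.≤ + ℤ.∣ i ∣ ℤ.* + suc d
  le = begin
    i ℤ.* + 1                      ≡⟨ ℤ.*-identityʳ i ⟩
    i                              ≤⟨ i≤∣i∣ i ⟩
    + ℤ.∣ i ∣                      ≤⟨ ℤ.+≤+ (ℕ.m≤m*n ℤ.∣ i ∣ (suc d)) ⟩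
    + (ℤ.∣ i ∣ ℕ.* suc d)          ≡⟨ ℤ.pos-* ℤ.∣ i ∣ (suc d) ⟩
    + ℤ.∣ i ∣ ℤ.* + suc d          ∎

archimedean-* : ∀ κ {ε} → 0ℚ ℚ.< ε → ∃[ N ] κ ℚ.≤ ν N ℚ.* ε
archimedean-* κ {ε} 0<ε = let N , κ/ε≤N = archimedean (κ ℚ.* ε⁻¹) in
  N , ≡.subst (ℚ._≤ ν N ℚ.* ε)
        (≡.trans (ℚ.*-assoc κ ε⁻¹ ε) (≡.trans (≡.cong (κ ℚ.*_) (ℚ.*-inverseˡ ε)) (ℚ.*-identityʳ κ)))
        (ℚ.*-monoʳ-≤-nonNeg ε {{ℚ.pos⇒nonNeg ε}} κ/ε≤N)
  where
  instance
    _ : ℚ.Positive ε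
    _ = ℚ.positive 0<ε
    _ : ℚ.NonZero ε
    _ = ℚ.pos⇒nonZero ε
  ε⁻¹ : ℚ
  ε⁻¹ = ℚ.1/ ε


-- Roots of unity in rings with conjugation

record Conjugation {c ℓ} (K : CommutativeRing c ℓ) : Set (c ⊔ ℓ) where
  open CommutativeRing K
  field
    σ      : Carrier → Carrier
    σ-cong : ∀ {x y} → x ≈ y → σ x ≈ σ y
    σ-+    : ∀ x y → σ (x + y) ≈ σ x + σ y
    σ-*    : ∀ x y → σ (x * y) ≈ σ x * σ y
    σ-neg  : ∀ x → σ (- x) ≈ - σ x
    σ-1    : σ 1# ≈ 1#

  open SemiringExp semiring

  σ-^ : ∀ x n → σ (x ^ n) ≈ σ x ^ n
  σ-^ x zero    = σ-1
  σ-^ x (suc n) = trans (σ-* x (x ^ n)) (*-congˡ (σ-^ x n))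

  σ-^-1 : ∀ x n → σ (x ^ n - 1#) ≈ σ x ^ n - 1#
  σ-^-1 x n = trans (σ-+ (x ^ n) (- 1#)) (+-cong (σ-^ x n) (trans (σ-neg 1#) (-‿cong σ-1)))

  σ-overlap : ∀ {x ω i j s t} → OverlapEquation K x ω i j s t → OverlapEquation K (σ x) ω i j s t
  σ-overlap {x} {ω} {i} {j} {s} {t} eq = begin
    σ x ^ ω * ((σ x ^ j - 1#) * (σ x ^ s - 1#))
      ≈⟨ *-cong (σ-^ x ω) (trans (σ-* _ _) (*-cong (σ-^-1 x j) (σ-^-1 x s))) ⟨
    σ (x ^ ω) * σ ((x ^ j - 1#) * (x ^ s - 1#))
      ≈⟨ σ-* _ _ ⟨
    σ (x ^ ω * ((x ^ j - 1#) * (x ^ s - 1#)))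
      ≈⟨ σ-cong eq ⟩
    σ ((x ^ i - 1#) * (x ^ t - 1#))
      ≈⟨ trans (σ-* _ _) (*-cong (σ-^-1 x i) (σ-^-1 x t)) ⟩
    (σ x ^ i - 1#) * (σ x ^ t - 1#) ∎
    where open import Relation.Binary.Reasoning.Setoid setoid

IsReal HasUnitNorm : ∀ {c ℓ} {K : CommutativeRing c ℓ} → Conjugation K → CommutativeRing.Carrier K → Set ℓ
IsReal {K = K} C x = x ≈ σ x
  where open CommutativeRing K; open Conjugation C
HasUnitNorm {K = K} C x = x * σ x ≈ 1#
  where open CommutativeRing K; open Conjugation C

-- `x at-angle q` abstracts x = exp(iπq) for rational q, the angle being measured in half turns. The
-- argument on the order of φ sees the exponential through these four laws alone.
record Phase {c ℓ} {K : CommutativeRing c ℓ} (C : Conjugation K) : Set (c ⊔ lsuc ℓ) where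
  open CommutativeRing K
  open Conjugation C
  infix 4 _at-angle_
  field
    _at-angle_ : Carrier → ℚ → Set ℓ
    at-0       : 1# at-angle 0ℚ
    at-+       : ∀ {x y q r} → x at-angle q → y at-angle r → (x * y) at-angle (q ℚ.+ r)
    at-neg     : ∀ {x q} → x at-angle q → σ x at-angle (ℚ.- q)
    unique     : ∀ {x y q} → x at-angle q → y at-angle q → x ≈ y

  open SemiringExp semiring

  at-multiple : ∀ {x q} → x at-angle q → ∀ n → (x ^ n) at-angle (ν n ℚ.* q)
  at-multiple {x} {q} a zero    = ≡.subst (1# at-angle_) (≡.sym (ℚ.*-zeroˡ q)) at-0
  at-multiple {x} {q} a (suc n) = ≡.subst (x ^ suc n at-angle_)
    (≡.sym (≡.trans (ℚ.*-distribʳ-+ q 1ℚ (ν n)) (≡.cong (ℚ._+ ν n ℚ.* q) (ℚ.*-identityˡ q))))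
    (at-+ a (at-multiple a n))

  norm : ∀ {x q} → x at-angle q → x * σ x ≈ 1#
  norm {x} {q} a = unique (≡.subst (x * σ x at-angle_) (ℚ.+-inverseʳ q) (at-+ a (at-neg a))) at-0

HasPhase : ∀ {c ℓ} {K : CommutativeRing c ℓ} {C : Conjugation K} → Phase C → CommutativeRing.Carrier K → ℚ → Set ℓ
HasPhase phase = Phase._at-angle_ phase

-- The minimality of π: exp(iπq) is real exactly when sin(πq) = 0.
NoRealPhase : ∀ {c ℓ} {K : CommutativeRing c ℓ} {C : Conjugation K} → Phase C → Set (c ⊔ ℓ)
NoRealPhase {C = C} phase = ∀ q y → 0ℚ ℚ.< q → q ℚ.< 1ℚ → HasPhase phase y q → ¬ IsReal C y

module PrimitiveRoot {κ ℓ} {K : CommutativeRing κ ℓ} {C : Conjugation K} (phase : Phase C)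
  (k h : ℕ) {{_ : NonZero k}} (k≡1+2h : k ≡ suc (h ℕ.+ h))
  {w φ : CommutativeRing.Carrier K} {c : ℚ} (kc≡1 : ν k ℚ.* c ≡ 1ℚ)
  (cis-w : HasPhase phase w 1ℚ) (cis-φ : HasPhase phase φ (c ℚ.+ c)) (w-real : IsReal C w)
  (not-real : NoRealPhase phase) where
  open CommutativeRing K hiding (zero)
  open Conjugation C
  open Phase phase
  open SemiringExp semiring
  open Geometric K using (1^n≈1)
  open import Relation.Binary.Reasoning.Setoid setoid

  -- Both φ^k and w² have angle 2, and since w is real, w² = w · σ w = 1. The value of w itself is
  -- never computed.
  φ^k≈1 : φ ^ k ≈ 1#
  φ^k≈1 = trans
    (unique (≡.subst (φ ^ k at-angle_) (≡.trans (ℚ.*-distribˡ-+ (ν k) c c) (≡.cong₂ ℚ._+_ kc≡1 kc≡1)) (at-multiple cis-φ k))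
            (at-+ cis-w cis-w))
    (trans (*-congˡ w-real) (norm cis-w))

  -- exp(iπ) exp(2πi/k)⁻ʰ = exp(iπ/k)
  half-angle : (w * σ φ ^ h) at-angle c
  half-angle = ≡.subst (w * σ φ ^ h at-angle_) angle≡c (at-+ cis-w (at-multiple (at-neg cis-φ) h))
    where
    angle≡c : 1ℚ ℚ.+ ν h ℚ.* (ℚ.- (c ℚ.+ c)) ≡ c
    angle≡c = ≡.trans (≡.cong (ℚ._+ ν h ℚ.* (ℚ.- (c ℚ.+ c))) (≡.trans (≡.sym kc≡1) (≡.cong (ℚ._* c)
      (≡.trans (≡.cong ν k≡1+2h) (≡.cong (1ℚ ℚ.+_) (ℚ′.·-homo-+ 1ℚ h h)))))) (ℚ′.odd-cancel (ν h) c)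

  0<c : 0ℚ ℚ.< c
  0<c = ℚ.*-cancelˡ-<-nonNeg (ν k) {{ℚ.nonNegative (0≤ν k)}} (≡.subst₂ ℚ._<_ (≡.sym (ℚ.*-zeroʳ (ν k))) (≡.sym kc≡1) (ℚ.positive⁻¹ 1ℚ))

  ν-mono-< : ∀ {m n} → m ℕ.< n → ν m ℚ.< ν n
  ν-mono-< {m} {n} m<n = ℚ.<-≤-trans (≡.subst (ℚ._< 1ℚ ℚ.+ ν m) (ℚ.+-identityˡ (ν m)) (ℚ.+-monoˡ-< (ν m) (ℚ.positive⁻¹ 1ℚ))) (ν-mono-≤ m<n)

  -- For y of angle a/k, y² = φ^a. If that is 1, then y · σ y = 1 forces y = σ y, so y is real
  -- although its angle lies strictly between 0 and 1.
  φ^a≉1 : ∀ {a} → 0 ℕ.< a → a ℕ.< k → ¬ φ ^ a ≈ 1#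
  φ^a≉1 {a} 0<a a<k φ^a≈1 = not-real _ _ 0<ac ac<1 cis-y (begin
    y                  ≈⟨ *-identityʳ y ⟨
    y * 1#             ≈⟨ *-congˡ (norm cis-y) ⟨
    y * (y * σ y)      ≈⟨ *-assoc y y (σ y) ⟨
    (y * y) * σ y      ≈⟨ *-congʳ (trans y²≈φ^a φ^a≈1) ⟩
    1# * σ y           ≈⟨ *-identityˡ (σ y) ⟩
    σ y                ∎)
    where
    y : Carrier
    y = (w * σ φ ^ h) ^ a
    cis-y : y at-angle (ν a ℚ.* c)
    cis-y = at-multiple half-angle a
    y²≈φ^a : y * y ≈ φ ^ a
    y²≈φ^a = unique (≡.subst (y * y at-angle_) (≡.sym (ℚ.*-distribˡ-+ (ν a) c c)) (at-+ cis-y cis-y)) (at-multiple cis-φ a)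
    0<ac : 0ℚ ℚ.< ν a ℚ.* c
    0<ac = ≡.subst (ℚ._< ν a ℚ.* c) (ℚ.*-zeroˡ c) (ℚ.*-monoˡ-<-pos c {{ℚ.positive 0<c}} (ν-mono-< 0<a))
    ac<1 : ν a ℚ.* c ℚ.< 1ℚ
    ac<1 = ≡.subst (ν a ℚ.* c ℚ.<_) kc≡1 (ℚ.*-monoˡ-<-pos c {{ℚ.positive 0<c}} (ν-mono-< a<k))

  φ-order : ∀ n → φ ^ n ≈ 1# → k ∣ n
  φ-order n φ^n≈1 with n % k in n%k≡a
  ... | zero  = m%n≡0⇒n∣m n k n%k≡a
  ... | suc a = contradiction φ^[1+a]≈1 (φ^a≉1 (ℕ.s≤s ℕ.z≤n) (≡.subst (ℕ._< k) n%k≡a (m%n<n n k)))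
    where
    φ^[1+a]≈1 : φ ^ suc a ≈ 1#
    φ^[1+a]≈1 = begin
      φ ^ suc a                               ≈⟨ *-identityʳ _ ⟨
      φ ^ suc a * 1#                          ≈⟨ *-congˡ (trans (^-congˡ (n / k) φ^k≈1) (1^n≈1 (n / k))) ⟨
      φ ^ suc a * (φ ^ k) ^ (n / k)           ≈⟨ *-congˡ (^-assocʳ φ k (n / k)) ⟩
      φ ^ suc a * φ ^ (k ℕ.* (n / k))         ≈⟨ ^-homo-* φ (suc a) (k ℕ.* (n / k)) ⟨
      φ ^ (suc a ℕ.+ k ℕ.* (n / k))           ≡⟨ ≡.cong (φ ^_) (≡.cong₂ ℕ._+_ (≡.sym n%k≡a) (ℕ.*-comm k (n / k))) ⟩
      φ ^ (n % k ℕ.+ n / k ℕ.* k)             ≡⟨ ≡.cong (φ ^_) (m≡m%n+[m/n]*n n k) ⟨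
      φ ^ n                                   ≈⟨ φ^n≈1 ⟩
      1#                                      ∎

-- An overlap equation and its conjugate

module ConjugateOverlap {κ ℓ} (K : CommutativeRing κ ℓ) (domain : IsDomain K) where
  open CommutativeRing K hiding (zero)
  open Geometric K using (1^n≈1)
  open IntegerCoefficients K
  open Solver
  open SemiringExp semiring
  open import Algebra.Properties.CommutativeSemiring.Exp commutativeSemiring using (^-distrib-*)
  open import Algebra.Properties.Ring ring using (x∙y⁻¹≈ε⇒x≈y)
  open import Relation.Binary.Reasoning.Setoid setoid

  inverse-powers : ∀ {x y} → x * y ≈ 1# → ∀ n → x ^ n * y ^ n ≈ 1#
  inverse-powers {x} {y} xy≈1 n = trans (sym (^-distrib-* x y n)) (trans (^-congˡ n xy≈1) (1^n≈1 n))

  -- Multiplying the equation for the inverses by a b c d e and comparing it with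
  -- the original one gives (b-1)(c-1)(de - a²bc) = 0.
  product-relation : ∀ {a b c d e a′ b′ c′ d′ e′} →
    a * a′ ≈ 1# → b * b′ ≈ 1# → c * c′ ≈ 1# → d * d′ ≈ 1# → e * e′ ≈ 1# → ¬ b ≈ 1# → ¬ c ≈ 1# →
    a * ((b - 1#) * (c - 1#)) ≈ (d - 1#) * (e - 1#) →
    a′ * ((b′ - 1#) * (c′ - 1#)) ≈ (d′ - 1#) * (e′ - 1#) →
    d * e ≈ (a * a) * (b * c)
  product-relation {a} {b} {c} {d} {e} {a′} {b′} {c′} {d′} {e′} aa′ bb′ cc′ dd′ ee′ b≉1 c≉1 eq eq′ =
    x∙y⁻¹≈ε⇒x≈y _ _ (domain _ _ (trans (*-comm _ _) (domain _ _ (trans (*-comm _ _) (trans (*-assoc _ _ _) product≈0)) (c≉1 ∘ x∙y⁻¹≈ε⇒x≈y c 1#))) (b≉1 ∘ x∙y⁻¹≈ε⇒x≈y b 1#))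
    where
    eq″ : ((b - 1#) * (c - 1#)) * (d * e) ≈ (a * (b * c)) * ((d - 1#) * (e - 1#))
    eq″ = begin
      ((b - 1#) * (c - 1#)) * (d * e)
        ≈⟨ solve 4 (λ b c d e → ((b :- con (+ 1)) :* (c :- con (+ 1))) :* (d :* e) := (con (+ 1) :* ((con (+ 1) :- b) :* (con (+ 1) :- c))) :* (d :* e)) refl b c d e ⟩
      (1# * ((1# - b) * (1# - c))) * (d * e)
        ≈⟨ *-congʳ (*-cong aa′ (*-cong (+-congʳ bb′) (+-congʳ cc′))) ⟨
      ((a * a′) * ((b * b′ - b) * (c * c′ - c))) * (d * e)
        ≈⟨ solve 8 (λ a b c d e a′ b′ c′ → ((a :* a′) :* ((b :* b′ :- b) :* (c :* c′ :- c))) :* (d :* e) :=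
             ((a :* (b :* c)) :* (d :* e)) :* (a′ :* ((b′ :- con (+ 1)) :* (c′ :- con (+ 1))))) refl a b c d e a′ b′ c′ ⟩
      ((a * (b * c)) * (d * e)) * (a′ * ((b′ - 1#) * (c′ - 1#)))
        ≈⟨ *-congˡ eq′ ⟩
      ((a * (b * c)) * (d * e)) * ((d′ - 1#) * (e′ - 1#))
        ≈⟨ solve 5 (λ x d e d′ e′ → (x :* (d :* e)) :* ((d′ :- con (+ 1)) :* (e′ :- con (+ 1))) := x :* ((d :* d′ :- d) :* (e :* e′ :- e))) refl (a * (b * c)) d e d′ e′ ⟩
      (a * (b * c)) * ((d * d′ - d) * (e * e′ - e))
        ≈⟨ *-congˡ (*-cong (+-congʳ dd′) (+-congʳ ee′)) ⟩
      (a * (b * c)) * ((1# - d) * (1# - e))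
        ≈⟨ *-congˡ (solve 2 (λ d e → (con (+ 1) :- d) :* (con (+ 1) :- e) := (d :- con (+ 1)) :* (e :- con (+ 1))) refl d e) ⟩
      (a * (b * c)) * ((d - 1#) * (e - 1#)) ∎
    product≈0 : (d * e - (a * a) * (b * c)) * ((b - 1#) * (c - 1#)) ≈ 0#
    product≈0 = begin
      (d * e - (a * a) * (b * c)) * ((b - 1#) * (c - 1#))
        ≈⟨ solve 5 (λ a b c d e → (d :* e :- (a :* a) :* (b :* c)) :* ((b :- con (+ 1)) :* (c :- con (+ 1))) :=
             ((b :- con (+ 1)) :* (c :- con (+ 1))) :* (d :* e) :- (a :* (b :* c)) :* (a :* ((b :- con (+ 1)) :* (c :- con (+ 1))))) refl a b c d e ⟩
      ((b - 1#) * (c - 1#)) * (d * e) - (a * (b * c)) * (a * ((b - 1#) * (c - 1#)))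
        ≈⟨ +-cong eq″ (-‿cong (*-congˡ eq)) ⟩
      (a * (b * c)) * ((d - 1#) * (e - 1#)) - (a * (b * c)) * ((d - 1#) * (e - 1#))
        ≈⟨ -‿inverseʳ _ ⟩
      0# ∎

-- From congruences modulo k to triviality

odd⇒1+2h : ∀ k → ¬ 2 ∣ k → ∃[ h ] k ≡ suc (h ℕ.+ h)
odd⇒1+2h k 2∤k with k % 2 in k%2≡r | m%n<n k 2
... | 0           | _ = contradiction (m%n≡0⇒n∣m k 2 k%2≡r) 2∤k
... | 1           | _ = k / 2 , ≡.trans (m≡m%n+[m/n]*n k 2) (≡.cong₂ ℕ._+_ k%2≡r
  (≡.trans (ℕ.*-comm (k / 2) 2) (≡.cong (k / 2 ℕ.+_) (ℕ.+-identityʳ (k / 2)))))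
... | suc (suc _) | ℕ.s≤s (ℕ.s≤s ())

-- As k - 1 = h + h, divisibility of i + u (h + h) says i ≡ u (mod k).
divides-difference : ∀ {k h i u v} → k ≡ suc (h ℕ.+ h) → k ∣ i ℕ.+ u ℕ.* (h ℕ.+ h) → k ∣ v →
  ∀ {x} → x ≡ (+ i ℤ.- + u) ℤ.+ + v → + k ℤ.∣ x
divides-difference {k} {h} {i} {u} {v} k≡1+2h (divides a i+u2h≡ak) (divides b v≡bk) {x} x≡ = Signed.∣⇒∣ᵤ (Signed.divides (+ a ℤ.- + u ℤ.+ + b) (begin
  x                                                                             ≡⟨ x≡ ⟩
  (+ i ℤ.- + u) ℤ.+ + v                                                         ≡⟨ identity ℤ.+-*-commutativeRing (+ i) (+ u) (+ (h ℕ.+ h)) (+ v) ⟩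
  ((+ i ℤ.+ + u ℤ.* + (h ℕ.+ h)) ℤ.- + u ℤ.* (+ 1 ℤ.+ + (h ℕ.+ h))) ℤ.+ + v     ≡⟨ ≡.cong₂ ℤ._+_ (≡.cong₂ ℤ._-_ cast (≡.cong (λ l → + u ℤ.* + l) (≡.sym k≡1+2h))) (≡.trans (≡.cong +_ v≡bk) (ℤ.pos-* b k)) ⟩
  (+ a ℤ.* + k ℤ.- + u ℤ.* + k) ℤ.+ + b ℤ.* + k                                 ≡⟨ factor ℤ.+-*-commutativeRing (+ a) (+ u) (+ b) (+ k) ⟩
  (+ a ℤ.- + u ℤ.+ + b) ℤ.* + k                                                 ∎))
  where
  open ≡.≡-Reasoning
  cast : + i ℤ.+ + u ℤ.* + (h ℕ.+ h) ≡ + a ℤ.* + k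
  cast = ≡.trans (≡.cong (λ l → + i ℤ.+ l) (≡.sym (ℤ.pos-* u (h ℕ.+ h)))) (≡.trans (≡.cong +_ i+u2h≡ak) (ℤ.pos-* a k))
  module _ {c ℓ} (R : CommutativeRing c ℓ) where
    open CommutativeRing R
    open IntegerCoefficients R
    open Solver
    identity : ∀ i u g v → (i - u) + v ≈ ((i + u * g) - u * (1# + g)) + v
    identity = solve 4 (λ i u g v → (i :- u) :+ v := ((i :+ u :* g) :- u :* (con (+ 1) :+ g)) :+ v) refl
    factor : ∀ a u b k → (a * k - u * k) + b * k ≈ (a - u + b) * k
    factor = solve 4 (λ a u b k → (a :* k :- u :* k) :+ b :* k := (a :- u :+ b) :* k) refl

shift-difference : ∀ {c ℓ} (R : CommutativeRing c ℓ) → let open CommutativeRing R in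
  ∀ i j ω → i - j ≈ (i - (ω + j)) + ω
shift-difference R = solve 3 (λ i j ω → i :- j := (i :- (ω :+ j)) :+ ω) refl
  where open CommutativeRing R; open IntegerCoefficients R; open Solver

shift-sum : ∀ {c ℓ} (R : CommutativeRing c ℓ) → let open CommutativeRing R in
  ∀ i j s ω → i - - s ≈ (i - (ω + j)) + (ω + (j + s))
shift-sum R = solve 4 (λ i j s ω → i :- :- s := (i :- (ω :+ j)) :+ (ω :+ (j :+ s))) refl
  where open CommutativeRing R; open IntegerCoefficients R; open Solver

-- With i ≡ ω + j, the cases ω ≡ 0 and ω ≡ -(j + s) give i ≡ j and s ≡ -i; with i ≡ ω + s they give
-- s ≡ i and i ≡ -j.
combine-congruences : ∀ {k h ω i j s} → k ≡ suc (h ℕ.+ h) →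
  k ∣ i ℕ.+ (ω ℕ.+ j) ℕ.* (h ℕ.+ h) ⊎ k ∣ i ℕ.+ (ω ℕ.+ s) ℕ.* (h ℕ.+ h) → k ∣ ω ⊎ k ∣ ω ℕ.+ (j ℕ.+ s) →
  (+ k ℤ.∣ + i ℤ.- + j ⊎ + k ℤ.∣ + i ℤ.- (ℤ.- + j)) ⊎ (+ k ℤ.∣ + s ℤ.- + i ⊎ + k ℤ.∣ + s ℤ.- (ℤ.- + i))
combine-congruences {k} {h} {ω} {i} {j} {s} k≡1+2h (inj₁ i≡ω+j) (inj₁ ω≡0) = inj₁ (inj₁ (divides-difference {k} {h} {i} {ω ℕ.+ j} {ω} k≡1+2h i≡ω+j ω≡0 (shift-difference ℤ.+-*-commutativeRing (+ i) (+ j) (+ ω))))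
combine-congruences {k} {h} {ω} {i} {j} {s} k≡1+2h (inj₁ i≡ω+j) (inj₂ ω≡-[j+s]) = inj₂ (inj₂ (divides-difference {k} {h} {i} {ω ℕ.+ j} {ω ℕ.+ (j ℕ.+ s)} k≡1+2h i≡ω+j ω≡-[j+s]
    (≡.trans (swap (+ s) (+ i)) (shift-sum ℤ.+-*-commutativeRing (+ i) (+ j) (+ s) (+ ω)))))
    where
    swap : ∀ s i → s ℤ.- (ℤ.- i) ≡ i ℤ.- (ℤ.- s)
    swap s i = ≡.trans (≡.cong (λ l → s ℤ.+ l) (ℤ.neg-involutive i)) (≡.trans (ℤ.+-comm s i) (≡.cong (λ l → i ℤ.+ l) (≡.sym (ℤ.neg-involutive s))))
combine-congruences {k} {h} {ω} {i} {j} {s} k≡1+2h (inj₂ i≡ω+s) (inj₁ ω≡0) =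
  inj₂ (inj₁ (≡.subst (λ n → k ∣ n) (ℤ.∣i-j∣≡∣j-i∣ (+ i) (+ s))
    (divides-difference {k} {h} {i} {ω ℕ.+ s} {ω} k≡1+2h i≡ω+s ω≡0 (shift-difference ℤ.+-*-commutativeRing (+ i) (+ s) (+ ω)))))
combine-congruences {k} {h} {ω} {i} {j} {s} k≡1+2h (inj₂ i≡ω+s) (inj₂ ω≡-[j+s]) =
  inj₁ (inj₂ (divides-difference {k} {h} {i} {ω ℕ.+ s} {ω ℕ.+ (s ℕ.+ j)} k≡1+2h i≡ω+s
    (≡.subst (λ l → k ∣ ω ℕ.+ l) (ℕ.+-comm j s) ω≡-[j+s])
    (shift-sum ℤ.+-*-commutativeRing (+ i) (+ s) (+ j) (+ ω))))

module TrivialOverlap {κ ℓ} {K : CommutativeRing κ ℓ} (C : Conjugation K)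
  (domain : IsDomain K) (char0 : CharacteristicZero K)
  (φ : CommutativeRing.Carrier K) (k h : ℕ) {{_ : NonZero k}} (k≡1+2h : k ≡ suc (h ℕ.+ h)) (2∤k : ¬ 2 ∣ k)
  (φ^k≈1 : RootOfUnity K φ k) (φ-order : OrderMultipleOf K φ k) (φσφ≈1 : HasUnitNorm C φ) where
  open CommutativeRing K hiding (zero)
  open SemiringExp semiring
  open Conjugation C
  open OddOverlap K domain char0 φ k h k≡1+2h 2∤k φ^k≈1 φ-order
  open ConjugateOverlap K domain

  overlap-trivial : ∀ {ω i j s t} → ¬ k ∣ i → ¬ k ∣ j → ¬ k ∣ s → ¬ k ∣ t → OverlapEquation K φ ω i j s t →
    (+ k ℤ.∣ + i ℤ.- + j ⊎ + k ℤ.∣ + i ℤ.- (ℤ.- + j)) ⊎ (+ k ℤ.∣ + s ℤ.- + i ⊎ + k ℤ.∣ + s ℤ.- (ℤ.- + i))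
  overlap-trivial {ω} {i} {j} {s} {t} k∤i k∤j k∤s k∤t eq =
    combine-congruences {k} {h} {ω} {i} {j} {s} k≡1+2h (i≡ω+j∨ω+s {ω} {i} {j} {s} {t} k∤i k∤t eq product) (ω≡0∨-[j+s] {ω} {i} {j} {s} {t} k∤i k∤t eq product)
    where
    product : φ ^ i * φ ^ t ≈ (φ ^ ω * φ ^ ω) * (φ ^ j * φ ^ s)
    product = product-relation (inverse-powers φσφ≈1 ω) (inverse-powers φσφ≈1 j) (inverse-powers φσφ≈1 s)
      (inverse-powers φσφ≈1 i) (inverse-powers φσφ≈1 t) (k∤j ∘ φ-order j) (k∤s ∘ φ-order s)
      eq (σ-overlap {φ} {ω} {i} {j} {s} {t} eq)

module OverlapsOfRootOfUnity {κ ℓ} {K : CommutativeRing κ ℓ} {C : Conjugation K} (phase : Phase C)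
  (domain : IsDomain K) (char0 : CharacteristicZero K)
  (k : ℕ) {{_ : NonZero k}} (2∤k : ¬ 2 ∣ k) {w φ : CommutativeRing.Carrier K} {c : ℚ} (kc≡1 : ν k ℚ.* c ≡ 1ℚ)
  (cis-w : HasPhase phase w 1ℚ) (cis-φ : HasPhase phase φ (c ℚ.+ c)) (w-real : IsReal C w)
  (not-real : NoRealPhase phase) where

  private
    h : ℕ
    h = proj₁ (odd⇒1+2h k 2∤k)

  open PrimitiveRoot phase k h (proj₂ (odd⇒1+2h k 2∤k)) kc≡1 cis-w cis-φ w-real not-real
  open TrivialOverlap C domain char0 φ k h (proj₂ (odd⇒1+2h k 2∤k)) 2∤k φ^k≈1 φ-order (Phase.norm phase cis-φ) public

-- The ring of complex numbers

open import Defs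

*-mono-≤ : ∀ {p q r s} → 0ℚ ℚ.≤ p → p ℚ.≤ q → 0ℚ ℚ.≤ r → r ℚ.≤ s → p ℚ.* r ℚ.≤ q ℚ.* s
*-mono-≤ {p} {q} {r} {s} 0≤p p≤q 0≤r r≤s = ℚ.≤-trans
  (ℚ.*-monoʳ-≤-nonNeg r {{ℚ.nonNegative 0≤r}} p≤q)
  (ℚ.*-monoˡ-≤-nonNeg q {{ℚ.nonNegative (ℚ.≤-trans 0≤p p≤q)}} r≤s)

0≤p² : ∀ p → 0ℚ ℚ.≤ p ℚ.* p
0≤p² p with ℚ.≤-total 0ℚ p
... | inj₁ 0≤p = ≡.subst (ℚ._≤ p ℚ.* p) (ℚ.*-zeroˡ 0ℚ) (*-mono-≤ ℚ.≤-refl 0≤p ℚ.≤-refl 0≤p)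
... | inj₂ p≤0 = ≡.subst₂ ℚ._≤_ (ℚ.*-zeroˡ 0ℚ) -p*-p≡p*p
    (*-mono-≤ ℚ.≤-refl 0≤-p ℚ.≤-refl 0≤-p)
  where
  0≤-p = ℚ.neg-antimono-≤ p≤0
  open import Algebra.Properties.Ring ℚ-Ring.ring using (-‿involutive)
  -p*-p≡p*p : ℚ.- p ℚ.* ℚ.- p ≡ p ℚ.* p
  -p*-p≡p*p = ≡.trans (≡.sym (ℚ.neg-distribˡ-* p (ℚ.- p)))
    (≡.trans (≡.cong ℚ.-_ (≡.sym (ℚ.neg-distribʳ-* p p))) (-‿involutive (p ℚ.* p)))

infix 8 ‖_‖
-- The ℓ¹ norm replaces the modulus: it takes rational values and is still submultiplicative.
‖_‖ : G.Carrier → ℚ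
‖ a , b ‖ = ℚ.∣ a ∣ ℚ.+ ℚ.∣ b ∣

‖‖-cong : ∀ {x y} → x G.≈ y → ‖ x ‖ ≡ ‖ y ‖
‖‖-cong (p , q) = ≡.cong₂ (λ a b → ℚ.∣ a ∣ ℚ.+ ℚ.∣ b ∣) p q

0≤‖_‖ : ∀ x → 0ℚ ℚ.≤ ‖ x ‖
0≤‖ a , b ‖ = ℚ.+-mono-≤ (ℚ.0≤∣p∣ a) (ℚ.0≤∣p∣ b)

‖-x‖≡‖x‖ : ∀ x → ‖ G.- x ‖ ≡ ‖ x ‖
‖-x‖≡‖x‖ (a , b) = ≡.cong₂ ℚ._+_ (ℚ.∣-p∣≡∣p∣ a) (ℚ.∣-p∣≡∣p∣ b)

+-interchange : ∀ a b c d → (a ℚ.+ b) ℚ.+ (c ℚ.+ d) ≡ (a ℚ.+ c) ℚ.+ (b ℚ.+ d)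
+-interchange = interchange
  where open import Algebra.Properties.CommutativeSemigroup ℚ-Ring.+-commutativeSemigroup

‖x+y‖≤‖x‖+‖y‖ : ∀ x y → ‖ x G.+ y ‖ ℚ.≤ ‖ x ‖ ℚ.+ ‖ y ‖
‖x+y‖≤‖x‖+‖y‖ (a , b) (c , d) = ≡.subst (‖ (a , b) G.+ (c , d) ‖ ℚ.≤_)
  (+-interchange ℚ.∣ a ∣ ℚ.∣ c ∣ ℚ.∣ b ∣ ℚ.∣ d ∣) (ℚ.+-mono-≤ (ℚ.∣p+q∣≤∣p∣+∣q∣ a c) (ℚ.∣p+q∣≤∣p∣+∣q∣ b d))

‖x*y‖≤‖x‖*‖y‖ : ∀ x y → ‖ x G.* y ‖ ℚ.≤ ‖ x ‖ ℚ.* ‖ y ‖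
‖x*y‖≤‖x‖*‖y‖ (a , b) (c , d) = begin
  ℚ.∣ a ℚ.* c ℚ.- b ℚ.* d ∣ ℚ.+ ℚ.∣ a ℚ.* d ℚ.+ b ℚ.* c ∣
    ≤⟨ ℚ.+-mono-≤ (ℚ.∣p-q∣≤∣p∣+∣q∣ (a ℚ.* c) (b ℚ.* d)) (ℚ.∣p+q∣≤∣p∣+∣q∣ (a ℚ.* d) (b ℚ.* c)) ⟩
  (ℚ.∣ a ℚ.* c ∣ ℚ.+ ℚ.∣ b ℚ.* d ∣) ℚ.+ (ℚ.∣ a ℚ.* d ∣ ℚ.+ ℚ.∣ b ℚ.* c ∣)
    ≡⟨ ≡.cong₂ ℚ._+_ (≡.cong₂ ℚ._+_ (∣*∣ a c) (∣*∣ b d)) (≡.cong₂ ℚ._+_ (∣*∣ a d) (∣*∣ b c)) ⟩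
  (ℚ.∣ a ∣ ℚ.* ℚ.∣ c ∣ ℚ.+ ℚ.∣ b ∣ ℚ.* ℚ.∣ d ∣) ℚ.+ (ℚ.∣ a ∣ ℚ.* ℚ.∣ d ∣ ℚ.+ ℚ.∣ b ∣ ℚ.* ℚ.∣ c ∣)
    ≡⟨ expand-norm ℚ.+-*-commutativeRing ℚ.∣ a ∣ ℚ.∣ b ∣ ℚ.∣ c ∣ ℚ.∣ d ∣ ⟩
  (ℚ.∣ a ∣ ℚ.+ ℚ.∣ b ∣) ℚ.* (ℚ.∣ c ∣ ℚ.+ ℚ.∣ d ∣) ∎
  where
  open ℚ.≤-Reasoning
  ∣*∣ = ℚ.∣p*q∣≡∣p∣*∣q∣

‖x-y‖≡‖y-x‖ : ∀ x y → ‖ x G.- y ‖ ≡ ‖ y G.- x ‖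
‖x-y‖≡‖y-x‖ (a , b) (c , d) = ≡.cong₂ ℚ._+_ (∣p-q∣≡∣q-p∣ a c) (∣p-q∣≡∣q-p∣ b d)

‖x-z‖≤‖x-y‖+‖y-z‖ : ∀ x y z → ‖ x G.- z ‖ ℚ.≤ ‖ x G.- y ‖ ℚ.+ ‖ y G.- z ‖
‖x-z‖≤‖x-y‖+‖y-z‖ x y z = ≡.subst (ℚ._≤ ‖ x G.- y ‖ ℚ.+ ‖ y G.- z ‖)
  (‖‖-cong (G.difference-chain x y z))
  (‖x+y‖≤‖x‖+‖y‖ (x G.- y) (y G.- z))

halve : ∀ {ε} → 0ℚ ℚ.< ε → ∃[ δ ] 0ℚ ℚ.< δ × δ ℚ.+ δ ≡ ε
halve {ε} 0<ε with split-ε {1ℚ} {1ℚ} (ℚ.positive⁻¹ 1ℚ) (ℚ.positive⁻¹ 1ℚ) 0<ε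
... | δ , 0<δ , eq = δ , 0<δ , ≡.trans (≡.sym (≡.cong₂ ℚ._+_ (ℚ.*-identityˡ δ) (ℚ.*-identityˡ δ))) eq

-- Convergence of double sequences

Eventually : (ℕ → Set) → Set
Eventually P = ∃[ N ] (∀ {n} → N ℕ.≤ n → P n)

-- The threshold for m may depend on n. Below, n counts the terms of a series and m indexes the
-- rational approximations to a complex number.
Eventually² : (ℕ → ℕ → Set) → Set
Eventually² P = Eventually λ n → Eventually λ m → P n m

always : ∀ {P} → (∀ n → P n) → Eventually P
always p = 0 , λ {n} _ → p n

always² : ∀ {P} → (∀ n m → P n m) → Eventually² P
always² p = always λ n → always (p n)

map₁ : ∀ {P Q} → (∀ n → P n → Q n) → Eventually P → Eventually Q
map₁ f (N , p) = N , λ {n} N≤n → f n (p N≤n)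

zip₁ : ∀ {P Q R} → (∀ n → P n → Q n → R n) → Eventually P → Eventually Q → Eventually R
zip₁ f (M , p) (N , q) = M ℕ.⊔ N , λ {n} ≤n →
  f n (p (ℕ.m⊔n≤o⇒m≤o M N ≤n)) (q (ℕ.m⊔n≤o⇒n≤o M N ≤n))

map₂ : ∀ {P Q} → (∀ n m → P n m → Q n m) → Eventually² P → Eventually² Q
map₂ f = map₁ λ n → map₁ (f n)

zip₂ : ∀ {P Q R} → (∀ n m → P n m → Q n m → R n m) → Eventually² P → Eventually² Q → Eventually² R
zip₂ f = zip₁ λ n → zip₁ (f n)

-- Equality in ℂ is about sequences of Gaussian rationals, limits in ℂ about
-- sequences of such sequences; both are instances of _≋_.
DoubleSeq : Set
DoubleSeq = ℕ → ℕ → G.Carrier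

infix 4 _≋_
record _≋_ (u v : DoubleSeq) : Set where
  constructor mk≋
  field
    near : ∀ {ε} → 0ℚ ℚ.< ε → Eventually² λ n m → ‖ u n m G.- v n m ‖ ℚ.< ε

open _≋_

Bounded : DoubleSeq → Set
Bounded u = ∃[ B ] 0ℚ ℚ.< B × Eventually² λ n m → ‖ u n m ‖ ℚ.≤ B

‖x-x‖≡0 : ∀ {x y} → x G.≈ y → ‖ x G.- y ‖ ≡ 0ℚ
‖x-x‖≡0 {x} {y} x≈y = ‖‖-cong {x G.- y} {G.0#} (G.trans (G.+-congʳ {G.- y} x≈y) (G.-‿inverseʳ y))

≋-pointwise : ∀ {u v} → (∀ n m → u n m G.≈ v n m) → u ≋ v
≋-pointwise u≈v .near {ε} 0<ε = always² λ n m → ≡.subst (ℚ._< ε) (≡.sym (‖x-x‖≡0 (u≈v n m))) 0<ε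

≋-sym : ∀ {u v} → u ≋ v → v ≋ u
≋-sym {u} {v} e .near {ε} 0<ε = map₂ (λ n m → ≡.subst (ℚ._< ε) (‖x-y‖≡‖y-x‖ (u n m) (v n m))) (e .near 0<ε)

≋-trans : ∀ {u v w} → u ≋ v → v ≋ w → u ≋ w
≋-trans {u} {v} {w} e f .near 0<ε with halve 0<ε
... | δ , 0<δ , ≡.refl = zip₂ (λ n m p q → ℚ.≤-<-trans (‖x-z‖≤‖x-y‖+‖y-z‖ (u n m) (v n m) (w n m)) (ℚ.+-mono-< p q))
  (e .near 0<δ) (f .near 0<δ)

+-cong-≋ : ∀ {u u′ v v′} → u ≋ u′ → v ≋ v′ → (λ n m → u n m G.+ v n m) ≋ (λ n m → u′ n m G.+ v′ n m)
+-cong-≋ {u} {u′} {v} {v′} e f .near 0<ε with halve 0<ε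
... | δ , 0<δ , ≡.refl = zip₂
  (λ n m p q → ≡.subst (ℚ._< δ ℚ.+ δ)
    (‖‖-cong (G.difference-+ (u n m) (u′ n m) (v n m) (v′ n m)))
    (ℚ.≤-<-trans (‖x+y‖≤‖x‖+‖y‖ (u n m G.- u′ n m) (v n m G.- v′ n m)) (ℚ.+-mono-< p q)))
  (e .near 0<δ) (f .near 0<δ)

*-cong-≋ : ∀ {u u′ v v′} → Bounded u → Bounded v′ → u ≋ u′ → v ≋ v′ →
  (λ n m → u n m G.* v n m) ≋ (λ n m → u′ n m G.* v′ n m)
*-cong-≋ {u} {u′} {v} {v′} (A , 0<A , u≤A) (B , 0<B , v′≤B) e f .near {ε} 0<ε =
  let δ , 0<δ , eq = split-ε 0<A 0<B 0<ε in
  zip₂ (λ { n m (u≤A , p) (v′≤B , q) → ≡.subst (_ ℚ.<_) eq (estimate n m u≤A v′≤B p q) })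
    (zip₂ (λ _ _ → _,_) u≤A (e .near 0<δ)) (zip₂ (λ _ _ → _,_) v′≤B (f .near 0<δ))
  where
  open ℚ.≤-Reasoning
  estimate : ∀ n m {δ} → ‖ u n m ‖ ℚ.≤ A → ‖ v′ n m ‖ ℚ.≤ B → ‖ u n m G.- u′ n m ‖ ℚ.< δ → ‖ v n m G.- v′ n m ‖ ℚ.< δ →
    ‖ u n m G.* v n m G.- u′ n m G.* v′ n m ‖ ℚ.< A ℚ.* δ ℚ.+ B ℚ.* δ
  estimate n m {δ} a≤A d≤B p q = begin-strict
    ‖ a G.* c G.- b G.* d ‖
      ≡⟨ ‖‖-cong (G.difference-* a b c d) ⟩
    ‖ a G.* (c G.- d) G.+ d G.* (a G.- b) ‖
      ≤⟨ ‖x+y‖≤‖x‖+‖y‖ (a G.* (c G.- d)) (d G.* (a G.- b)) ⟩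
    ‖ a G.* (c G.- d) ‖ ℚ.+ ‖ d G.* (a G.- b) ‖
      ≤⟨ ℚ.+-mono-≤ (bound a (c G.- d) a≤A) (bound d (a G.- b) d≤B) ⟩
    A ℚ.* ‖ c G.- d ‖ ℚ.+ B ℚ.* ‖ a G.- b ‖
      <⟨ ℚ.+-mono-< (ℚ.*-monoʳ-<-pos A {{ℚ.positive 0<A}} q) (ℚ.*-monoʳ-<-pos B {{ℚ.positive 0<B}} p) ⟩
    A ℚ.* δ ℚ.+ B ℚ.* δ ∎
    where
    a = u n m
    b = u′ n m
    c = v n m
    d = v′ n m
    bound : ∀ x y {C} → ‖ x ‖ ℚ.≤ C → ‖ x G.* y ‖ ℚ.≤ C ℚ.* ‖ y ‖
    bound x y x≤C = ℚ.≤-trans (‖x*y‖≤‖x‖*‖y‖ x y) (*-mono-≤ 0≤‖ x ‖ x≤C 0≤‖ y ‖ ℚ.≤-refl)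

bounded-≋ : ∀ {u v} → u ≋ v → Bounded v → Bounded u
bounded-≋ {u} {v} e (B , 0<B , v≤B) = 1ℚ ℚ.+ B , ℚ.+-mono-< (ℚ.positive⁻¹ 1ℚ) 0<B , zip₂
  (λ n m p q → ℚ.≤-trans (≡.subst (ℚ._≤ ‖ u n m G.- v n m ‖ ℚ.+ ‖ v n m ‖)
      (‖‖-cong (G.difference-cancel (u n m) (v n m)))
      (‖x+y‖≤‖x‖+‖y‖ (u n m G.- v n m) (v n m)))
    (ℚ.+-mono-≤ (ℚ.<⇒≤ p) q)) (e .near (ℚ.positive⁻¹ 1ℚ)) v≤B

infix 9 _at_
_at_ : ℂ → ℕ → G.Carrier
z at m = seq (re z) m , seq (im z) m

const-seq : ℂ → DoubleSeq
const-seq z _ m = z at m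

bounded-const : ∀ z → Bounded (const-seq z)
bounded-const z =
  let A , 0<A , re≤A = cauchy-bounded {seq (re z)} (cauchy (re z))
      B , 0<B , im≤B = cauchy-bounded {seq (im z)} (cauchy (im z))
  in bound 0<A 0<B re≤A im≤B
  where
  bound : ∀ {A B} → 0ℚ ℚ.< A → 0ℚ ℚ.< B → Eventually (λ m → ℚ.∣ seq (re z) m ∣ ℚ.≤ A) →
    Eventually (λ m → ℚ.∣ seq (im z) m ∣ ℚ.≤ B) → Bounded (const-seq z)
  bound {A} {B} 0<A 0<B re≤A im≤B = A ℚ.+ B , ℚ.+-mono-< 0<A 0<B , always λ _ → zip₁ (λ _ → ℚ.+-mono-≤) re≤A im≤B

∣a∣≤‖a,b‖ : ∀ a b → ℚ.∣ a ∣ ℚ.≤ ‖ a , b ‖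
∣a∣≤‖a,b‖ a b = ≡.subst (ℚ._≤ ‖ a , b ‖) (ℚ.+-identityʳ _) (ℚ.+-monoʳ-≤ ℚ.∣ a ∣ (ℚ.0≤∣p∣ b))

∣b∣≤‖a,b‖ : ∀ a b → ℚ.∣ b ∣ ℚ.≤ ‖ a , b ‖
∣b∣≤‖a,b‖ a b = ≡.subst (ℚ._≤ ‖ a , b ‖) (ℚ.+-identityˡ _) (ℚ.+-monoˡ-≤ ℚ.∣ b ∣ (ℚ.0≤∣p∣ a))

≈⇒≋ : ∀ {z w} → z ≈ w → const-seq z ≋ const-seq w
≈⇒≋ (mk≈ᶜ (mk≈ᴿ p) (mk≈ᴿ q)) .near 0<ε with halve 0<ε
... | δ , 0<δ , ≡.refl = always λ _ → zip₁ (λ _ → ℚ.+-mono-<) (p 0<δ) (q 0<δ)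

≋⇒≈ : ∀ {z w} → const-seq z ≋ const-seq w → z ≈ w
≋⇒≈ {z} {w} e = mk≈ᶜ
  (mk≈ᴿ λ 0<ε → map₁ (λ m → ℚ.≤-<-trans (∣a∣≤‖a,b‖ (seq (re z) m ℚ.- seq (re w) m) (seq (im z) m ℚ.- seq (im w) m))) (tail 0<ε))
  (mk≈ᴿ λ 0<ε → map₁ (λ m → ℚ.≤-<-trans (∣b∣≤‖a,b‖ (seq (re z) m ℚ.- seq (re w) m) (seq (im z) m ℚ.- seq (im w) m))) (tail 0<ε))
  where
  tail : ∀ {ε} → 0ℚ ℚ.< ε → Eventually λ m → ‖ z at m G.- w at m ‖ ℚ.< ε
  tail 0<ε with e .near 0<ε
  ... | N , p = p {N} ℕ.≤-refl

pointwise : ∀ {z w} → (∀ m → z at m G.≈ w at m) → z ≈ w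
pointwise e = ≋⇒≈ (≋-pointwise λ _ → e)

-- The ring axioms hold term by term in the Gaussian rationals; only the equivalence and congruence
-- laws need estimates.
ℂ-commutativeRing : CommutativeRing 0ℓ 0ℓ
ℂ-commutativeRing = record
  { Carrier = ℂ
  ; _≈_ = _≈_
  ; _+_ = _+_
  ; _*_ = _*_
  ; -_  = -_
  ; 0#  = 0#
  ; 1#  = 1#
  ; isCommutativeRing = record
    { isRing = record
      { +-isAbelianGroup = record
        { isGroup = record
          { isMonoid = record
            { isSemigroup = record
              { isMagma = record
                { isEquivalence = record
                  { refl  = pointwise λ _ → G.refl
                  ; sym   = λ e → ≋⇒≈ (≋-sym (≈⇒≋ e))
                  ; trans = λ e f → ≋⇒≈ (≋-trans (≈⇒≋ e) (≈⇒≋ f))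
                  }
                ; ∙-cong = λ e f → ≋⇒≈ (+-cong-≋ (≈⇒≋ e) (≈⇒≋ f))
                }
              ; assoc = λ x y z → pointwise λ m → G.+-assoc (x at m) (y at m) (z at m)
              }
            ; identity = (λ x → pointwise λ m → G.+-identityˡ (x at m)) , (λ x → pointwise λ m → G.+-identityʳ (x at m))
            }
          ; inverse = (λ x → pointwise λ m → G.-‿inverseˡ (x at m)) , (λ x → pointwise λ m → G.-‿inverseʳ (x at m))
          ; ⁻¹-cong = λ {x} {y} e → ≋⇒≈ (mk≋ λ {ε} 0<ε → map₂ (λ _ m → ≡.subst (ℚ._< ε)
              (≡.trans (≡.sym (‖-x‖≡‖x‖ (x at m G.- y at m))) (‖‖-cong (G.difference-neg (x at m) (y at m)))))
              (≈⇒≋ e .near 0<ε))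
          }
        ; comm = λ x y → pointwise λ m → G.+-comm (x at m) (y at m)
        }
      ; *-cong = λ {x} {y} {u} {v} e f → ≋⇒≈ (*-cong-≋ (bounded-const x) (bounded-const v) (≈⇒≋ e) (≈⇒≋ f))
      ; *-assoc = λ x y z → pointwise λ m → G.*-assoc (x at m) (y at m) (z at m)
      ; *-identity = (λ x → pointwise λ m → G.*-identityˡ (x at m)) , (λ x → pointwise λ m → G.*-identityʳ (x at m))
      ; distrib = (λ x y z → pointwise λ m → G.distribˡ (x at m) (y at m) (z at m)) , (λ x y z → pointwise λ m → G.distribʳ (x at m) (y at m) (z at m))
      }
    ; *-comm = λ x y → pointwise λ m → G.*-comm (x at m) (y at m)
    }
  }
module C = CommutativeRing ℂ-commutativeRing

-- The exponential series

ν[1+m]/[1+m]! : ∀ m → ν (suc m) ℚ.* 1/ suc m ! ≡ 1/ m !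
ν[1+m]/[1+m]! m = begin
  ν (suc m) ℚ.* 1/ suc m !                              ≡⟨ ℚ.*-identityˡ _ ⟨
  1ℚ ℚ.* (ν (suc m) ℚ.* 1/ suc m !)                     ≡⟨ ≡.cong (ℚ._* (ν (suc m) ℚ.* 1/ suc m !)) (≡.trans (ℚ.*-comm (1/ m !) (ν (m !))) (factorial-inverse m)) ⟨
  (1/ m ! ℚ.* ν (m !)) ℚ.* (ν (suc m) ℚ.* 1/ suc m !)   ≡⟨ ℚ.*-assoc (1/ m !) (ν (m !)) _ ⟩
  1/ m ! ℚ.* (ν (m !) ℚ.* (ν (suc m) ℚ.* 1/ suc m !))   ≡⟨ ≡.cong (1/ m ! ℚ.*_) (ℚ.*-assoc (ν (m !)) (ν (suc m)) _) ⟨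
  1/ m ! ℚ.* ((ν (m !) ℚ.* ν (suc m)) ℚ.* 1/ suc m !)   ≡⟨ ≡.cong (λ q → 1/ m ! ℚ.* (q ℚ.* 1/ suc m !)) (≡.trans (≡.cong ν (ℕ.*-comm (suc m) (m !))) (ℚ′.·1-homo-* (m !) (suc m))) ⟨
  1/ m ! ℚ.* (ν (suc m !) ℚ.* 1/ suc m !)               ≡⟨ ≡.cong (1/ m ! ℚ.*_) (factorial-inverse (suc m)) ⟩
  1/ m ! ℚ.* 1ℚ                                         ≡⟨ ℚ.*-identityʳ _ ⟩
  1/ m !                                                ∎
  where
  open ≡.≡-Reasoning
  factorial-inverse : ∀ m → ν (m !) ℚ.* 1/ m ! ≡ 1ℚ
  factorial-inverse m = ≡.trans (ν*[n/d]≡ν 1 (m !) {{m ℕ.!≢0}}) (ℚ.+-identityʳ 1ℚ)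

0≤1/m! : ∀ m → 0ℚ ℚ.≤ 1/ m !
0≤1/m! m = ℚ.nonNegative⁻¹ _ {{ℚ.normalize-nonNeg 1 (m !) {{m ℕ.!≢0}}}}

0≤^ : ∀ {x} → 0ℚ ℚ.≤ x → ∀ n → 0ℚ ℚ.≤ x ℚ′.^ n
0≤^ 0≤x zero    = 0≤1
0≤^ {x} 0≤x (suc n) = ≡.subst (ℚ._≤ x ℚ.* x ℚ′.^ n) (ℚ.*-zeroʳ 0ℚ) (*-mono-≤ ℚ.≤-refl 0≤x ℚ.≤-refl (0≤^ 0≤x n))

0≤* : ∀ {p q} → 0ℚ ℚ.≤ p → 0ℚ ℚ.≤ q → 0ℚ ℚ.≤ p ℚ.* q
0≤* {p} {q} 0≤p 0≤q = ≡.subst (ℚ._≤ p ℚ.* q) (ℚ.*-zeroʳ 0ℚ) (*-mono-≤ ℚ.≤-refl 0≤p ℚ.≤-refl 0≤q)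

-- The ratio ¼ absorbs a factor n, as n ¼ⁿ = (n ½ⁿ) ½ⁿ.
¼ : ℚ
¼ = ½ ℚ.* ½

0≤¼ : 0ℚ ℚ.≤ ¼
0≤¼ = ℚ.nonNegative⁻¹ ¼

ν*½^≤1 : ∀ n → ν n ℚ.* ½ ℚ′.^ n ℚ.≤ 1ℚ
ν*½^≤1 zero    = 0≤1
ν*½^≤1 (suc n) = begin
  (1ℚ ℚ.+ ν n) ℚ.* (½ ℚ.* ½ ℚ′.^ n)                ≡⟨ ℚ′.successor-distrib (ν n) ½ (½ ℚ′.^ n) ⟩
  ½ ℚ.* (½ ℚ′.^ n ℚ.+ ν n ℚ.* ½ ℚ′.^ n)            ≤⟨ ℚ.*-monoˡ-≤-nonNeg ½ (ℚ.+-mono-≤ (½^≤1 n) (ν*½^≤1 n)) ⟩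
  ½ ℚ.* (1ℚ ℚ.+ 1ℚ)                                ≡⟨⟩
  1ℚ                                               ∎
  where
  open ℚ.≤-Reasoning
  ½^≤1 : ∀ n → ½ ℚ′.^ n ℚ.≤ 1ℚ
  ½^≤1 zero    = ℚ.≤-refl
  ½^≤1 (suc n) = *-mono-≤ (ℚ.nonNegative⁻¹ ½) (ℚ.≤ᵇ⇒≤ {½} {1ℚ} _) (0≤^ (ℚ.nonNegative⁻¹ ½) n) (½^≤1 n)

-- Past N, κ ≤ N δ ≤ n δ introduces a second factor n, and both are absorbed by (n ½ⁿ)² ≤ 1.
null-sequence : ∀ κ {ε} → 0ℚ ℚ.≤ κ → 0ℚ ℚ.< ε → Eventually λ n → ν n ℚ.* (κ ℚ.* ¼ ℚ′.^ n) ℚ.< ε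
null-sequence κ {ε} 0≤κ 0<ε =
  let δ , 0<δ , δ+δ≡ε = halve 0<ε
      N , κ≤Nδ = archimedean-* κ 0<δ
  in N , λ {n} N≤n → ℚ.≤-<-trans (bound 0<δ κ≤Nδ N≤n)
       (≡.subst₂ ℚ._<_ (ℚ.+-identityʳ δ) δ+δ≡ε (ℚ.+-monoʳ-< δ 0<δ))
  where
  open ℚ.≤-Reasoning
  bound : ∀ {δ N n} → 0ℚ ℚ.< δ → κ ℚ.≤ ν N ℚ.* δ → N ℕ.≤ n → ν n ℚ.* (κ ℚ.* ¼ ℚ′.^ n) ℚ.≤ δ
  bound {δ} {N} {n} 0<δ κ≤Nδ N≤n = begin
    ν n ℚ.* (κ ℚ.* ¼ ℚ′.^ n)
      ≤⟨ ℚ.*-monoˡ-≤-nonNeg (ν n) {{ℚ.nonNegative (0≤ν n)}} (ℚ.*-monoʳ-≤-nonNeg (¼ ℚ′.^ n) {{ℚ.nonNegative (0≤^ 0≤¼ n)}}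
           (ℚ.≤-trans κ≤Nδ (ℚ.*-monoʳ-≤-nonNeg δ {{ℚ.nonNegative (ℚ.<⇒≤ 0<δ)}} (ν-mono-≤ N≤n)))) ⟩
    ν n ℚ.* ((ν n ℚ.* δ) ℚ.* ¼ ℚ′.^ n)
      ≡⟨ ≡.cong (λ x → ν n ℚ.* ((ν n ℚ.* δ) ℚ.* x)) (ℚ′.^-distrib-* ½ ½ n) ⟩
    ν n ℚ.* ((ν n ℚ.* δ) ℚ.* (½ ℚ′.^ n ℚ.* ½ ℚ′.^ n))
      ≡⟨ ℚ′.square-distrib (ν n) δ (½ ℚ′.^ n) ⟩
    ((ν n ℚ.* ½ ℚ′.^ n) ℚ.* (ν n ℚ.* ½ ℚ′.^ n)) ℚ.* δ
      ≤⟨ ℚ.*-monoʳ-≤-nonNeg δ {{ℚ.nonNegative (ℚ.<⇒≤ 0<δ)}} (*-mono-≤ 0≤w (ν*½^≤1 n) 0≤w (ν*½^≤1 n)) ⟩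
    1ℚ ℚ.* δ
      ≡⟨ ℚ.*-identityˡ δ ⟩
    δ ∎
    where
    0≤w : 0ℚ ℚ.≤ ν n ℚ.* ½ ℚ′.^ n
    0≤w = 0≤* (0≤ν n) (0≤^ (ℚ.nonNegative⁻¹ ½) n)

module G^ where
  open SemiringExp G.semiring public using (_^_)
  open SemiringMult G.semiring public using () renaming (_×_ to _·_)
  open CauchyProduct (gaussian ℚ.+-*-commutativeRing) public

fromℝ : ℚ → G.Carrier
fromℝ q = q , 0ℚ

expTerm : G.Carrier → ℕ → G.Carrier
expTerm z m = fromℝ (1/ m !) G.* z G^.^ m

shift-bound : ∀ {γ} {b : ℕ → G.Carrier} → (∀ q → ‖ b q ‖ ℚ.≤ γ ℚ.* ¼ ℚ′.^ q) → ∀ q → ‖ b (suc q) ‖ ℚ.≤ (γ ℚ.* ¼) ℚ.* ¼ ℚ′.^ q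
shift-bound {γ} {b} b≤ q = ≡.subst (‖ b (suc q) ‖ ℚ.≤_) (≡.sym (ℚ.*-assoc γ ¼ (¼ ℚ′.^ q))) (b≤ (suc q))

-- A geometric tail. The constant 2 in place of the sharp 4/3 is closed under the induction, since 1
-- + 2 · ¼ ≤ 2.
tail-bound : ∀ {γ} b → 0ℚ ℚ.≤ γ → (∀ q → ‖ b q ‖ ℚ.≤ γ ℚ.* ¼ ℚ′.^ q) →
  ∀ M j → j ℕ.≤ M → ‖ G^.∑ M b G.- G^.∑ j b ‖ ℚ.≤ (γ ℚ.+ γ) ℚ.* ¼ ℚ′.^ j
tail-bound {γ} b 0≤γ b≤ zero zero _ = ≡.subst₂ ℚ._≤_ (≡.sym (‖x-x‖≡0 {G.0#} {G.0#} G.refl)) (≡.sym (ℚ.*-identityʳ (γ ℚ.+ γ))) (ℚ.+-mono-≤ 0≤γ 0≤γ)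
tail-bound {γ} b 0≤γ b≤ (suc M) zero _ = begin
  ‖ (b 0 G.+ S) G.- G.0# ‖                ≡⟨ ‖‖-cong {(b 0 G.+ S) G.- G.0#} {b 0 G.+ (S G.- G.0#)} (G.+-assoc (b 0) S (G.- G.0#)) ⟩
  ‖ b 0 G.+ (S G.- G.0#) ‖                ≤⟨ ‖x+y‖≤‖x‖+‖y‖ (b 0) (S G.- G.0#) ⟩
  ‖ b 0 ‖ ℚ.+ ‖ S G.- G.0# ‖              ≤⟨ ℚ.+-mono-≤ (b≤ 0) (tail-bound (b ∘ suc) (0≤* 0≤γ 0≤¼) (shift-bound {γ} {b} b≤) M 0 ℕ.z≤n) ⟩
  γ ℚ.* 1ℚ ℚ.+ (γ ℚ.* ¼ ℚ.+ γ ℚ.* ¼) ℚ.* 1ℚ  ≡⟨ ≡.cong₂ ℚ._+_ (ℚ.*-identityʳ γ) (≡.trans (ℚ.*-identityʳ _) (≡.sym (ℚ.*-distribˡ-+ γ ¼ ¼))) ⟩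
  γ ℚ.+ γ ℚ.* ½                           ≤⟨ ℚ.+-monoʳ-≤ γ (ℚ.*-monoˡ-≤-nonNeg γ {{ℚ.nonNegative 0≤γ}} (ℚ.≤ᵇ⇒≤ {½} {1ℚ} _)) ⟩
  γ ℚ.+ γ ℚ.* 1ℚ                          ≡⟨ ≡.cong (γ ℚ.+_) (ℚ.*-identityʳ γ) ⟩
  γ ℚ.+ γ                                 ≡⟨ ℚ.*-identityʳ (γ ℚ.+ γ) ⟨
  (γ ℚ.+ γ) ℚ.* 1ℚ                        ∎
  where
  open ℚ.≤-Reasoning
  S = G^.∑ M (b ∘ suc)
tail-bound {γ} b 0≤γ b≤ (suc M) (suc j) (ℕ.s≤s j≤M) = begin
  ‖ (b 0 G.+ S) G.- (b 0 G.+ T) ‖         ≡⟨ ‖‖-cong (G.difference-head (b 0) S T) ⟩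
  ‖ S G.- T ‖                             ≤⟨ tail-bound (b ∘ suc) (0≤* 0≤γ 0≤¼) (shift-bound {γ} {b} b≤) M j j≤M ⟩
  (γ ℚ.* ¼ ℚ.+ γ ℚ.* ¼) ℚ.* ¼ ℚ′.^ j      ≡⟨ ≡.cong (ℚ._* ¼ ℚ′.^ j) (ℚ.*-distribʳ-+ ¼ γ γ) ⟨
  ((γ ℚ.+ γ) ℚ.* ¼) ℚ.* ¼ ℚ′.^ j          ≡⟨ ℚ.*-assoc (γ ℚ.+ γ) ¼ (¼ ℚ′.^ j) ⟩
  (γ ℚ.+ γ) ℚ.* ¼ ℚ′.^ suc j              ∎
  where
  open ℚ.≤-Reasoning
  S = G^.∑ M (b ∘ suc)
  T = G^.∑ j (b ∘ suc)

-- The rectangle minus the triangle, row by row: row p lacks the tail of b from n - p on, which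
-- costs at most α ¼^p · β ¼^(n-p) = αβ ¼^n, and there are n rows. M stays fixed while the induction
-- lowers n.
product-bound : ∀ {α β} a b M → (∀ p → ‖ a p ‖ ℚ.≤ α ℚ.* ¼ ℚ′.^ p) → 0ℚ ℚ.≤ α →
  (∀ j → j ℕ.≤ M → ‖ G^.∑ M b G.- G^.∑ j b ‖ ℚ.≤ β ℚ.* ¼ ℚ′.^ j) →
  ∀ n → n ℕ.≤ M → ‖ G^.∑ n a G.* G^.∑ M b G.- G^.diagonal a b n ‖ ℚ.≤ ν n ℚ.* ((α ℚ.* β) ℚ.* ¼ ℚ′.^ n)
product-bound {α} {β} a b M a≤ 0≤α b≤ zero _ = ℚ.≤-reflexive (≡.trans
  (‖x-x‖≡0 {G.0# G.* G^.∑ M b} {G.0#} (G.zeroˡ (G^.∑ M b))) (≡.sym (ℚ.*-zeroˡ ((α ℚ.* β) ℚ.* 1ℚ))))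
product-bound {α} {β} a b M a≤ 0≤α b≤ (suc n) n<M = begin
  ‖ (a 0 G.+ S) G.* B G.- (a 0 G.* T G.+ D) ‖
    ≡⟨ ‖‖-cong (G.difference-product (a 0) S B T D) ⟩
  ‖ a 0 G.* (B G.- T) G.+ (S G.* B G.- D) ‖
    ≤⟨ ‖x+y‖≤‖x‖+‖y‖ (a 0 G.* (B G.- T)) (S G.* B G.- D) ⟩
  ‖ a 0 G.* (B G.- T) ‖ ℚ.+ ‖ S G.* B G.- D ‖
    ≤⟨ ℚ.+-mono-≤ (ℚ.≤-trans (‖x*y‖≤‖x‖*‖y‖ (a 0) (B G.- T)) (*-mono-≤ 0≤‖ a 0 ‖ (a≤ 0) 0≤‖ B G.- T ‖ (b≤ (suc n) n<M)))
         (product-bound (a ∘ suc) b M (shift-bound {α} {a} a≤) (0≤* 0≤α 0≤¼) b≤ n (ℕ.<⇒≤ n<M)) ⟩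
  (α ℚ.* 1ℚ) ℚ.* (β ℚ.* (¼ ℚ.* ¼ ℚ′.^ n)) ℚ.+ ν n ℚ.* (((α ℚ.* ¼) ℚ.* β) ℚ.* ¼ ℚ′.^ n)
    ≡⟨ ℚ′.successor-product (ν n) α β ¼ (¼ ℚ′.^ n) ⟩
  (1ℚ ℚ.+ ν n) ℚ.* ((α ℚ.* β) ℚ.* (¼ ℚ.* ¼ ℚ′.^ n)) ∎
  where
  open ℚ.≤-Reasoning
  S = G^.∑ n (a ∘ suc)
  B = G^.∑ M b
  T = G^.∑ (suc n) b
  D = G^.diagonal (a ∘ suc) b n

‖fromℝ‖ : ∀ {q} → 0ℚ ℚ.≤ q → ‖ fromℝ q ‖ ≡ q
‖fromℝ‖ 0≤q = ≡.trans (ℚ.+-identityʳ _) (ℚ.0≤p⇒∣p∣≡p 0≤q)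

‖^‖ : ∀ {z B} → 0ℚ ℚ.≤ B → ‖ z ‖ ℚ.≤ B → ∀ n → ‖ z G^.^ n ‖ ℚ.≤ B ℚ′.^ n
‖^‖ 0≤B z≤B zero    = ℚ.≤-refl
‖^‖ {z} 0≤B z≤B (suc n) = ℚ.≤-trans (‖x*y‖≤‖x‖*‖y‖ z (z G^.^ n)) (*-mono-≤ 0≤‖ z ‖ z≤B 0≤‖ z G^.^ n ‖ (‖^‖ 0≤B z≤B n))

-- μ^m / m! decreases once m ≥ μ.
power/factorial-bounded : ∀ μ → 0ℚ ℚ.≤ μ → ∃[ α ] 0ℚ ℚ.≤ α × (∀ m → 1/ m ! ℚ.* μ ℚ′.^ m ℚ.≤ α)
power/factorial-bounded μ 0≤μ =
  let N , μ≤N = archimedean μ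
      α , 0≤α , v≤α = initial N
  in α , 0≤α , all N μ≤N v≤α
  where
  v : ℕ → ℚ
  v m = 1/ m ! ℚ.* μ ℚ′.^ m
  0≤v : ∀ m → 0ℚ ℚ.≤ v m
  0≤v m = 0≤* (0≤1/m! m) (0≤^ 0≤μ m)
  initial : ∀ N → ∃[ α ] 0ℚ ℚ.≤ α × (∀ m → m ℕ.≤ N → v m ℚ.≤ α)
  initial zero    = v 0 , 0≤v 0 , λ { zero ℕ.z≤n → ℚ.≤-refl }
  initial (suc N) = let α , 0≤α , v≤α = initial N in
    α ℚ.+ v (suc N) , ℚ.+-mono-≤ 0≤α (0≤v (suc N)) , λ m m≤ → extend α 0≤α v≤α m (ℕ.m≤n⇒m<n∨m≡n m≤)
    where
    extend : ∀ α → 0ℚ ℚ.≤ α → (∀ m → m ℕ.≤ N → v m ℚ.≤ α) → ∀ m → m ℕ.< suc N ⊎ m ≡ suc N → v m ℚ.≤ α ℚ.+ v (suc N)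
    extend α 0≤α v≤α m (inj₁ (ℕ.s≤s m≤N)) = ≡.subst (ℚ._≤ α ℚ.+ v (suc N)) (ℚ.+-identityʳ (v m)) (ℚ.+-mono-≤ (v≤α m m≤N) (0≤v (suc N)))
    extend α 0≤α v≤α m (inj₂ ≡.refl)      = ≡.subst (ℚ._≤ α ℚ.+ v (suc N)) (ℚ.+-identityˡ (v m)) (ℚ.+-monoˡ-≤ (v m) 0≤α)
  decreasing : ∀ m → μ ℚ.≤ ν (suc m) → v (suc m) ℚ.≤ v m
  decreasing m μ≤ = ℚ.*-cancelˡ-≤-pos (ν (suc m)) {{ℚ.positive (0<ν m)}} (begin
    ν (suc m) ℚ.* (1/ suc m ! ℚ.* (μ ℚ.* μ ℚ′.^ m))    ≡⟨ ℚ.*-assoc (ν (suc m)) (1/ suc m !) _ ⟨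
    (ν (suc m) ℚ.* 1/ suc m !) ℚ.* (μ ℚ.* μ ℚ′.^ m)    ≡⟨ ≡.cong (ℚ._* (μ ℚ.* μ ℚ′.^ m)) (ν[1+m]/[1+m]! m) ⟩
    1/ m ! ℚ.* (μ ℚ.* μ ℚ′.^ m)                        ≡⟨ ℚ′.*-swap (1/ m !) μ (μ ℚ′.^ m) ⟩
    μ ℚ.* v m                                          ≤⟨ ℚ.*-monoʳ-≤-nonNeg (v m) {{ℚ.nonNegative (0≤v m)}} μ≤ ⟩
    ν (suc m) ℚ.* v m                                  ∎)
    where open ℚ.≤-Reasoning
  all : ∀ {α} N → μ ℚ.≤ ν N → (∀ m → m ℕ.≤ N → v m ℚ.≤ α) → ∀ m → v m ℚ.≤ α
  all N μ≤N v≤α zero = v≤α 0 ℕ.z≤n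
  all N μ≤N v≤α (suc m) with suc m ℕ.≤? N
  ... | yes m<N = v≤α (suc m) m<N
  ... | no  m≮N = ℚ.≤-trans (decreasing m (ℚ.≤-trans μ≤N (ν-mono-≤ (ℕ.<⇒≤ (ℕ.≰⇒> m≮N))))) (all N μ≤N v≤α m)

-- The bound is uniform on the ball of radius B because it will be applied to all rational
-- approximations of a number at once.
expTerm-bound : ∀ {B} → 0ℚ ℚ.≤ B → ∃[ α ] 0ℚ ℚ.≤ α × (∀ {z} → ‖ z ‖ ℚ.≤ B → ∀ m → ‖ expTerm z m ‖ ℚ.≤ α ℚ.* ¼ ℚ′.^ m)
expTerm-bound {B} 0≤B = let α , 0≤α , v≤α = power/factorial-bounded μ 0≤μ in α , 0≤α , λ {z} z≤B m → bound v≤α {z} z≤B m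
  where
  open ℚ.≤-Reasoning
  μ : ℚ
  -- With μ = 4B, B^m / m! = (μ^m / m!) ¼^m, whose first factor is bounded.
  μ = (B ℚ.+ B) ℚ.+ (B ℚ.+ B)
  0≤μ : 0ℚ ℚ.≤ μ
  0≤μ = ℚ.+-mono-≤ (ℚ.+-mono-≤ 0≤B 0≤B) (ℚ.+-mono-≤ 0≤B 0≤B)
  μ¼≡B : μ ℚ.* ¼ ≡ B
  μ¼≡B = ≡.trans (ℚ′.4-fold B ½) (ℚ.*-identityʳ B)
  bound : ∀ {α} → (∀ m → 1/ m ! ℚ.* μ ℚ′.^ m ℚ.≤ α) → ∀ {z} → ‖ z ‖ ℚ.≤ B → ∀ m → ‖ expTerm z m ‖ ℚ.≤ α ℚ.* ¼ ℚ′.^ m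
  bound {α} v≤α {z} z≤B m = begin
    ‖ fromℝ (1/ m !) G.* z G^.^ m ‖              ≤⟨ ‖x*y‖≤‖x‖*‖y‖ (fromℝ (1/ m !)) (z G^.^ m) ⟩
    ‖ fromℝ (1/ m !) ‖ ℚ.* ‖ z G^.^ m ‖          ≡⟨ ≡.cong (ℚ._* ‖ z G^.^ m ‖) (‖fromℝ‖ (0≤1/m! m)) ⟩
    1/ m ! ℚ.* ‖ z G^.^ m ‖                      ≤⟨ ℚ.*-monoˡ-≤-nonNeg (1/ m !) {{ℚ.nonNegative (0≤1/m! m)}} (‖^‖ {z} 0≤B z≤B m) ⟩
    1/ m ! ℚ.* B ℚ′.^ m                          ≡⟨ ≡.cong (λ b → 1/ m ! ℚ.* b ℚ′.^ m) μ¼≡B ⟨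
    1/ m ! ℚ.* (μ ℚ.* ¼) ℚ′.^ m                  ≡⟨ ≡.cong (1/ m ! ℚ.*_) (ℚ′.^-distrib-* μ ¼ m) ⟩
    1/ m ! ℚ.* (μ ℚ′.^ m ℚ.* ¼ ℚ′.^ m)           ≡⟨ ℚ.*-assoc (1/ m !) (μ ℚ′.^ m) (¼ ℚ′.^ m) ⟨
    (1/ m ! ℚ.* μ ℚ′.^ m) ℚ.* ¼ ℚ′.^ m           ≤⟨ ℚ.*-monoʳ-≤-nonNeg (¼ ℚ′.^ m) {{ℚ.nonNegative (0≤^ 0≤¼ m)}} (v≤α m) ⟩
    α ℚ.* ¼ ℚ′.^ m                               ∎

fromℝ-ν : ∀ m → suc m G^.· G.1# G.≈ fromℝ (ν (suc m))
fromℝ-ν m = go (suc m)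
  where
  go : ∀ n → n G^.· G.1# G.≈ fromℝ (ν n)
  go zero    = G.refl
  go (suc n) = G.+-congˡ {G.1#} (go n)

fromℝ-* : ∀ p q → fromℝ p G.* fromℝ q G.≈ fromℝ (p ℚ.* q)
fromℝ-* p q = ℚ′.fromReal-* p q

cancel-ν : ∀ m {x y} → suc m G^.· G.1# G.* x G.≈ suc m G^.· G.1# G.* y → x G.≈ y
cancel-ν m {x} {y} eq = begin
  x                                             ≈⟨ inverse x ⟨
  fromℝ r G.* (suc m G^.· G.1# G.* x)           ≈⟨ G.*-congˡ {fromℝ r} eq ⟩
  fromℝ r G.* (suc m G^.· G.1# G.* y)           ≈⟨ inverse y ⟩
  y                                             ∎
  where
  open import Relation.Binary.Reasoning.Setoid G.setoid
  r : ℚ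
  r = + 1 ℚ./ suc m
  unit : fromℝ r G.* suc m G^.· G.1# G.≈ G.1#
  unit = G.trans (G.*-congˡ {fromℝ r} (fromℝ-ν m)) (G.trans (fromℝ-* r (ν (suc m)))
    (≡.trans (ℚ.*-comm r (ν (suc m))) (≡.trans (ν*[n/d]≡ν 1 (suc m)) (ℚ.+-identityʳ 1ℚ)) , ≡.refl))
  inverse : ∀ x → fromℝ r G.* (suc m G^.· G.1# G.* x) G.≈ x
  inverse x = G.trans (G.sym (G.*-assoc (fromℝ r) (suc m G^.· G.1#) x)) (G.trans (G.*-congʳ {x} unit) (G.*-identityˡ x))

expTerm-0 : ∀ z → expTerm z 0 G.≈ G.1#
expTerm-0 z = G.refl

∂expTerm : ∀ z m → G^.∂ (expTerm z) m G.≈ z G.* expTerm z m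
∂expTerm z m = begin
  suc m G^.· G.1# G.* (fromℝ (1/ suc m !) G.* (z G.* z G^.^ m))
    ≈⟨ G.*-assoc (suc m G^.· G.1#) (fromℝ (1/ suc m !)) (z G.* z G^.^ m) ⟨
  (suc m G^.· G.1# G.* fromℝ (1/ suc m !)) G.* (z G.* z G^.^ m)
    ≈⟨ G.*-congʳ {z G.* z G^.^ m} (G.trans (G.*-congʳ {fromℝ (1/ suc m !)} (fromℝ-ν m)) (G.trans (fromℝ-* (ν (suc m)) (1/ suc m !)) (ν[1+m]/[1+m]! m , ≡.refl))) ⟩
  fromℝ (1/ m !) G.* (z G.* z G^.^ m)
    ≈⟨ G.*-swap (fromℝ (1/ m !)) z (z G^.^ m) ⟩
  z G.* expTerm z m ∎
  where open import Relation.Binary.Reasoning.Setoid G.setoid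

expPartial : G.Carrier → ℕ → G.Carrier
expPartial z n = G^.∑ n (expTerm z)

-- The sum over the triangle is exactly the partial sum at x + y, by `diagonal-exp`; the rest is
-- `product-bound` with β = 2α from `tail-bound`.
expPartial-bound : ∀ {B} → 0ℚ ℚ.≤ B → ∃[ κ ] 0ℚ ℚ.≤ κ × (∀ {x y} → ‖ x ‖ ℚ.≤ B → ‖ y ‖ ℚ.≤ B → ∀ n →
  ‖ expPartial x n G.* expPartial y n G.- expPartial (x G.+ y) n ‖ ℚ.≤ ν n ℚ.* (κ ℚ.* ¼ ℚ′.^ n))
expPartial-bound 0≤B = let α , 0≤α , e≤ = expTerm-bound 0≤B in
  α ℚ.* (α ℚ.+ α) , 0≤* 0≤α (ℚ.+-mono-≤ 0≤α 0≤α) , λ {x} {y} x≤B y≤B n →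
  ≡.subst (ℚ._≤ ν n ℚ.* ((α ℚ.* (α ℚ.+ α)) ℚ.* ¼ ℚ′.^ n))
    (‖‖-cong (G.+-congˡ {expPartial x n G.* expPartial y n} (G.-‿cong (G^.diagonal-exp cancel-ν expTerm expTerm-0 ∂expTerm x y n))))
    (product-bound (expTerm x) (expTerm y) n (e≤ {x} x≤B) 0≤α (tail-bound (expTerm y) 0≤α (e≤ {y} y≤B) n) n ℕ.≤-refl)

at-^ : ∀ z n m → (z ^ n) at m ≡ (z at m) G^.^ n
at-^ z zero    m = ≡.refl
at-^ z (suc n) m = ≡.cong (z at m G.*_) (at-^ z n m)

at-sum : ∀ n (f : ℕ → ℂ) m → sum {n} (λ i → f (toℕ i)) at m ≡ G^.∑ n (λ i → f i at m)
at-sum zero    f m = ≡.refl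
at-sum (suc n) f m = ≡.cong (f 0 at m G.+_) (at-sum n (f ∘ suc) m)

∑-≡ : ∀ n {f g : ℕ → G.Carrier} → (∀ i → f i ≡ g i) → G^.∑ n f ≡ G^.∑ n g
∑-≡ zero    e = ≡.refl
∑-≡ (suc n) e = ≡.cong₂ G._+_ (e 0) (∑-≡ n (e ∘ suc))

at-expSum : ∀ z n m → expSum z n at m ≡ expPartial (z at m) n
at-expSum z n m = ≡.trans (at-sum n (λ i → (fromℚ (1/ i !) +i 0ᴿ) * z ^ i) m) (∑-≡ n λ i → ≡.cong (fromℝ (1/ i !) G.*_) (at-^ z i m))

expSeq : ℂ → DoubleSeq
expSeq z n m = expPartial (z at m) n

⟶⇒≋ : ∀ {u l} → u ⟶ l → (λ n → u n at_) ≋ const-seq l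
⟶⇒≋ {u} {l} (lim-re , lim-im) .near {ε} 0<ε = let δ , 0<δ , δ+δ≡ε = halve 0<ε in
  zip₁ (λ n → λ { (mk<ᴿ g 0<g re<δ) (mk<ᴿ g′ 0<g′ im<δ) → zip₁ (λ m → distance n m δ+δ≡ε 0<g 0<g′) re<δ im<δ })
    (lim-re 0<δ) (lim-im 0<δ)
  where
  drop-gap : ∀ {g p q} → 0ℚ ℚ.< g → p ℚ.+ g ℚ.≤ q → p ℚ.< q
  drop-gap {g} {p} 0<g p+g≤q = ℚ.<-≤-trans (≡.subst (ℚ._< p ℚ.+ g) (ℚ.+-identityʳ p) (ℚ.+-monoʳ-< p 0<g)) p+g≤q
  distance : ∀ n m {δ g g′} → δ ℚ.+ δ ≡ ε → 0ℚ ℚ.< g → 0ℚ ℚ.< g′ →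
    ℚ.∣ proj₁ (u n at m G.- l at m) ∣ ℚ.+ g ℚ.≤ δ → ℚ.∣ proj₂ (u n at m G.- l at m) ∣ ℚ.+ g′ ℚ.≤ δ →
    ‖ u n at m G.- l at m ‖ ℚ.< ε
  distance n m {δ} δ+δ≡ε 0<g 0<g′ p q = ≡.subst (‖ u n at m G.- l at m ‖ ℚ.<_) δ+δ≡ε
    (ℚ.+-mono-< {ℚ.∣ proj₁ (u n at m G.- l at m) ∣} {δ} {ℚ.∣ proj₂ (u n at m G.- l at m) ∣} {δ} (drop-gap 0<g p) (drop-gap 0<g′ q))

≋⇒⟶ : ∀ {u l} → (λ n → u n at_) ≋ const-seq l → u ⟶ l
≋⇒⟶ {u} {l} e = lim-re , lim-im
  where
  bound : ∀ {p q δ ε} → δ ℚ.+ δ ≡ ε → p ℚ.≤ q → q ℚ.< δ → p ℚ.+ δ ℚ.≤ ε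
  bound {δ = δ} ≡.refl p≤q q<δ = ℚ.+-monoˡ-≤ δ (ℚ.≤-trans p≤q (ℚ.<⇒≤ q<δ))
  lim-re : (re ∘ u) ⟶ᴿ re l
  lim-re 0<ε = let δ , 0<δ , δ+δ≡ε = halve 0<ε in
    map₁ (λ n ev → mk<ᴿ δ 0<δ (map₁ (λ m → bound δ+δ≡ε (∣a∣≤‖a,b‖ (proj₁ (u n at m G.- l at m)) (proj₂ (u n at m G.- l at m)))) ev)) (e .near 0<δ)
  lim-im : (im ∘ u) ⟶ᴿ im l
  lim-im 0<ε = let δ , 0<δ , δ+δ≡ε = halve 0<ε in
    map₁ (λ n ev → mk<ᴿ δ 0<δ (map₁ (λ m → bound δ+δ≡ε (∣b∣≤‖a,b‖ (proj₁ (u n at m G.- l at m)) (proj₂ (u n at m G.- l at m)))) ev)) (e .near 0<δ)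

expSum-≋ : ∀ z → (λ n → expSum z n at_) ≋ expSeq z
expSum-≋ z = ≋-pointwise λ n m → G.reflexive (at-expSum z n m)

exp⇒≋ : ∀ {z w} → IsExp z w → expSeq z ≋ const-seq w
exp⇒≋ {z} {w} lim = ≋-trans (≋-sym (expSum-≋ z)) (⟶⇒≋ {expSum z} {w} lim)

≋⇒exp : ∀ {z w} → expSeq z ≋ const-seq w → IsExp z w
≋⇒exp {z} {w} e = ≋⇒⟶ {expSum z} {w} (≋-trans (expSum-≋ z) e)

-- The exponential on bounded sequences of Gaussian rationals

GaussianSeq : Set
GaussianSeq = ℕ → G.Carrier

infix 4 _≍_
_≍_ : GaussianSeq → GaussianSeq → Set
x ≍ y = (λ _ → x) ≋ (λ _ → y)

-- The relation exp x = y on bare sequences, so that arithmetic of angles requires bounds but no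
-- Cauchy proofs.
ExpLimit : GaussianSeq → GaussianSeq → Set
ExpLimit x y = (λ n m → expPartial (x m) n) ≋ (λ _ → y)

BoundedSeq : GaussianSeq → Set
BoundedSeq x = Bounded (λ _ → x)

bounded-* : ∀ {x y} → BoundedSeq x → BoundedSeq y → BoundedSeq (λ m → x m G.* y m)
bounded-* {x} {y} (A , 0<A , x≤A) (B , 0<B , y≤B) = A ℚ.* B , 0<AB ,
  zip₂ (λ _ m p q → ℚ.≤-trans (‖x*y‖≤‖x‖*‖y‖ (x m) (y m)) (*-mono-≤ 0≤‖ x m ‖ p 0≤‖ y m ‖ q)) x≤A y≤B
  where
  0<AB : 0ℚ ℚ.< A ℚ.* B
  0<AB = ≡.subst (ℚ._< A ℚ.* B) (ℚ.*-zeroʳ A) (ℚ.*-monoʳ-<-pos A {{ℚ.positive 0<A}} 0<B)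

conj : G.Carrier → G.Carrier
conj (a , b) = a , ℚ.- b

‖conj‖ : ∀ x → ‖ conj x ‖ ≡ ‖ x ‖
‖conj‖ (a , b) = ≡.cong (ℚ.∣ a ∣ ℚ.+_) (ℚ.∣-p∣≡∣p∣ b)

conj-+ : ∀ x y → conj (x G.+ y) ≡ conj x G.+ conj y
conj-+ (a , b) (c , d) = ≡.cong (a ℚ.+ c ,_) (ℚ.neg-distrib-+ b d)

conj-neg : ∀ x → conj (G.- x) ≡ G.- conj x
conj-neg x = ≡.refl

conj-* : ∀ x y → conj (x G.* y) ≡ conj x G.* conj y
conj-* (a , b) (c , d) = let p , q = gaussian-conj-* ℚ.+-*-commutativeRing a b c d in ≡.cong₂ _,_ p q

conj-^ : ∀ x n → conj (x G^.^ n) ≡ conj x G^.^ n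
conj-^ x zero    = ≡.refl
conj-^ x (suc n) = ≡.trans (conj-* x (x G^.^ n)) (≡.cong (conj x G.*_) (conj-^ x n))

conj-∑ : ∀ n f → conj (G^.∑ n f) ≡ G^.∑ n (conj ∘ f)
conj-∑ zero    f = ≡.refl
conj-∑ (suc n) f = ≡.trans (conj-+ (f 0) (G^.∑ n (f ∘ suc))) (≡.cong (conj (f 0) G.+_) (conj-∑ n (f ∘ suc)))

conj-expPartial : ∀ x n → conj (expPartial x n) ≡ expPartial (conj x) n
conj-expPartial x n = ≡.trans (conj-∑ n (expTerm x)) (∑-≡ n λ m →
  ≡.trans (conj-* (fromℝ (1/ m !)) (x G^.^ m)) (≡.cong (fromℝ (1/ m !) G.*_) (conj-^ x m)))

conj-≋ : ∀ {u v} → u ≋ v → (λ n m → conj (u n m)) ≋ (λ n m → conj (v n m))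
conj-≋ {u} {v} e .near {ε} 0<ε = map₂ (λ n m → ≡.subst (ℚ._< ε) (≡.trans (≡.sym (‖conj‖ (u n m G.- v n m))) (≡.cong ‖_‖ (conj-+ (u n m) (G.- v n m))))) (e .near 0<ε)

bounded-conj : ∀ {x} → BoundedSeq x → BoundedSeq (conj ∘ x)
bounded-conj {x} (B , 0<B , x≤B) = B , 0<B , map₂ (λ _ m → ≡.subst (ℚ._≤ B) (≡.sym (‖conj‖ (x m)))) x≤B

expLimit-conj : ∀ {x y} → ExpLimit x y → ExpLimit (conj ∘ x) (conj ∘ y)
expLimit-conj {x} {y} e = ≋-trans
  (≋-pointwise {λ n m → expPartial (conj (x m)) n} {λ n m → conj (expPartial (x m) n)} λ n m → G.reflexive (≡.sym (conj-expPartial (x m) n)))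
  (conj-≋ {λ n m → expPartial (x m) n} {λ _ → y} e)

expLimit-cong : ∀ {x x′ y} → (∀ m → x m ≡ x′ m) → ExpLimit x y → ExpLimit x′ y
expLimit-cong {x} {x′} e lim = ≋-trans
  (≋-pointwise {λ n m → expPartial (x′ m) n} {λ n m → expPartial (x m) n} λ n m → G.reflexive (≡.cong (λ z → expPartial z n) (≡.sym (e m)))) lim

-- The product of the partial sums tends to y y′. On a ball containing both sequences it differs
-- from the partial sum at x + x′ by a null sequence, uniformly in m.
expLimit-+ : ∀ {x x′ y y′} → BoundedSeq x → BoundedSeq x′ → BoundedSeq y → BoundedSeq y′ →
  ExpLimit x y → ExpLimit x′ y′ → ExpLimit (λ m → x m G.+ x′ m) (λ m → y m G.* y′ m)
expLimit-+ {x} {x′} {y} {y′} bx bx′ by by′ e e′ = ≋-trans (≋-sym product)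
  (*-cong-≋ {λ n m → expPartial (x m) n} {λ _ → y} {λ n m → expPartial (x′ m) n} {λ _ → y′} (bounded-≋ e by) by′ e e′)
  where
  weakenʳ : ∀ {p B B′} → 0ℚ ℚ.< B′ → p ℚ.≤ B → p ℚ.≤ B ℚ.+ B′
  weakenʳ {p} 0<B′ p≤B = ≡.subst (ℚ._≤ _) (ℚ.+-identityʳ p) (ℚ.+-mono-≤ p≤B (ℚ.<⇒≤ 0<B′))
  weakenˡ : ∀ {p B B′} → 0ℚ ℚ.< B → p ℚ.≤ B′ → p ℚ.≤ B ℚ.+ B′
  weakenˡ {p} 0<B p≤B′ = ≡.subst (ℚ._≤ _) (ℚ.+-identityˡ p) (ℚ.+-mono-≤ (ℚ.<⇒≤ 0<B) p≤B′)
  product : (λ n m → expPartial (x m) n G.* expPartial (x′ m) n) ≋ (λ n m → expPartial (x m G.+ x′ m) n)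
  product .near {ε} 0<ε =
    let B , 0<B , N , x≤B = bx
        B′ , 0<B′ , N′ , x′≤B′ = bx′
        κ , 0≤κ , bound = expPartial-bound {B ℚ.+ B′} (ℚ.+-mono-≤ (ℚ.<⇒≤ 0<B) (ℚ.<⇒≤ 0<B′))
    in map₁ (λ n small → zip₁ (λ m p q → ℚ.≤-<-trans (bound {x m} {x′ m} (weakenʳ 0<B′ p) (weakenˡ 0<B q) n) small)
                           (x≤B {N} ℕ.≤-refl) (x′≤B′ {N′} ℕ.≤-refl))
         (null-sequence κ 0≤κ 0<ε)

expLimit-0 : ExpLimit (λ _ → G.0#) (λ _ → G.1#)
-- The threshold is 1 because the empty sum at n = 0 is 0 rather than 1.
expLimit-0 .near {ε} 0<ε = 1 , λ { {suc n} _ → always λ m → ≡.subst (ℚ._< ε) (≡.sym (‖x-x‖≡0 {expPartial G.0# (suc n)} {G.1#} (constant n))) 0<ε }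
  where
  vanishing : ∀ n → G^.∑ n (λ i → expTerm G.0# (suc i)) G.≈ G.0#
  vanishing n = G.trans (G^.∑-cong n (λ i → G.trans (G.*-congˡ {fromℝ (1/ suc i !)} (G.zeroˡ (G.0# G^.^ i))) (G.zeroʳ (fromℝ (1/ suc i !))))) (zeros n)
    where
    zeros : ∀ n → G^.∑ n (λ _ → G.0#) G.≈ G.0#
    zeros zero    = G.refl
    zeros (suc n) = G.trans (G.+-identityˡ (G^.∑ n (λ _ → G.0#))) (zeros n)
  constant : ∀ n → expPartial G.0# (suc n) G.≈ G.1#
  constant n = G.trans (G.+-congˡ {G.1#} (vanishing n)) (G.+-identityʳ G.1#)

module Rotation (p : ℕ → ℚ) (p-bounded : ∃[ B ] 0ℚ ℚ.< B × Eventually (λ m → ℚ.∣ p m ∣ ℚ.≤ B)) where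

  angle : ℚ → GaussianSeq
  angle q m = 0ℚ , q ℚ.* p m

  angle-bounded : ∀ q → BoundedSeq (angle q)
  angle-bounded q =
    let B , 0<B , p≤B = p-bounded
    in (1ℚ ℚ.+ ℚ.∣ q ∣) ℚ.* B , 0<bound 0<B , always λ _ → map₁ (λ m → estimate m (ℚ.<⇒≤ 0<B)) p≤B
    where
    1≤1+∣q∣ : 1ℚ ℚ.≤ 1ℚ ℚ.+ ℚ.∣ q ∣
    1≤1+∣q∣ = ≡.subst (ℚ._≤ 1ℚ ℚ.+ ℚ.∣ q ∣) (ℚ.+-identityʳ 1ℚ) (ℚ.+-monoʳ-≤ 1ℚ (ℚ.0≤∣p∣ q))
    ∣q∣≤1+∣q∣ : ℚ.∣ q ∣ ℚ.≤ 1ℚ ℚ.+ ℚ.∣ q ∣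
    ∣q∣≤1+∣q∣ = ≡.subst (ℚ._≤ 1ℚ ℚ.+ ℚ.∣ q ∣) (ℚ.+-identityˡ ℚ.∣ q ∣) (ℚ.+-monoˡ-≤ ℚ.∣ q ∣ 0≤1)
    0<bound : ∀ {B} → 0ℚ ℚ.< B → 0ℚ ℚ.< (1ℚ ℚ.+ ℚ.∣ q ∣) ℚ.* B
    0<bound {B} 0<B = ℚ.<-≤-trans (≡.subst (0ℚ ℚ.<_) (≡.sym (ℚ.*-identityˡ B)) 0<B) (*-mono-≤ 0≤1 1≤1+∣q∣ (ℚ.<⇒≤ 0<B) ℚ.≤-refl)
    estimate : ∀ m {B} → 0ℚ ℚ.≤ B → ℚ.∣ p m ∣ ℚ.≤ B → ‖ angle q m ‖ ℚ.≤ (1ℚ ℚ.+ ℚ.∣ q ∣) ℚ.* B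
    estimate m {B} 0≤B p≤B = ≡.subst (ℚ._≤ (1ℚ ℚ.+ ℚ.∣ q ∣) ℚ.* B)
      (≡.trans (≡.sym (ℚ.∣p*q∣≡∣p∣*∣q∣ q (p m))) (≡.sym (ℚ.+-identityˡ ℚ.∣ q ℚ.* p m ∣)))
      (*-mono-≤ (ℚ.0≤∣p∣ q) ∣q∣≤1+∣q∣ (ℚ.0≤∣p∣ (p m)) p≤B)

  -- y represents exp(iqp). Its bound is carried along because the limit of a product requires one.
  record Cis (q : ℚ) (y : GaussianSeq) : Set where
    constructor mkCis
    field
      bounded : BoundedSeq y
      limit   : ExpLimit (angle q) y

  cis-0 : Cis 0ℚ (λ _ → G.1#)
  cis-0 = mkCis (1ℚ , ℚ.positive⁻¹ 1ℚ , always² λ _ _ → ℚ.≤-refl)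
    (expLimit-cong {λ _ → G.0#} {angle 0ℚ} {λ _ → G.1#} (λ m → ≡.cong (0ℚ ,_) (≡.sym (ℚ.*-zeroˡ (p m)))) expLimit-0)

  cis-* : ∀ {q r y z} → Cis q y → Cis r z → Cis (q ℚ.+ r) (λ m → y m G.* z m)
  cis-* {q} {r} {y} {z} (mkCis by e) (mkCis bz f) = mkCis (bounded-* {y} {z} by bz)
    (expLimit-cong {λ m → angle q m G.+ angle r m} {angle (q ℚ.+ r)} {λ m → y m G.* z m}
      (λ m → ≡.cong (0ℚ ,_) (≡.sym (ℚ.*-distribʳ-+ (p m) q r)))
      (expLimit-+ {angle q} {angle r} {y} {z} (angle-bounded q) (angle-bounded r) by bz e f))

  cis-conj : ∀ {q y} → Cis q y → Cis (ℚ.- q) (conj ∘ y)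
  cis-conj {q} {y} (mkCis by e) = mkCis (bounded-conj {y} by)
    (expLimit-cong {conj ∘ angle q} {angle (ℚ.- q)} {conj ∘ y} (λ m → ≡.cong (0ℚ ,_) (ℚ.neg-distribˡ-* q (p m)))
      (expLimit-conj {angle q} {y} e))

  cis-unique : ∀ {q r y z} → q ≡ r → Cis q y → Cis r z → y ≍ z
  cis-unique ≡.refl (mkCis _ e) (mkCis _ f) = ≋-trans (≋-sym e) f

-- ℂ is an integral domain of characteristic zero

≈-eventually : ∀ {z w} → z ≈ w → ∀ {ε} → 0ℚ ℚ.< ε → Eventually λ m → ‖ z at m G.- w at m ‖ ℚ.< ε
≈-eventually {z} {w} e 0<ε = let N , p = ≈⇒≋ {z} {w} e .near 0<ε in p {N} ℕ.≤-refl

eventually-≈ : ∀ {z w} → (∀ {ε} → 0ℚ ℚ.< ε → Eventually λ m → ‖ z at m G.- w at m ‖ ℚ.< ε) → z ≈ w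
eventually-≈ {z} {w} f = ≋⇒≈ {z} {w} (mk≋ λ 0<ε → always λ _ → f 0<ε)

‖x-0‖ : ∀ x → ‖ x G.- G.0# ‖ ≡ ‖ x ‖
‖x-0‖ x = ‖‖-cong {x G.- G.0#} {x} (G.+-identityʳ x)

≈0-eventually : ∀ {z} → z ≈ 0# → ∀ {ε} → 0ℚ ℚ.< ε → Eventually λ m → ‖ z at m ‖ ℚ.< ε
≈0-eventually {z} e {ε} 0<ε = map₁ (λ m → ≡.subst (ℚ._< ε) (‖x-0‖ (z at m))) (≈-eventually {z} {0#} e 0<ε)

eventually-≈0 : ∀ {z} → (∀ {ε} → 0ℚ ℚ.< ε → Eventually λ m → ‖ z at m ‖ ℚ.< ε) → z ≈ 0#
eventually-≈0 {z} f = eventually-≈ {z} {0#} λ {ε} 0<ε → map₁ (λ m → ≡.subst (ℚ._< ε) (≡.sym (‖x-0‖ (z at m)))) (f 0<ε)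

eventually-witness : ∀ {P : ℕ → Set} → Eventually P → ∃[ n ] P n
eventually-witness (N , p) = N , p ℕ.≤-refl

cauchy-norm : ∀ z {ε} → 0ℚ ℚ.< ε → ∃[ N ] (∀ {m n} → N ℕ.≤ m → N ℕ.≤ n → ‖ z at m G.- z at n ‖ ℚ.< ε)
cauchy-norm z 0<ε =
  let δ , 0<δ , δ+δ≡ε = halve 0<ε
      M , p = cauchy (re z) 0<δ
      N , q = cauchy (im z) 0<δ
  in M ℕ.⊔ N , λ {m} {n} ≤m ≤n → ≡.subst (‖ z at m G.- z at n ‖ ℚ.<_) δ+δ≡ε (ℚ.+-mono-<
    (p (ℕ.m⊔n≤o⇒m≤o M N ≤m) (ℕ.m⊔n≤o⇒m≤o M N ≤n)) (q (ℕ.m⊔n≤o⇒n≤o M N ≤m) (ℕ.m⊔n≤o⇒n≤o M N ≤n)))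

-- Beyond N the sequence moves by less than η, so one decidable rational comparison at N suffices:
-- either all later terms are small, or all stay above η, which the hypothesis refutes.
not-apart⇒≈0 : ∀ z → (∀ {δ} → 0ℚ ℚ.< δ → ¬ Eventually λ m → δ ℚ.≤ ‖ z at m ‖) → z ≈ 0#
not-apart⇒≈0 z not-apart = eventually-≈0 {z} λ 0<ε →
  let δ , 0<δ , δ+δ≡ε = halve 0<ε
      η , 0<η , η+η≡δ = halve 0<δ
      N , close = cauchy-norm z 0<η
  in N , λ N≤m → small N 0<η η+η≡δ δ+δ≡ε (λ N≤m → close N≤m ℕ.≤-refl) N≤m
  where
  small : ∀ N {ε δ η m} → 0ℚ ℚ.< η → η ℚ.+ η ≡ δ → δ ℚ.+ δ ≡ ε →
    (∀ {m} → N ℕ.≤ m → ‖ z at m G.- z at N ‖ ℚ.< η) → N ℕ.≤ m → ‖ z at m ‖ ℚ.< ε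
  small N {ε} {δ} {η} {m} 0<η ≡.refl ≡.refl close N≤m with ‖ z at N ‖ ℚ.<? δ
  ... | yes z<δ = begin-strict
    ‖ z at m ‖                                  ≡⟨ ‖‖-cong (G.difference-cancel (z at m) (z at N)) ⟨
    ‖ (z at m G.- z at N) G.+ z at N ‖          ≤⟨ ‖x+y‖≤‖x‖+‖y‖ (z at m G.- z at N) (z at N) ⟩
    ‖ z at m G.- z at N ‖ ℚ.+ ‖ z at N ‖        <⟨ ℚ.+-mono-< (close N≤m) z<δ ⟩
    η ℚ.+ δ                                     ≤⟨ ℚ.+-monoˡ-≤ δ (≡.subst (ℚ._≤ η ℚ.+ η) (ℚ.+-identityʳ η) (ℚ.+-monoʳ-≤ η (ℚ.<⇒≤ 0<η))) ⟩
    δ ℚ.+ δ                                     ∎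
    where open ℚ.≤-Reasoning
  ... | no  z≮δ = contradiction (N , λ {n} N≤n → lower n N≤n) (not-apart 0<η)
    where
    open ℚ.≤-Reasoning
    lower : ∀ n → N ℕ.≤ n → η ℚ.≤ ‖ z at n ‖
    lower n N≤n = ℚ.≮⇒≥ λ z<η → z≮δ (begin-strict
      ‖ z at N ‖                                ≡⟨ ‖‖-cong (G.difference-cancel (z at N) (z at n)) ⟨
      ‖ (z at N G.- z at n) G.+ z at n ‖        ≤⟨ ‖x+y‖≤‖x‖+‖y‖ (z at N G.- z at n) (z at n) ⟩
      ‖ z at N G.- z at n ‖ ℚ.+ ‖ z at n ‖      ≡⟨ ≡.cong (ℚ._+ ‖ z at n ‖) (‖x-y‖≡‖y-x‖ (z at N) (z at n)) ⟩
      ‖ z at n G.- z at N ‖ ℚ.+ ‖ z at n ‖      <⟨ ℚ.+-mono-< (close N≤n) z<η ⟩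
      η ℚ.+ η                                   ∎)

normSquare : G.Carrier → ℚ
normSquare (a , b) = a ℚ.* a ℚ.+ b ℚ.* b

‖x‖²≤2normSquare : ∀ x → ‖ x ‖ ℚ.* ‖ x ‖ ℚ.≤ normSquare x ℚ.+ normSquare x
‖x‖²≤2normSquare (a , b) = begin
  (ℚ.∣ a ∣ ℚ.+ ℚ.∣ b ∣) ℚ.* (ℚ.∣ a ∣ ℚ.+ ℚ.∣ b ∣)
    ≡⟨ ℚ.+-identityʳ _ ⟨
  (ℚ.∣ a ∣ ℚ.+ ℚ.∣ b ∣) ℚ.* (ℚ.∣ a ∣ ℚ.+ ℚ.∣ b ∣) ℚ.+ 0ℚ
    ≤⟨ ℚ.+-monoʳ-≤ ((ℚ.∣ a ∣ ℚ.+ ℚ.∣ b ∣) ℚ.* (ℚ.∣ a ∣ ℚ.+ ℚ.∣ b ∣)) (0≤p² (ℚ.∣ a ∣ ℚ.- ℚ.∣ b ∣)) ⟩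
  (ℚ.∣ a ∣ ℚ.+ ℚ.∣ b ∣) ℚ.* (ℚ.∣ a ∣ ℚ.+ ℚ.∣ b ∣) ℚ.+ (ℚ.∣ a ∣ ℚ.- ℚ.∣ b ∣) ℚ.* (ℚ.∣ a ∣ ℚ.- ℚ.∣ b ∣)
    ≡⟨ parallelogram ℚ.+-*-commutativeRing ℚ.∣ a ∣ ℚ.∣ b ∣ ⟩
  (ℚ.∣ a ∣ ℚ.* ℚ.∣ a ∣ ℚ.+ ℚ.∣ b ∣ ℚ.* ℚ.∣ b ∣) ℚ.+ (ℚ.∣ a ∣ ℚ.* ℚ.∣ a ∣ ℚ.+ ℚ.∣ b ∣ ℚ.* ℚ.∣ b ∣)
    ≡⟨ ≡.cong₂ (λ u v → (u ℚ.+ v) ℚ.+ (u ℚ.+ v)) (square a) (square b) ⟩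
  normSquare (a , b) ℚ.+ normSquare (a , b) ∎
  where
  open ℚ.≤-Reasoning
  square : ∀ a → ℚ.∣ a ∣ ℚ.* ℚ.∣ a ∣ ≡ a ℚ.* a
  square a = ≡.trans (≡.sym (ℚ.∣p*q∣≡∣p∣*∣q∣ a a)) (ℚ.0≤p⇒∣p∣≡p (0≤p² a))

x*conj[x] : ∀ x → x G.* conj x G.≈ fromℝ (normSquare x)
x*conj[x] (a , b) = ℚ′.conjugate-product a b

-- Multiplying xy by the conjugate of y gives x times the square modulus of y, and
-- `‖x‖²≤2normSquare` compares that square with ‖y‖². The factor 2 is the price of the ℓ¹ norm.
‖x‖‖y‖≤2‖xy‖ : ∀ x y → 0ℚ ℚ.< ‖ y ‖ → ‖ x ‖ ℚ.* ‖ y ‖ ℚ.≤ ‖ x G.* y ‖ ℚ.+ ‖ x G.* y ‖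
‖x‖‖y‖≤2‖xy‖ x y 0<y = ℚ.*-cancelʳ-≤-pos ‖ y ‖ {{ℚ.positive 0<y}} (begin
  (‖ x ‖ ℚ.* ‖ y ‖) ℚ.* ‖ y ‖                          ≡⟨ ℚ.*-assoc ‖ x ‖ _ _ ⟩
  ‖ x ‖ ℚ.* (‖ y ‖ ℚ.* ‖ y ‖)                          ≤⟨ ℚ.*-monoˡ-≤-nonNeg ‖ x ‖ {{ℚ.nonNegative 0≤‖ x ‖}} (‖x‖²≤2normSquare y) ⟩
  ‖ x ‖ ℚ.* (normSquare y ℚ.+ normSquare y)            ≡⟨ ℚ.*-distribˡ-+ ‖ x ‖ (normSquare y) (normSquare y) ⟩
  ‖ x ‖ ℚ.* normSquare y ℚ.+ ‖ x ‖ ℚ.* normSquare y    ≤⟨ ℚ.+-mono-≤ bound bound ⟩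
  ‖ x G.* y ‖ ℚ.* ‖ y ‖ ℚ.+ ‖ x G.* y ‖ ℚ.* ‖ y ‖      ≡⟨ ℚ.*-distribʳ-+ ‖ y ‖ (‖ x G.* y ‖) (‖ x G.* y ‖) ⟨
  (‖ x G.* y ‖ ℚ.+ ‖ x G.* y ‖) ℚ.* ‖ y ‖              ∎)
  where
  open ℚ.≤-Reasoning
  0≤normSquare : ∀ x → 0ℚ ℚ.≤ normSquare x
  0≤normSquare (a , b) = ℚ.+-mono-≤ (0≤p² a) (0≤p² b)
  real-multiple : ∀ x {q} → 0ℚ ℚ.≤ q → ‖ x G.* fromℝ q ‖ ≡ ‖ x ‖ ℚ.* q
  real-multiple (a , b) {q} 0≤q = ≡.trans (‖‖-cong (ℚ′.real-multiple a b q))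
    (≡.trans (≡.cong₂ ℚ._+_ (scale a) (scale b)) (≡.sym (ℚ.*-distribʳ-+ q ℚ.∣ a ∣ ℚ.∣ b ∣)))
    where
    scale : ∀ a → ℚ.∣ a ℚ.* q ∣ ≡ ℚ.∣ a ∣ ℚ.* q
    scale a = ≡.trans (ℚ.∣p*q∣≡∣p∣*∣q∣ a q) (≡.cong (ℚ.∣ a ∣ ℚ.*_) (ℚ.0≤p⇒∣p∣≡p 0≤q))
  bound : ‖ x ‖ ℚ.* normSquare y ℚ.≤ ‖ x G.* y ‖ ℚ.* ‖ y ‖
  bound = begin
    ‖ x ‖ ℚ.* normSquare y              ≡⟨ real-multiple x (0≤normSquare y) ⟨
    ‖ x G.* fromℝ (normSquare y) ‖      ≡⟨ ‖‖-cong (G.*-congˡ {x} (x*conj[x] y)) ⟨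
    ‖ x G.* (y G.* conj y) ‖            ≡⟨ ‖‖-cong (G.*-assoc x y (conj y)) ⟨
    ‖ (x G.* y) G.* conj y ‖            ≤⟨ ‖x*y‖≤‖x‖*‖y‖ (x G.* y) (conj y) ⟩
    ‖ x G.* y ‖ ℚ.* ‖ conj y ‖          ≡⟨ ≡.cong (‖ x G.* y ‖ ℚ.*_) (‖conj‖ y) ⟩
    ‖ x G.* y ‖ ℚ.* ‖ y ‖               ∎

at-* : ∀ x y m → (x * y) at m ≡ x at m G.* y at m
at-* x y m = ≡.refl

-- If y stayed above some δ > 0, then ‖x‖ δ ≤ 2‖xy‖ would force x to be zero; so y is not apart from
-- zero, and `not-apart⇒≈0` concludes.
ℂ-domain : IsDomain ℂ-commutativeRing
ℂ-domain x y xy≈0 x≉0 = not-apart⇒≈0 y λ {δ} 0<δ y≥δ → x≉0 (eventually-≈0 {x} λ {ε} 0<ε →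
  let η , 0<η , η+η≡εδ = halve (0<* 0<ε 0<δ)
  in zip₁ (λ m y≥δ xy<η → bound m 0<δ η+η≡εδ y≥δ (≡.subst (λ z → ‖ z ‖ ℚ.< η) (at-* x y m) xy<η))
       y≥δ (≈0-eventually {x * y} xy≈0 0<η))
  where
  0<* : ∀ {p q} → 0ℚ ℚ.< p → 0ℚ ℚ.< q → 0ℚ ℚ.< p ℚ.* q
  0<* {p} {q} 0<p 0<q = ≡.subst (ℚ._< p ℚ.* q) (ℚ.*-zeroʳ p) (ℚ.*-monoʳ-<-pos p {{ℚ.positive 0<p}} 0<q)
  bound : ∀ m {δ ε η} → 0ℚ ℚ.< δ → η ℚ.+ η ≡ ε ℚ.* δ → δ ℚ.≤ ‖ y at m ‖ → ‖ x at m G.* y at m ‖ ℚ.< η → ‖ x at m ‖ ℚ.< ε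
  bound m {δ} {ε} {η} 0<δ η+η≡εδ y≥δ xy<η = ℚ.*-cancelʳ-<-nonNeg δ {{ℚ.nonNegative (ℚ.<⇒≤ 0<δ)}} (begin-strict
    ‖ x at m ‖ ℚ.* δ                                                ≤⟨ ℚ.*-monoˡ-≤-nonNeg ‖ x at m ‖ {{ℚ.nonNegative 0≤‖ x at m ‖}} y≥δ ⟩
    ‖ x at m ‖ ℚ.* ‖ y at m ‖                                       ≤⟨ ‖x‖‖y‖≤2‖xy‖ (x at m) (y at m) (ℚ.<-≤-trans 0<δ y≥δ) ⟩
    ‖ x at m G.* y at m ‖ ℚ.+ ‖ x at m G.* y at m ‖                 <⟨ ℚ.+-mono-< xy<η xy<η ⟩
    η ℚ.+ η                                                         ≡⟨ η+η≡εδ ⟩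
    ε ℚ.* δ                                                         ∎)
    where open ℚ.≤-Reasoning

module Cᶻ = IntegerCoefficients ℂ-commutativeRing

at-ι : ∀ n m → Cᶻ.ι (+ n) at m ≡ fromℝ (ν n)
at-ι zero          m = ≡.refl
at-ι (suc zero)    m = ≡.cong fromℝ (≡.sym (ℚ.+-identityʳ 1ℚ))
at-ι (suc (suc n)) m = ≡.trans (≡.cong (G._+ G.1#) (at-ι (suc n) m)) (≡.cong fromℝ (ℚ.+-comm (ν (suc n)) 1ℚ))

unit-norm⇒≉0 : ∀ z → (∀ m → 1ℚ ℚ.≤ ‖ z at m ‖) → ¬ z ≈ 0#
unit-norm⇒≉0 z 1≤z z≈0 =
  let m , z<1 = eventually-witness (≈0-eventually {z} z≈0 (ℚ.positive⁻¹ 1ℚ))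
  in ℚ.<-irrefl ≡.refl (ℚ.<-≤-trans z<1 (1≤z m))

1≤‖ι‖ : ∀ n m → 1ℚ ℚ.≤ ‖ Cᶻ.ι (+ suc n) at m ‖
1≤‖ι‖ n m = ≡.subst (1ℚ ℚ.≤_) (≡.sym (≡.trans (≡.cong ‖_‖ (at-ι (suc n) m)) (‖fromℝ‖ (0≤ν (suc n))))) (1≤ν n)

at-neg : ∀ z m → ‖ (- z) at m ‖ ≡ ‖ z at m ‖
at-neg z m = ‖-x‖≡‖x‖ (z at m)

ℂ-char0 : CharacteristicZero ℂ-commutativeRing
ℂ-char0 (+ zero)  _ = ≡.refl
ℂ-char0 (+ suc n) e = contradiction e (unit-norm⇒≉0 (Cᶻ.ι (+ suc n)) (1≤‖ι‖ n))
ℂ-char0 -[1+ n ]  e = contradiction e (unit-norm⇒≉0 (Cᶻ.ι -[1+ n ])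
  λ m → ≡.subst (1ℚ ℚ.≤_) (≡.sym (at-neg (Cᶻ.ι (+ suc n)) m)) (1≤‖ι‖ n m))

pointwise-≡ : ∀ {z w} → (∀ m → z at m ≡ w at m) → z ≈ w
pointwise-≡ {z} {w} e = pointwise {z} {w} λ m → G.reflexive {z at m} {w at m} (e m)

-- Conjugation, angles and the minimality of π in ℂ

conjugate : ℂ → ℂ
conjugate z = re z +i (-ᴿ im z)

conjugate-cong : ∀ {z w} → z ≈ w → conjugate z ≈ conjugate w
conjugate-cong {z} {w} e = ≋⇒≈ (conj-≋ {const-seq z} {const-seq w} (≈⇒≋ {z} {w} e))

ℂ-conjugation : Conjugation ℂ-commutativeRing
ℂ-conjugation = record
  { σ      = conjugate
  ; σ-cong = conjugate-cong
  ; σ-+    = λ z w → pointwise-≡ λ m → conj-+ (z at m) (w at m)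
  ; σ-*    = λ z w → pointwise-≡ λ m → conj-* (z at m) (w at m)
  ; σ-neg  = λ z → pointwise-≡ λ m → conj-neg (z at m)
  ; σ-1    = pointwise-≡ λ m → conj-1
  }
  where
  conj-1 : conj G.1# ≡ G.1#
  conj-1 = ≡.refl

Bounded-ℝ : ℝ → Set
Bounded-ℝ x = ∃[ B ] 0ℚ ℚ.< B × Eventually (λ m → ℚ.∣ seq x m ∣ ℚ.≤ B)

module Turn (π : ℝ) (π-bounded : Bounded-ℝ π) where
  module R = Rotation (seq π) π-bounded

  ℂ-phase : Phase ℂ-conjugation
  ℂ-phase = record
    { _at-angle_ = λ z q → R.Cis q (z at_)
    ; at-0       = R.cis-0
    ; at-+       = λ {x} {y} {q} {r} c d → R.cis-* {q} {r} {x at_} {y at_} c d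
    ; at-neg     = λ {x} {q} c → R.cis-conj {q} {x at_} c
    ; unique     = λ {x} {y} c d → ≋⇒≈ {x} {y} (R.cis-unique ≡.refl c d)
    }

  exp⇒cis : ∀ {q z w} → IsExp z w → (∀ m → z at m ≡ (0ℚ , q ℚ.* seq π m)) → R.Cis q (w at_)
  exp⇒cis {q} {z} {w} lim e = R.mkCis (bounded-const w) (expLimit-cong {z at_} {R.angle q} {w at_} e (exp⇒≋ {z} {w} lim))

  cis⇒exp : ∀ {q z w} → (∀ m → (0ℚ , q ℚ.* seq π m) ≡ z at m) → R.Cis q (w at_) → IsExp z w
  cis⇒exp {q} {z} {w} e (R.mkCis _ lim) = ≋⇒exp {z} {w} (expLimit-cong {R.angle q} {z at_} {w at_} e lim)

∣b-0∣≤∣b+b∣ : ∀ b → ℚ.∣ b ℚ.- 0ℚ ∣ ℚ.≤ ℚ.∣ b ℚ.- ℚ.- b ∣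
∣b-0∣≤∣b+b∣ b with ℚ.≤-total 0ℚ b
... | inj₁ 0≤b = bound
  where
  bound : ℚ.∣ b ℚ.- 0ℚ ∣ ℚ.≤ ℚ.∣ b ℚ.- ℚ.- b ∣
  bound = ≡.subst₂ ℚ._≤_ (≡.sym (≡.trans (≡.cong ℚ.∣_∣ (ℚ.+-identityʳ b)) (ℚ.0≤p⇒∣p∣≡p 0≤b)))
    (≡.sym (≡.trans (≡.cong ℚ.∣_∣ (ℚ′.minus-neg b)) (ℚ.0≤p⇒∣p∣≡p (ℚ.+-mono-≤ 0≤b 0≤b))))
    (≡.subst (ℚ._≤ b ℚ.+ b) (ℚ.+-identityʳ b) (ℚ.+-monoʳ-≤ b 0≤b))
... | inj₂ b≤0 = bound
  where
  ∣b∣ : ∀ {b} → b ℚ.≤ 0ℚ → ℚ.∣ b ∣ ≡ ℚ.- b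
  ∣b∣ {b} b≤0 = ≡.trans (≡.sym (ℚ.∣-p∣≡∣p∣ b)) (ℚ.0≤p⇒∣p∣≡p (ℚ.neg-antimono-≤ b≤0))
  bound : ℚ.∣ b ℚ.- 0ℚ ∣ ℚ.≤ ℚ.∣ b ℚ.- ℚ.- b ∣
  bound = ≡.subst₂ ℚ._≤_ (≡.sym (≡.trans (≡.cong ℚ.∣_∣ (ℚ.+-identityʳ b)) (∣b∣ b≤0)))
    (≡.sym (≡.trans (≡.cong ℚ.∣_∣ (ℚ′.minus-neg b)) (∣b∣ (ℚ.+-mono-≤ b≤0 b≤0))))
    (ℚ.neg-antimono-≤ (≡.subst (b ℚ.+ b ℚ.≤_) (ℚ.+-identityʳ b) (ℚ.+-monoʳ-≤ b b≤0)))

real⇒im≈0 : ∀ {z} → z ≈ conjugate z → im z ≈ᴿ 0ᴿ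
real⇒im≈0 {z} (mk≈ᶜ _ (mk≈ᴿ close)) = mk≈ᴿ λ 0<ε → map₁ (λ m → ℚ.≤-<-trans (∣b-0∣≤∣b+b∣ (seq (im z) m))) (close 0<ε)

im≈0⇒real : ∀ {z} → im z ≈ᴿ 0ᴿ → z ≈ conjugate z
im≈0⇒real {z} (mk≈ᴿ close) = mk≈ᶜ (_≈ᶜ_.re-≈ (C.refl {z})) (mk≈ᴿ λ {ε} 0<ε →
  let δ , 0<δ , δ+δ≡ε = halve 0<ε
  in map₁ (λ m b<δ → ≡.subst₂ ℚ._<_ ≡.refl δ+δ≡ε (bound (seq (im z) m) b<δ)) (close 0<δ))
  where
  bound : ∀ b {δ} → ℚ.∣ b ℚ.- 0ℚ ∣ ℚ.< δ → ℚ.∣ b ℚ.- ℚ.- b ∣ ℚ.< δ ℚ.+ δ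
  bound b {δ} b<δ = ℚ.≤-<-trans (ℚ.∣p-q∣≤∣p∣+∣q∣ b (ℚ.- b)) (ℚ.+-mono-<
    (≡.subst (λ x → ℚ.∣ x ∣ ℚ.< δ) (ℚ.+-identityʳ b) b<δ)
    (≡.subst (ℚ._< δ) (≡.trans (≡.cong ℚ.∣_∣ (ℚ.+-identityʳ b)) (≡.sym (ℚ.∣-p∣≡∣p∣ b))) b<δ))

0<-scale : ∀ {π x q} → (∀ m → seq x m ≡ q ℚ.* seq π m) → 0ℚ ℚ.< q → 0ᴿ <ᴿ π → 0ᴿ <ᴿ x
0<-scale {π} {x} {q} x≡qπ 0<q (mk<ᴿ g 0<g sep) = mk<ᴿ (q ℚ.* g) 0<qg (map₁ bound sep)
  where
  0<qg : 0ℚ ℚ.< q ℚ.* g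
  0<qg = ≡.subst (ℚ._< q ℚ.* g) (ℚ.*-zeroʳ q) (ℚ.*-monoʳ-<-pos q {{ℚ.positive 0<q}} 0<g)
  bound : ∀ m → 0ℚ ℚ.+ g ℚ.≤ seq π m → 0ℚ ℚ.+ q ℚ.* g ℚ.≤ seq x m
  bound m g≤π = ≡.subst₂ ℚ._≤_ (≡.sym (ℚ.+-identityˡ (q ℚ.* g))) (≡.sym (x≡qπ m))
    (ℚ.*-monoˡ-≤-nonNeg q {{ℚ.nonNegative (ℚ.<⇒≤ 0<q)}} (≡.subst (ℚ._≤ seq π m) (ℚ.+-identityˡ g) g≤π))

-- If π ≥ g eventually, then π - qπ = (1 - q)π ≥ (1 - q) g, and this is the gap supplied.
scale-< : ∀ {π x q} → (∀ m → seq x m ≡ q ℚ.* seq π m) → q ℚ.< 1ℚ → 0ᴿ <ᴿ π → x <ᴿ π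
scale-< {π} {x} {q} x≡qπ q<1 (mk<ᴿ g 0<g sep) = mk<ᴿ ((1ℚ ℚ.- q) ℚ.* g) 0<rg (map₁ bound sep)
  where
  0<r : 0ℚ ℚ.< 1ℚ ℚ.- q
  0<r = ≡.subst (ℚ._< 1ℚ ℚ.- q) (ℚ.+-inverseʳ q) (ℚ.+-monoˡ-< (ℚ.- q) q<1)
  0<rg : 0ℚ ℚ.< (1ℚ ℚ.- q) ℚ.* g
  0<rg = ≡.subst (ℚ._< (1ℚ ℚ.- q) ℚ.* g) (ℚ.*-zeroʳ (1ℚ ℚ.- q)) (ℚ.*-monoʳ-<-pos (1ℚ ℚ.- q) {{ℚ.positive 0<r}} 0<g)
  bound : ∀ m → 0ℚ ℚ.+ g ℚ.≤ seq π m → seq x m ℚ.+ (1ℚ ℚ.- q) ℚ.* g ℚ.≤ seq π m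
  bound m g≤π = ≡.subst₂ ℚ._≤_ (≡.cong (ℚ._+ (1ℚ ℚ.- q) ℚ.* g) (≡.sym (x≡qπ m))) (ℚ′.complement q (seq π m))
    (ℚ.+-monoʳ-≤ (q ℚ.* seq π m) (ℚ.*-monoˡ-≤-nonNeg (1ℚ ℚ.- q) {{ℚ.nonNegative (ℚ.<⇒≤ 0<r)}} (≡.subst (ℚ._≤ seq π m) (ℚ.+-identityˡ g) g≤π)))

module LeastZero (π : ℝ) (π-bounded : Bounded-ℝ π) (0<π : 0ᴿ <ᴿ π)
  (least : ∀ x → 0ᴿ <ᴿ x → x <ᴿ π → ¬ IsSin x 0ᴿ) where
  open Turn π π-bounded

  -- A real y has imaginary part 0, so qπ would be a zero of sin strictly between 0 and π.
  not-real : ∀ q y → 0ℚ ℚ.< q → q ℚ.< 1ℚ → R.Cis q (y at_) → ¬ y ≈ conjugate y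
  not-real q y 0<q q<1 c real = no-zero (fromℚ q *ᴿ π) λ _ → ≡.refl
    where
    no-zero : ∀ x → ¬ (∀ m → seq x m ≡ q ℚ.* seq π m)
    no-zero x x≡qπ = least x (0<-scale {π} {x} x≡qπ 0<q 0<π) (scale-< {π} {x} x≡qπ q<1 0<π)
      (y , cis⇒exp {q} {0ᴿ +i x} {y} (λ m → ≡.cong (0ℚ ,_) (≡.sym (x≡qπ m))) c , real⇒im≈0 {y} real)

-- Overlaps in ℂ

2/k≡1/k+1/k : ∀ k .{{_ : NonZero k}} → + 2 ℚ./ k ≡ + 1 ℚ./ k ℚ.+ + 1 ℚ./ k
2/k≡1/k+1/k k = begin
  d                                    ≡⟨ ℚ.*-identityˡ d ⟨
  1ℚ ℚ.* d                             ≡⟨ ≡.cong (ℚ._* d) (≡.trans (ℚ.*-comm c (ν k)) (ν*[n/d]≡ν 1 k)) ⟨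
  (c ℚ.* ν k) ℚ.* d                    ≡⟨ ℚ.*-assoc c (ν k) d ⟩
  c ℚ.* (ν k ℚ.* d)                    ≡⟨ ≡.cong (c ℚ.*_) (ν*[n/d]≡ν 2 k) ⟩
  c ℚ.* (1ℚ ℚ.+ 1ℚ)                    ≡⟨ ℚ.*-distribˡ-+ c 1ℚ 1ℚ ⟩
  c ℚ.* 1ℚ ℚ.+ c ℚ.* 1ℚ                ≡⟨ ≡.cong₂ ℚ._+_ (ℚ.*-identityʳ c) (ℚ.*-identityʳ c) ⟩
  c ℚ.+ c                              ∎
  where
  open ≡.≡-Reasoning
  c d : ℚ
  c = + 1 ℚ./ k
  d = + 2 ℚ./ k

-- Moves an equation between the operations of Defs and those of ℂ-commutativeRing, whose
-- rational approximations agree by definition.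
≈-transport : ∀ {A B X Y} → A ≈ B → (∀ m → X at m ≡ A at m) → (∀ m → B at m ≡ Y at m) → X ≈ Y
≈-transport {A} {B} {X} {Y} A≈B X≡A B≡Y = C.trans {X} {A} {Y} (pointwise-≡ {X} {A} X≡A) (C.trans {A} {B} {Y} A≈B (pointwise-≡ {B} {Y} B≡Y))

module OverlapsTrivial (k : ℕ) {{_ : NonZero k}} (2∤k : ¬ (2 ∣ k)) (c d : ℚ) (kc≡1 : ν k ℚ.* c ≡ 1ℚ) (d≡c+c : d ≡ c ℚ.+ c)
  (φ : ℂ) (π : ℝ) (π-bounded : Bounded-ℝ π) (0<π : 0ᴿ <ᴿ π)
  (w : ℂ) (exp-w : IsExp (0ᴿ +i π) w) (im-w≈0 : im w ≈ᴿ 0ᴿ) (least : ∀ x → 0ᴿ <ᴿ x → x <ᴿ π → ¬ IsSin x 0ᴿ)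
  (exp-φ : IsExp (0ᴿ +i (fromℚ d *ᴿ π)) φ) where
  open Turn π π-bounded
  open LeastZero π π-bounded 0<π least

  cis-φ : R.Cis (c ℚ.+ c) (φ at_)
  cis-φ = exp⇒cis {c ℚ.+ c} {0ᴿ +i (fromℚ d *ᴿ π)} {φ} exp-φ at-angle
    where
    at-angle : ∀ m → (0ᴿ +i (fromℚ d *ᴿ π)) at m ≡ (0ℚ , (c ℚ.+ c) ℚ.* seq π m)
    at-angle m = ≡.cong (λ q → 0ℚ , q ℚ.* seq π m) d≡c+c

  cis-w : R.Cis 1ℚ (w at_)
  cis-w = exp⇒cis {1ℚ} {0ᴿ +i π} {w} exp-w at-angle
    where
    at-angle : ∀ m → (0ᴿ +i π) at m ≡ (0ℚ , 1ℚ ℚ.* seq π m)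
    at-angle m = ≡.cong (0ℚ ,_) (≡.sym (ℚ.*-identityˡ (seq π m)))

  open OverlapsOfRootOfUnity ℂ-phase ℂ-domain ℂ-char0 k 2∤k {w} {φ} {c} kc≡1
    cis-w cis-φ (im≈0⇒real {w} im-w≈0) not-real using (overlap-trivial)

  overlaps-trivial : Overlap k φ ⊆ Trivial k
  overlaps-trivial {i , j ∣ s , t} (i∈ , j∈ , s∈ , t∈ , _ , ω , _ , eq) =
    classify (overlap-trivial {ω} {i} {j} {s} {t} (∤ i∈) (∤ j∈) (∤ s∈) (∤ t∈) (≈-transport eq
      (λ m → ≡.refl {x = (φ ^ ω) at m G.* (((φ ^ j) at m G.- G.1#) G.* ((φ ^ s) at m G.- G.1#))})
      (λ m → ≡.refl {x = ((φ ^ i) at m G.- G.1#) G.* ((φ ^ t) at m G.- G.1#)})))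
    where
    ∤ : ∀ {n} → 1 ℕ.≤ n × n ℕ.< k → ¬ k ∣ n
    ∤ (1≤n , n<k) = >⇒∤ {{ℕ.>-nonZero 1≤n}} n<k
    classify : (i ≡± j mod k) ⊎ (s ≡± i mod k) → Trivial k (i , j ∣ s , t)
    classify (inj₁ i≡±j) = inj₁ i≡±j
    classify (inj₂ s≡±i) = inj₂ (inj₂ (inj₂ s≡±i))

theorem27 : ∀ (k : ℕ) .{{_ : NonZero k}} → 3 ≤ k → ¬ (2 ∣ k) →
    ∀ (φ : ℂ) → IsExp[2πi/ k ] φ →
    Empty (𝒪 k φ) × (Overlap k φ ⊆ Trivial k)
theorem27 k {{nonZero}} 3≤k 2∤k φ (π , (0<π , (w , exp-w , im-w≈0) , least) , exp-φ) = (λ _ (isOverlap , nontrivial) → nontrivial (trivial isOverlap)) , trivial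
  where
  instance
    k≢0 : NonZero k
    k≢0 = ℕ.>-nonZero (ℕ.≤-trans (ℕ.s≤s ℕ.z≤n) 3≤k)
  trivial : Overlap k φ ⊆ Trivial k
  trivial = OverlapsTrivial.overlaps-trivial k {{k≢0}} 2∤k (+ 1 ℚ./ k) ((+ 2 ℚ./ k) {{nonZero}})
    (ν*[n/d]≡ν 1 k) (2/k≡1/k+1/k k) φ π (cauchy-bounded {seq π} (cauchy π)) 0<π w exp-w im-w≈0 least exp-φ
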